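{- Let $\mathbf r,\mathbf c\in\mathbb Z_{>0}^3$ with $r_1+r_2+r_3=c_1+c_2+c_3$, and let $\operatorname{T}_{\mathbf r\mathbf c}$ be the corresponding $3\times3$ transportation polytope. If $\operatorname{T}_{\mathbf r\mathbf c}$ is not a multiple of the Birkhoff polytope $B_3$ (i.e. it is not the case that $\mathbf r=\mathbf c=(k,k,k)$ for some positive integer $k$), then $\operatorname{T}_{\mathbf r\mathbf c}$ has a quadratic triangulation.
   Context: The $3\times3$ transportation polytope $\operatorname{T}_{\mathbf r\mathbf c}\subset\mathbb R^{9}$ is the set of all real nonnegative $3\times3$ matrices with row sums $r_1,r_2,r_3$ and column sums $c_1,c_2,c_3$; it is a lattice polytope with respect to $\mathbb Z^9$. $B_3=\operatorname{T}_{(1,1,1),(1,1,1)}$. For a triangulation of a lattice polytope $P$ with vertices among the lattice points $P\cap\mathbb Z^d$, a subset $F\subseteq P\cap\mathbb Z^d$ is a face if $\operatorname{conv}(F)$ is a simplex of the triangulation, and a non-face otherwise. A quadratic triangulation of $P$ is a regular (i.e. induced by a height function on the lattice points) unimodular (every maximal simplex has normalized volume $1$ with respect to the lattice of the affine span of $P$) triangulation of $P$ with vertices in $P\cap\mathbb Z^d$, all of whose minimal non-faces have exactly two elements.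
   Formalization: That the simplices of the triangulation cover the transportation polytope is stated for its rational points only; covering of all real points follows because rational points are dense and a finite union of simplices is closed. -}

module Defs where

open import Data.Nat as ℕ using (ℕ)
open import Data.Integer as ℤ using (ℤ; +_)
open import Data.Rational as ℚ using (ℚ; 0ℚ; 1ℚ)
open import Data.Fin using (Fin; zero; suc)
open import Data.Vec using (Vec; lookup)
open import Data.Vec.Membership.Propositional as VM using ()
open import Data.List using (List; length)
open import Data.List.Membership.Propositional as LM using ()
open import Data.List.Relation.Unary.All using (All)
open import Data.List.Relation.Unary.Unique.Propositional using (Unique)
open import Data.Product using (Σ; ∃; _×_; _,_)
open import Relation.Binary.PropositionalEquality using (_≡_)
open import Relation.Nullary using (¬_)

sum3ℕ : (Fin 3 → ℕ) → ℕ
sum3ℕ f = f zero ℕ.+ (f (suc zero) ℕ.+ f (suc (suc zero)))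

sum3ℤ : (Fin 3 → ℤ) → ℤ
sum3ℤ f = f zero ℤ.+ (f (suc zero) ℤ.+ f (suc (suc zero)))

sum3ℚ : (Fin 3 → ℚ) → ℚ
sum3ℚ f = f zero ℚ.+ (f (suc zero) ℚ.+ f (suc (suc zero)))

sum4ℤ : (Fin 4 → ℤ) → ℤ
sum4ℤ f = f zero ℤ.+ sum3ℤ (λ k → f (suc k))

sum5ℚ : (Fin 5 → ℚ) → ℚ
sum5ℚ f = f zero ℚ.+ (f (suc zero) ℚ.+ sum3ℚ (λ k → f (suc (suc k))))

toℚ : ℤ → ℚ
toℚ z = z ℚ./ 1

ℕtoℚ : ℕ → ℚ
ℕtoℚ n = toℚ (+ n)

-- 3×3 matrices.  Lattice points of ℝ^9 = ℤ^9 are 3×3 integer matrices;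
-- points of T_rc are nonnegative, so lattice points of T_rc are 3×3
-- matrices over ℕ, stored as vectors (so that ≡ is the right equality).

LMat : Set
LMat = Vec (Vec ℕ 3) 3

entry : LMat → Fin 3 → Fin 3 → ℕ
entry M i j = lookup (lookup M i) j

InT : (r c : Fin 3 → ℕ) → LMat → Set
InT r c M = (∀ i → sum3ℕ (λ j → entry M i j) ≡ r i)
          × (∀ j → sum3ℕ (λ i → entry M i j) ≡ c j)

QMat : Set
QMat = Fin 3 → Fin 3 → ℚ

InTℚ : (r c : Fin 3 → ℕ) → QMat → Set
InTℚ r c X = (∀ i j → 0ℚ ℚ.≤ X i j)
           × (∀ i → sum3ℚ (λ j → X i j) ≡ ℕtoℚ (r i))
           × (∀ j → sum3ℚ (λ i → X i j) ≡ ℕtoℚ (c j))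

-- integer 3×3 matrices with all row and column sums zero:
-- the lattice of the (linear space parallel to the) affine span of T_rc
ZMat : Set
ZMat = Fin 3 → Fin 3 → ℤ

ZeroMargins : ZMat → Set
ZeroMargins M = (∀ i → sum3ℤ (λ j → M i j) ≡ + 0)
              × (∀ j → sum3ℤ (λ i → M i j) ≡ + 0)

-- Simplices.  T_rc (r, c positive) is 4-dimensional, so a maximal
-- simplex of a triangulation has 5 vertices, all lattice points.

Simplex : Set
Simplex = Vec LMat 5

vert : Simplex → Fin 5 → LMat
vert σ k = lookup σ k

edge : Simplex → Fin 4 → ZMat
edge σ k i j = + entry (vert σ (suc k)) i j ℤ.- + entry (vert σ zero) i j

-- normalized volume 1 w.r.t. the lattice of the affine span:
-- the edge vectors v_1-v_0,…,v_4-v_0 generate that lattice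
Unimodular : Simplex → Set
Unimodular σ = ∀ (M : ZMat) → ZeroMargins M →
  Σ (Fin 4 → ℤ) λ a → ∀ i j → M i j ≡ sum4ℤ (λ k → a k ℤ.* edge σ k i j)

record Affine : Set where
  constructor affine
  field
    coeff : Fin 3 → Fin 3 → ℚ
    const : ℚ

evalAff : Affine → LMat → ℚ
evalAff (affine A b) M =
  b ℚ.+ sum3ℚ (λ i → sum3ℚ (λ j → A i j ℚ.* ℕtoℚ (entry M i j)))

InConv : QMat → Simplex → Set
InConv X σ = Σ (Fin 5 → ℚ) λ λs →
    (∀ k → 0ℚ ℚ.≤ λs k) × sum5ℚ λs ≡ 1ℚ
  × (∀ i j → X i j ≡ sum5ℚ (λ k → λs k ℚ.* ℕtoℚ (entry (vert σ k) i j)))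

-- A regular unimodular triangulation of T_rc with vertices among its
-- lattice points, given by its list of maximal simplices:
--  * every vertex is a lattice point of T_rc;
--  * every maximal simplex is unimodular;
--  * the simplices cover T_rc;
--  * regularity: there is a height function ω on the lattice points
--    such that every maximal simplex σ is a lower facet of the lifted
--    point configuration: the affine function agreeing with ω on the
--    vertices of σ lies strictly below ω at every other lattice point.
record RegUnimodTriang (r c : Fin 3 → ℕ) : Set where
  field
    simplices  : List Simplex
    vertsInT   : ∀ σ → σ LM.∈ simplices → ∀ k → InT r c (vert σ k)
    unimodular : ∀ σ → σ LM.∈ simplices → Unimodular σ
    covers     : ∀ X → InTℚ r c X → ∃ λ σ → σ LM.∈ simplices × InConv X σ
    height     : LMat → ℚ
    lowerFacet : ∀ σ → σ LM.∈ simplices → Σ Affine λ ℓ →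
        (∀ k → evalAff ℓ (vert σ k) ≡ height (vert σ k))
      × (∀ M → InT r c M → ¬ (M VM.∈ σ) → evalAff ℓ M ℚ.< height M)

module _ {r c : Fin 3 → ℕ} (T : RegUnimodTriang r c) where
  open RegUnimodTriang T

  -- F ⊆ P ∩ ℤ^9 is a face iff conv(F) is a simplex of the triangulation,
  -- i.e. F is a set of vertices of some maximal simplex.
  IsFace : List LMat → Set
  IsFace F = ∃ λ σ → σ LM.∈ simplices × All (λ v → v VM.∈ σ) F

  MinimalNonFace : List LMat → Set
  MinimalNonFace F = Unique F × All (InT r c) F × ¬ IsFace F
    × (∀ G → All (λ v → v LM.∈ F) G → ¬ All (λ v → v LM.∈ G) F → IsFace G)

IsQuadratic : {r c : Fin 3 → ℕ} → RegUnimodTriang r c → Set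
IsQuadratic T = ∀ F → MinimalNonFace T F → length F ≡ 2

HasQuadraticTriangulation : (r c : Fin 3 → ℕ) → Set
HasQuadraticTriangulation r c =
  Σ (RegUnimodTriang r c) IsQuadratic

{-# OPTIONS --safe #-}
module Submission where

-- Some row sum is at least 2, since otherwise r = c = (1,1,1); number that row 0 and call the other
-- two p and q.  Slice T by the hyperplanes pⱼ ∈ ℤ and qⱼ ∈ ℤ only.  The cells are products of two unit
-- triangles, truncated by inequalities x₀ⱼ ≥ 0; their lattice points are a subset of the edges of K₃,₃,
-- and unimodular simplices correspond to spanning trees.  Every translate of B₃ sits inside a larger
-- cell, because r₀ ≥ 2 leaves room in row 0.  The height ω = N (Σ pⱼ² + Σ qⱼ²) + β(p, q), with N large
-- and a suitable bilinear form β, induces these slices and refines each cell by optimal transport: a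
-- spanning tree is a lower facet iff its potential is dual feasible for the costs ±β.  A finite
-- computation over the types of cells shows that these triangulations are flag.
--
-- Call a pair a, b of lattice points reducible if a + b = a' + b' with ω a' + ω b' < ω a + ω b.  Edges are
-- irreducible, and an irreducible set lies in one simplex: exchanging along a circuit of K₃,₃ conformal
-- to a − b shows that its points differ by at most 1 in each pⱼ and qⱼ, hence they share a cell (the one
-- around a perturbation of their barycentre into the interior), and cells are flag.  This gives flagness,
-- and also the covering: a rational point with denominator D is a sum of D lattice points divided by D,
-- and the exchanges reduce these points to an irreducible family.

open import Defs
open import Data.Bool using (Bool; true; false; T; T?; not; _∧_; _∨_; if_then_else_)
open import Data.Bool.ListAction using (any; all)
open import Data.Bool.Properties using (T-∧; T-∨; T-≡)
open import Data.Empty using (⊥; ⊥-elim)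
open import Data.Fin using (Fin; zero; suc)
open import Data.Fin.Properties using (any?; all?; ¬∀⟶∃¬)
open import Data.Integer as ℤ using (ℤ)
import Data.Integer.Properties as ℤP
open import Data.List as List using (List; []; _∷_; _++_; length; concatMap; filterᵇ)
open import Data.List.Membership.Propositional using (_∈_; find; lose)
import Data.List.Membership.DecPropositional as DecMembership
import Data.List.Membership.Propositional.Properties as ∈P
import Data.List.Properties as ListP
open import Data.List.Relation.Binary.Permutation.Propositional using (_↭_; ↭-refl; ↭-trans; prep; swap)
import Data.List.Relation.Binary.Permutation.Propositional.Properties as ↭P
open import Data.List.Relation.Unary.All as All using (All; []; _∷_)
import Data.List.Relation.Unary.All.Properties as AllP
open import Data.List.Relation.Unary.AllPairs using (AllPairs; []; _∷_)
open import Data.List.Relation.Unary.Any as Any using (Any; here; there)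
import Data.List.Relation.Unary.Any.Properties as AnyP
open import Data.Maybe using (Maybe; just; nothing; fromMaybe)
open import Data.Nat as ℕ using (ℕ; zero; suc; z≤n; s≤s; NonZero)
open import Data.Nat.DivMod using (_/_; _%_; m≡m%n+[m/n]*n; m%n<n)
open import Data.Nat.Induction using (<-wellFounded)
open import Data.Nat.ListAction using (sum)
open import Data.Nat.ListAction.Properties using (sum-↭)
import Data.Nat.Properties as ℕP
open import Data.Product using (Σ; ∃; ∃₂; _×_; _,_; proj₁; proj₂)
open import Data.Rational as ℚ using (ℚ; 0ℚ; 1ℚ; mkℚ)
import Data.Rational.Properties as ℚP
open import Data.Rational.Unnormalised using (mkℚᵘ; _≃_; *≡*; *<*)
import Data.Rational.Unnormalised.Properties as ℚᵘP
open import Data.Sum as Sum using (_⊎_; inj₁; inj₂)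
open import Data.Unit using (tt)
open import Data.Vec as Vec using (Vec; []; _∷_; lookup; tabulate)
import Data.Vec.Membership.DecPropositional as VDec
open import Data.Vec.Membership.Propositional as VM using ()
import Data.Vec.Membership.Propositional.Properties as VMP
open import Data.Vec.N-ary using (N-ary; curryⁿ; _$ⁿ_; ∀ⁿ)
open import Data.Vec.Properties using (lookup-map; lookup∘tabulate; tabulate∘lookup; tabulate-cong; ≡-dec)
open import Data.Vec.Relation.Unary.Any as VAny using (here; there)
import Data.Vec.Relation.Unary.Any.Properties as VAnyP
open import Function using (_∘_; Equivalence)
open import Induction.WellFounded using (Acc; acc)
open import Relation.Binary.PropositionalEquality
open import Relation.Nullary using (¬_; yes; no; Dec; ⌊_⌋; _×-dec_)
open import Relation.Nullary.Decidable using (toWitness; fromWitness)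

-- The obstacle is B₃ itself: its six lattice points carry a single affine relation, even against
-- odd permutation matrices, so each of its triangulations has a minimal non-face with three
-- elements. In the encoding of cells below, B₃ is the product of two upward triangles with all
-- three inequalities x₀ⱼ ≥ 0 tight. Row 0 of the matrix `K` that encodes a cell sums to
-- `r₀ + size o₁ + size o₂ - 3`; with `2 ≤ r₀` this is positive, so the three inequalities are never
-- tight together.
--
-- One finite check serves all `r` and `c` because β is bilinear: up to an affine function, the
-- height on a cell depends only on the orientations of the two triangles and on the tight columns.
--
-- The perturbation into the interior is needed because the boxes around a boundary point may meet T
-- in a set of smaller dimension, which contains no spanning tree. Around a point with positive row
-- 0 the box can be chosen so that it meets T in a full-dimensional cell.

-- Linear arithmetic over ℕ by reflective Fourier-Motzkin elimination

module LinearArithmetic where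

  open import Data.Integer using (+_; -[1+_])
  open import Data.Integer.Solver using (module +-*-Solver)

  -- A form (c , a) stands for the inequality c + Σ aᵢ xᵢ ≥ 0 in natural-number unknowns.
  Form : ℕ → Set
  Form n = ℤ × Vec ℤ n

  dot : ∀ {n} → Vec ℤ n → Vec ℕ n → ℤ
  dot []       []       = + 0
  dot (a ∷ as) (x ∷ xs) = a ℤ.* + x ℤ.+ dot as xs

  evalForm : ∀ {n} → Vec ℕ n → Form n → ℤ
  evalForm ρ (c , as) = c ℤ.+ dot as ρ

  NonNeg : ∀ {n} → Vec ℕ n → Form n → Set
  NonNeg ρ φ = + 0 ℤ.≤ evalForm ρ φ

  linComb : ∀ {n} → ℤ → Form n → ℤ → Form n → Form n
  linComb k (c , as) l (d , bs) =
    k ℤ.* c ℤ.+ l ℤ.* d , Vec.zipWith (λ a b → k ℤ.* a ℤ.+ l ℤ.* b) as bs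

  dot-linComb : ∀ {n} k l (as bs : Vec ℤ n) ρ →
    dot (Vec.zipWith (λ a b → k ℤ.* a ℤ.+ l ℤ.* b) as bs) ρ ≡ k ℤ.* dot as ρ ℤ.+ l ℤ.* dot bs ρ
  dot-linComb k l [] [] [] = solve 2 (λ k l → con (+ 0) := k :* con (+ 0) :+ l :* con (+ 0)) refl k l
    where open +-*-Solver
  dot-linComb k l (a ∷ as) (b ∷ bs) (x ∷ ρ) rewrite dot-linComb k l as bs ρ =
    solve 7 (λ k l a b x u v → (k :* a :+ l :* b) :* x :+ (k :* u :+ l :* v)
                            := k :* (a :* x :+ u) :+ l :* (b :* x :+ v))
      refl k l a b (+ x) (dot as ρ) (dot bs ρ)
    where open +-*-Solver

  evalForm-linComb : ∀ {n} k l (φ ψ : Form n) ρ →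
    evalForm ρ (linComb k φ l ψ) ≡ k ℤ.* evalForm ρ φ ℤ.+ l ℤ.* evalForm ρ ψ
  evalForm-linComb k l (c , as) (d , bs) ρ rewrite dot-linComb k l as bs ρ =
    solve 6 (λ k l c d u v → (k :* c :+ l :* d) :+ (k :* u :+ l :* v)
                          := k :* (c :+ u) :+ l :* (d :+ v))
      refl k l c d (dot as ρ) (dot bs ρ)
    where open +-*-Solver

  nonNeg-linComb : ∀ {n} {ρ : Vec ℕ n} k l (φ ψ : Form n) →
    NonNeg ρ φ → NonNeg ρ ψ → NonNeg ρ (linComb (+ k) φ (+ l) ψ)
  nonNeg-linComb {ρ = ρ} k l φ ψ p q =
    subst (+ 0 ℤ.≤_) (sym (evalForm-linComb (+ k) (+ l) φ ψ ρ))
      (ℤP.+-mono-≤ (scale k p) (scale l q))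
    where
    scale : ∀ k {x} → + 0 ℤ.≤ x → + 0 ℤ.≤ + k ℤ.* x
    scale k {x} 0≤x = subst (ℤ._≤ + k ℤ.* x) (ℤP.*-zeroʳ (+ k)) (ℤP.*-monoˡ-≤-nonNeg (+ k) 0≤x)

  unknown : ∀ {n} → Fin n → Vec ℤ n
  unknown zero    = + 1 ∷ Vec.replicate _ (+ 0)
  unknown (suc i) = + 0 ∷ unknown i

  dot-zero : ∀ {n} (ρ : Vec ℕ n) → dot (Vec.replicate n (+ 0)) ρ ≡ + 0
  dot-zero []      = refl
  dot-zero (x ∷ ρ) = trans (ℤP.+-identityˡ _) (dot-zero ρ)

  dot-unknown : ∀ {n} (i : Fin n) ρ → dot (unknown i) ρ ≡ + lookup ρ i
  dot-unknown zero (x ∷ ρ) rewrite dot-zero ρ = trans (ℤP.+-identityʳ _) (ℤP.*-identityˡ (+ x))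
  dot-unknown (suc i) (x ∷ ρ) rewrite dot-unknown i ρ = ℤP.+-identityˡ _

  coefficient : ∀ {n} → Fin n → Form n → ℤ
  coefficient i (_ , as) = lookup as i

  isPos isNeg isZero : ℤ → Bool
  isPos (+ suc _) = true
  isPos _         = false
  isNeg -[1+ _ ]  = true
  isNeg _         = false
  isZero (+ 0)    = true
  isZero _        = false

  -- Meant for φ with positive and ψ with negative i-th coefficient.
  cancel : ∀ {n} → Fin n → Form n → Form n → Form n
  cancel i φ ψ = linComb (+ ℤ.∣ coefficient i ψ ∣) φ (+ ℤ.∣ coefficient i φ ∣) ψ

  nonNegCoefficients : ∀ {n} → Form n → Bool
  nonNegCoefficients (c , as) = all (not ∘ isNeg) (c ∷ Vec.toList as)

  -- The bounds x ≥ 0 are implicit: that of the eliminated unknown joins the positive forms, and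
  -- forms without a negative constant or coefficient are dropped because they hold for all natural
  -- numbers.
  eliminate : ∀ {n} → Fin n → List (Form n) → List (Form n)
  eliminate i φs = filterᵇ (not ∘ nonNegCoefficients)
    (filterᵇ (isZero ∘ coefficient i) φs ++
     concatMap (λ φ → List.map (cancel i φ) (filterᵇ (isNeg ∘ coefficient i) φs))
       ((+ 0 , unknown i) ∷ filterᵇ (isPos ∘ coefficient i) φs))

  -- Counts the combinations that the elimination creates; the successor accounts for the extra form
  -- xᵢ ≥ 0.
  cost : ∀ {n} → Fin n → List (Form n) → ℕ
  cost i φs = suc (List.length (filterᵇ (isPos ∘ coefficient i) φs))
              ℕ.* List.length (filterᵇ (isNeg ∘ coefficient i) φs)

  cheapest : ∀ {n} → List (Fin n) → Fin n → List (Form n) → Fin n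
  cheapest is i₀ φs = proj₁ (List.foldr step (i₀ , 0) is)
    where
    step : Fin _ → Fin _ × ℕ → Fin _ × ℕ
    -- Cost 0 in the accumulator means that nothing is chosen yet. An unknown of cost 0 has no
    -- negative coefficient, so a large value satisfies every form in which it is positive, and its
    -- elimination cannot help.
    step i (j , 0) = if cost i φs ℕ.≤ᵇ 0 then (j , 0) else (i , cost i φs)
    step i (j , m) = if cost i φs ℕ.≤ᵇ 0 then (j , m)
                     else if m ℕ.≤ᵇ cost i φs then (j , m) else (i , cost i φs)

  negative : ∀ {n} → Form n → Bool
  negative (c , as) = isNeg c ∧ all (not ∘ isPos) (Vec.toList as)

  -- Fourier–Motzkin elimination; the first argument bounds the number of eliminated unknowns.
  refutes : ∀ {n} → ℕ → List (Form n) → Bool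
  refutes zero φs = any negative φs
  refutes {zero}  (suc fuel) φs = any negative φs
  refutes {suc n} (suc fuel) φs =
    any negative φs ∨ refutes fuel (eliminate (cheapest (List.allFin (suc n)) zero φs) φs)

  nonNeg-unknown : ∀ {n} (ρ : Vec ℕ n) i → NonNeg ρ (+ 0 , unknown i)
  nonNeg-unknown ρ i = subst (+ 0 ℤ.≤_)
    (sym (trans (ℤP.+-identityˡ _) (dot-unknown i ρ))) (ℤ.+≤+ ℕ.z≤n)

  eliminate-sound : ∀ {n} (ρ : Vec ℕ n) i {φs} → All (NonNeg ρ) φs → All (NonNeg ρ) (eliminate i φs)
  eliminate-sound ρ i {φs} ps =
    AllP.filter⁺ (T? ∘ not ∘ nonNegCoefficients)
      (AllP.++⁺ (AllP.filter⁺ (T? ∘ isZero ∘ coefficient i) ps)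
        (AllP.concat⁺ (AllP.map⁺ (All.map
          (λ {φ} p → AllP.map⁺ (All.map
             (λ {ψ} q → nonNeg-linComb ℤ.∣ coefficient i ψ ∣ ℤ.∣ coefficient i φ ∣ φ ψ p q)
             (AllP.filter⁺ (T? ∘ isNeg ∘ coefficient i) ps)))
          (nonNeg-unknown ρ i ∷ AllP.filter⁺ (T? ∘ isPos ∘ coefficient i) ps)))))

  dot-nonPos : ∀ {n} (as : Vec ℤ n) ρ → T (all (not ∘ isPos) (Vec.toList as)) → dot as ρ ℤ.≤ + 0
  dot-nonPos []             []      _ = ℤP.≤-refl
  dot-nonPos (+ 0 ∷ as)     (x ∷ ρ) t = subst (ℤ._≤ + 0) (sym (ℤP.+-identityˡ _)) (dot-nonPos as ρ t)
  dot-nonPos (-[1+ a ] ∷ as) (x ∷ ρ) t =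
    ℤP.+-mono-≤ (ℤP.≤-trans (ℤP.*-monoˡ-≤-nonPos -[1+ a ] {+ 0} {+ x} (ℤ.+≤+ ℕ.z≤n))
                            (ℤP.≤-reflexive (ℤP.*-zeroʳ -[1+ a ])))
      (dot-nonPos as ρ t)

  negative-sound : ∀ {n} (ρ : Vec ℕ n) φ → T (negative φ) → ¬ NonNeg ρ φ
  negative-sound ρ (-[1+ c ] , as) t 0≤φ =
    ℤP.<-irrefl refl (ℤP.≤-<-trans 0≤φ (ℤP.+-mono-<-≤ {x = -[1+ c ]} {y = + 0} ℤ.-<+ (dot-nonPos as ρ t)))

  any-negative-sound : ∀ {n} (ρ : Vec ℕ n) φs → T (any negative φs) → ¬ All (NonNeg ρ) φs
  any-negative-sound ρ (φ ∷ φs) t (p ∷ ps) with Equivalence.to T-∨ t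
  ... | inj₁ t' = negative-sound ρ φ t' p
  ... | inj₂ t' = any-negative-sound ρ φs t' ps

  refutes-sound : ∀ {n} fuel (ρ : Vec ℕ n) φs → T (refutes fuel φs) → ¬ All (NonNeg ρ) φs
  refutes-sound zero ρ φs t ps = any-negative-sound ρ φs t ps
  refutes-sound {zero}  (suc fuel) ρ φs t ps = any-negative-sound ρ φs t ps
  refutes-sound {suc n} (suc fuel) ρ φs t ps with Equivalence.to T-∨ t
  ... | inj₁ t' = any-negative-sound ρ φs t' ps
  ... | inj₂ t' = refutes-sound fuel ρ _ t' (eliminate-sound ρ (cheapest (List.allFin (suc n)) zero φs) ps)

  infixl 8 _:*_
  infixl 7 _:+_
  infix  6 _:≤_ _:<_ _:≡_
  infix  2 _⊢_

  data Exp (n : ℕ) : Set where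
    var  : Fin n → Exp n
    con  : ℕ → Exp n
    _:+_ : Exp n → Exp n → Exp n
    _:*_ : ℕ → Exp n → Exp n

  ⟦_⟧ : ∀ {n} → Exp n → Vec ℕ n → ℕ
  ⟦ var i ⟧  ρ = lookup ρ i
  ⟦ con k ⟧  ρ = k
  ⟦ e :+ f ⟧ ρ = ⟦ e ⟧ ρ ℕ.+ ⟦ f ⟧ ρ
  ⟦ k :* e ⟧ ρ = k ℕ.* ⟦ e ⟧ ρ

  form : ∀ {n} → Exp n → Form n
  form (var i)  = + 0 , unknown i
  form (con k)  = + k , Vec.replicate _ (+ 0)
  form (e :+ f) = linComb (+ 1) (form e) (+ 1) (form f)
  form (k :* e) = linComb (+ k) (form e) (+ 0) (form e)

  evalForm-form : ∀ {n} (e : Exp n) ρ → evalForm ρ (form e) ≡ + ⟦ e ⟧ ρ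
  evalForm-form (var i) ρ = trans (ℤP.+-identityˡ _) (dot-unknown i ρ)
  evalForm-form (con k) ρ = trans (cong (λ z → + k ℤ.+ z) (dot-zero ρ)) (ℤP.+-identityʳ _)
  evalForm-form (e :+ f) ρ
    rewrite evalForm-linComb (+ 1) (+ 1) (form e) (form f) ρ | evalForm-form e ρ | evalForm-form f ρ =
    cong₂ ℤ._+_ (ℤP.*-identityˡ (+ ⟦ e ⟧ ρ)) (ℤP.*-identityˡ (+ ⟦ f ⟧ ρ))
  evalForm-form (k :* e) ρ
    rewrite evalForm-linComb (+ k) (+ 0) (form e) (form e) ρ | evalForm-form e ρ =
    trans (ℤP.+-identityʳ _) (sym (ℤP.pos-* k (⟦ e ⟧ ρ)))

  data Con (n : ℕ) : Set where
    _:≤_ _:<_ _:≡_ : Exp n → Exp n → Con n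
    false : Con n

  Holds : ∀ {n} → Con n → Vec ℕ n → Set
  Holds (e :≤ f) ρ = ⟦ e ⟧ ρ ℕ.≤ ⟦ f ⟧ ρ
  Holds (e :< f) ρ = ⟦ e ⟧ ρ ℕ.< ⟦ f ⟧ ρ
  Holds (e :≡ f) ρ = ⟦ e ⟧ ρ ≡ ⟦ f ⟧ ρ
  Holds false    ρ = ⊥

  leForm ltForm : ∀ {n} → Exp n → Exp n → Form n
  leForm e f = linComb (+ 1) (form f) (ℤ.- + 1) (form e)
  ltForm e f = linComb (+ 1) (form f) (ℤ.- + 1) (form (con 1 :+ e))

  leForm-sound : ∀ {n} (e f : Exp n) ρ → ⟦ e ⟧ ρ ℕ.≤ ⟦ f ⟧ ρ → NonNeg ρ (leForm e f)
  leForm-sound e f ρ p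
    rewrite evalForm-linComb (+ 1) (ℤ.- + 1) (form f) (form e) ρ
          | evalForm-form e ρ | evalForm-form f ρ
          | ℤP.*-identityˡ (+ ⟦ f ⟧ ρ) | ℤP.-1*i≡-i (+ ⟦ e ⟧ ρ) =
    ℤP.i≤j⇒0≤j-i (ℤ.+≤+ p)

  hypothesisForms : ∀ {n} → Con n → List (Form n)
  hypothesisForms (e :≤ f) = leForm e f ∷ []
  hypothesisForms (e :< f) = ltForm e f ∷ []
  hypothesisForms (e :≡ f) = leForm e f ∷ leForm f e ∷ []
  hypothesisForms false    = []

  hypothesisForms-sound : ∀ {n} (C : Con n) ρ → Holds C ρ → All (NonNeg ρ) (hypothesisForms C)
  hypothesisForms-sound (e :≤ f) ρ p = leForm-sound e f ρ p ∷ []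
  hypothesisForms-sound (e :< f) ρ p = leForm-sound (con 1 :+ e) f ρ p ∷ []
  hypothesisForms-sound (e :≡ f) ρ p =
    leForm-sound e f ρ (ℕP.≤-reflexive p) ∷ leForm-sound f e ρ (ℕP.≤-reflexive (sym p)) ∷ []
  hypothesisForms-sound false ρ ()

  -- The elimination is rational; integrality enters because the negation of `≤`, like a strict
  -- hypothesis, is sharpened by one in `ltForm`.
  entails : ∀ {n} → List (Form n) → Con n → Bool
  entails {n} φs (e :≤ f) = refutes n (ltForm f e ∷ φs)
  entails {n} φs (e :< f) = refutes n (leForm f e ∷ φs)
  entails {n} φs (e :≡ f) = refutes n (ltForm f e ∷ φs) ∧ refutes n (ltForm e f ∷ φs)
  entails {n} φs false    = refutes n φs

  entails-sound : ∀ {n} (ρ : Vec ℕ n) φs C → T (entails φs C) → All (NonNeg ρ) φs → Holds C ρ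
  entails-sound {n} ρ φs (e :≤ f) t ps = ℕP.≮⇒≥ λ q →
    refutes-sound n ρ _ t (leForm-sound (con 1 :+ f) e ρ q ∷ ps)
  entails-sound {n} ρ φs (e :< f) t ps = ℕP.≰⇒> λ q →
    refutes-sound n ρ _ t (leForm-sound f e ρ q ∷ ps)
  entails-sound {n} ρ φs (e :≡ f) t ps = let t₁ , t₂ = Equivalence.to T-∧ t in ℕP.≤-antisym
    (ℕP.≮⇒≥ λ q → refutes-sound n ρ _ t₁ (leForm-sound (con 1 :+ f) e ρ q ∷ ps))
    (ℕP.≮⇒≥ λ q → refutes-sound n ρ _ t₂ (leForm-sound (con 1 :+ e) f ρ q ∷ ps))
  entails-sound {n} ρ φs false t ps = refutes-sound n ρ φs t ps

  record Sequent (n : ℕ) : Set where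
    constructor _⊢_
    field
      hypotheses : List (Con n)
      conclusion : Con n

  HoldsSequent : ∀ {n} → Sequent n → Vec ℕ n → Set
  HoldsSequent (hs ⊢ g) ρ = go hs
    where
    go : List (Con _) → Set
    go []       = Holds g ρ
    go (h ∷ hs) = Holds h ρ → go hs

  valid : ∀ {n} → Sequent n → Bool
  valid (hs ⊢ g) = entails (concatMap hypothesisForms hs) g

  valid-sound : ∀ {n} (S : Sequent n) → T (valid S) → ∀ ρ → HoldsSequent S ρ
  valid-sound (hs ⊢ g) t ρ = go hs (entails-sound ρ _ g t)
    where
    go : ∀ hs → (All (NonNeg ρ) (concatMap hypothesisForms hs) → Holds g ρ) → HoldsSequent (hs ⊢ g) ρ
    go []       k = k []
    go (h ∷ hs) k = λ p → go hs (λ ps → k (AllP.++⁺ (hypothesisForms-sound h ρ p) ps))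

  sequent : ∀ n → N-ary n (Exp n) (Sequent n) → Sequent n
  sequent n f = f $ⁿ Vec.tabulate var

  -- The hidden argument reduces to the unit type when the elimination succeeds, so a use supplies
  -- only the unknowns and the hypotheses. Nonlinear terms are passed as unknowns of their own.
  linarith : ∀ n (f : N-ary n (Exp n) (Sequent n)) → {T (valid (sequent n f))} →
    ∀ⁿ n (curryⁿ (HoldsSequent (sequent n f)))
  linarith n f {t} = go n (valid-sound (sequent n f) t)
    where
    go : ∀ m {P : Vec ℕ m → Set} → (∀ ρ → P ρ) → ∀ⁿ m (curryⁿ P)
    go zero    p = p []
    go (suc m) p = λ x → go m (λ ρ → p (x ∷ ρ))

open LinearArithmetic using (linarith; _⊢_; con; _:+_; _:*_; _:≤_; _:<_; _:≡_; false)

-- Cells as truncated products of unit triangles, and the finite check of flagness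

module TriangleProducts where

  open import Data.Integer using (+_)

  pattern 0F = zero
  pattern 1F = suc zero
  pattern 2F = suc (suc zero)

  sameIndex : Fin 3 → Fin 3 → Bool
  sameIndex 0F 0F = true
  sameIndex 1F 1F = true
  sameIndex 2F 2F = true
  sameIndex _  _  = false

  Position : Set
  Position = Fin 3 × Fin 3

  samePosition : Position → Position → Bool
  samePosition (i , j) (k , l) = sameIndex i k ∧ sameIndex j l

  -- The vertices of an upward unit triangle are the unit vectors, those of a downward one their complements in (1,1,1).
  corner : Bool → Fin 3 → Fin 3 → ℕ
  corner up i l = if sameIndex i l then (if up then 1 else 0) else (if up then 0 else 1)

  -- The coefficients were found by search: on every product of two unit triangles, truncated by any
  -- admissible set of tight inequalities x₀ⱼ ≥ 0, this form has to induce a flag triangulation.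
  bilinear : (Fin 3 → ℕ) → (Fin 3 → ℕ) → ℕ
  bilinear p q = p 0F ℕ.* q 0F ℕ.+ p 0F ℕ.* q 2F ℕ.+ 2 ℕ.* (p 1F ℕ.* q 2F) ℕ.+ 2 ℕ.* (p 2F ℕ.* q 0F)

  -- Expanding `bilinear` around the floors of a cell leaves this matrix besides affine terms. Up to
  -- summands in `i` alone or in `j` alone it is β(eᵢ, eⱼ) for equal orientations and its negative
  -- for opposite ones.
  cellCost : Bool → Bool → Fin 3 → Fin 3 → ℕ
  cellCost o o' i j = bilinear (corner o i) (corner o' j)

  every : (Fin 3 → Bool) → Bool
  every f = f 0F ∧ (f 1F ∧ f 2F)

  -- In column `l` of a cell point, row 0 is `K 0F l + 1` minus two corner entries. This is negative
  -- only if `K 0F l` is 0 and both corner entries are 1; `t` marks the columns in which `K 0F l` is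
  -- 0.
  allowed : Bool → Bool → Vec Bool 3 → Position → Bool
  allowed o o' t (i , j) = every λ l → not (lookup t l ∧ (2 ℕ.≤ᵇ corner o i l ℕ.+ corner o' j l))

  count : Vec Bool 3 → ℕ
  count = Vec.foldr′ (λ b n → if b then suc n else n) 0

  -- Three tight columns would force r₀ ≤ 1, and with two upward triangles such a cell is a
  -- translate of B₃. Two downward triangles with two tight columns leave only two lattice points.
  admissible : Bool → Bool → Vec Bool 3 → Bool
  admissible false false t = count t ℕ.≤ᵇ 1
  admissible _     _     t = count t ℕ.≤ᵇ 2

  Edges : Set
  Edges = Vec Position 5

  Potential : Set
  Potential = Vec ℤ 3 × Vec ℤ 3

  value : Potential → Position → ℤ
  value (a , b) (i , j) = lookup a i ℤ.+ lookup b j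

  Partial : Set
  Partial = Vec (Maybe ℤ) 3 × Vec (Maybe ℤ) 3

  propagate : Position → ℤ → Partial → Partial
  propagate (i , j) w (a , b) with lookup a i | lookup b j
  ... | just x  | nothing = a , b Vec.[ j ]≔ just (w ℤ.- x)
  ... | nothing | just y  = a Vec.[ i ]≔ just (w ℤ.- y) , b
  ... | _       | _       = a , b

  -- Normalised by the value 0 at the first row. On a spanning tree each sweep settles at least one
  -- of the five other nodes until all are settled, so five sweeps are enough; the default 0 is
  -- reached only for disconnected edge sets.
  potential : Edges → (Fin 5 → ℤ) → Potential
  potential es w = let (a , b) = iterate 5 start in Vec.map (fromMaybe (+ 0)) a , Vec.map (fromMaybe (+ 0)) b
    where
    start : Partial
    start = (just (+ 0) ∷ nothing ∷ nothing ∷ []) , (nothing ∷ nothing ∷ nothing ∷ [])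
    sweep : Partial → Partial
    sweep s = List.foldr (λ k → propagate (lookup es k) (w k)) s (List.allFin 5)
    iterate : ℕ → Partial → Partial
    iterate zero    s = s
    iterate (suc n) s = iterate n (sweep s)

  indicator : ∀ {n} → Fin n → Fin n → ℤ
  indicator zero    zero    = + 1
  indicator (suc i) (suc j) = indicator i j
  indicator _       _       = + 0

  sum5ℤ : (Fin 5 → ℤ) → ℤ
  sum5ℤ f = f zero ℤ.+ sum4ℤ (λ k → f (suc k))

  -- The weight which a flow on a spanning tree puts on an edge is a linear function of its divergences,
  -- whose coefficients are the potential of the indicator cost of that edge.
  flowWeights : Vec Potential 5 → (Fin 3 → ℤ) → (Fin 3 → ℤ) → Vec ℤ 5
  flowWeights πs δ η = Vec.map
    (λ (a , b) → sum3ℤ (λ i → lookup a i ℤ.* δ i) ℤ.+ sum3ℤ (λ j → lookup b j ℤ.* η j)) πs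

  outflow : Edges → (Fin 5 → ℤ) → Fin 3 → ℤ
  outflow es w i = sum5ℤ (λ k → w k ℤ.* indicator (proj₁ (lookup es k)) i)

  inflow : Edges → (Fin 5 → ℤ) → Fin 3 → ℤ
  inflow es w j = sum5ℤ (λ k → w k ℤ.* indicator (proj₂ (lookup es k)) j)

  isFlow : Edges → (Fin 3 → ℤ) → (Fin 3 → ℤ) → (Fin 5 → ℤ) → Bool
  isFlow es δ η w = every (λ i → ⌊ outflow es w i ℤ.≟ δ i ⌋) ∧ every (λ j → ⌊ inflow es w j ℤ.≟ η j ⌋)

  difference : Fin 3 → Fin 3 → ℤ
  difference i l = indicator i l ℤ.- indicator 0F l

  none : Fin 3 → ℤ
  none _ = + 0

  -- The differences generate all integer vectors with sum zero, so these four flows yield all those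
  -- whose divergences on the rows and on the columns sum to zero separately.
  solvesFlows : Edges → Vec Potential 5 → Bool
  solvesFlows es πs = solves (difference 1F) none ∧ (solves (difference 2F) none
                    ∧ (solves none (difference 1F) ∧ solves none (difference 2F)))
    where
    solves : (Fin 3 → ℤ) → (Fin 3 → ℤ) → Bool
    solves δ η = isFlow es δ η (lookup (flowWeights πs δ η))

  opaque
    flowPotentials : Edges → Vec Potential 5
    flowPotentials es = Vec.tabulate (λ k → potential es (indicator k))

  spansFlows : Edges → Bool
  spansFlows es = solvesFlows es (flowPotentials es)

  positions : List Position
  positions = List.cartesianProduct (List.allFin 3) (List.allFin 3)

  choose : ∀ {A : Set} n → List A → List (Vec A n)
  choose zero    _        = [] ∷ []
  choose (suc n) []       = []
  choose (suc n) (x ∷ xs) = List.map (x ∷_) (choose n xs) ++ choose (suc n) xs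

  -- Of the 126 choices the 81 spanning trees of K₃,₃ remain: an edge set that fails to join all
  -- rows, or all columns, to each other cannot carry one of the four test flows.
  spanningTrees : List Edges
  spanningTrees = filterᵇ spansFlows (choose 5 positions)

  _isIn_ : Position → Edges → Bool
  p isIn es = any (samePosition p) (Vec.toList es)

  opaque
    costPotential : Bool → Bool → Edges → Potential
    costPotential o o' es = potential es (λ k → let (i , j) = lookup es k in + cellCost o o' i j)

  -- Dual feasibility with complementary slackness for the transportation problem on the cell.
  optimalAt : Bool → Bool → Vec Bool 3 → Edges → Potential → Position → Bool
  optimalAt o o' t es π p@(i , j) =
    if p isIn es then allowed o o' t (i , j) ∧ ⌊ value π p ℤ.≟ + cellCost o o' i j ⌋
    else not (allowed o o' t (i , j)) ∨ ⌊ value π p ℤ.<? + cellCost o o' i j ⌋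

  -- The bound 10 is what `N` reserves for the potentials; it reappears in the summands
  -- `40 * S + 61`.
  bounded : ℤ → Bool
  bounded z = ℤ.∣ z ∣ ℕ.≤ᵇ 10

  optimalFor : Bool → Bool → Vec Bool 3 → Edges → Potential → Bool
  optimalFor o o' t es π =
      every (λ i → every λ j → optimalAt o o' t es π (i , j))
    ∧ every (λ i → bounded (lookup (proj₁ π) i) ∧ bounded (lookup (proj₂ π) i))

  opaque
    optimal : Bool → Bool → Vec Bool 3 → Edges → Bool
    optimal o o' t es = optimalFor o o' t es (costPotential o o' es)

    optimal-potential : ∀ o o' t es → T (optimal o o' t es) → T (optimalFor o o' t es (costPotential o o' es))
    optimal-potential o o' t es h = h

  -- One diagonal of a 2×2 minor is exchanged for the other. If the exchange is feasible and
  -- strictly cheaper, the two lattice points form a reducible pair.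
  conflict : Bool → Bool → Vec Bool 3 → Position → Position → Bool
  conflict o o' t (i , j) (k , l) =
    allowed o o' t (i , l) ∧ (allowed o o' t (k , j) ∧
    (suc (cellCost o o' i l ℕ.+ cellCost o o' k j) ℕ.≤ᵇ cellCost o o' i j ℕ.+ cellCost o o' k l))

  module _ (optimal : Edges → Bool) (allowed : Position → Bool) (conflict : Position → Position → Bool) where

    -- A backtracking search through all sets of pairwise compatible positions. A branch that would
    -- add a conflicting position counts as passed, and every completed set has to lie in one tree
    -- of `es`.
    cliquesCovered : List Edges → List Position → List Position → Bool
    cliquesCovered es []       chosen = any (λ e → all (_isIn e) chosen) es
    cliquesCovered es (p ∷ ps) chosen =
      cliquesCovered es ps chosen ∧
      (if any (conflict p) chosen then true else cliquesCovered es ps (p ∷ chosen))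

    flag : List Edges → List Position → Bool
    flag trees ps = cliquesCovered (filterᵇ optimal trees) (filterᵇ allowed ps) []

  flagCell : Bool → Bool → Vec Bool 3 → List Edges → List Position → Bool
  flagCell o o' t trees ps =
    not (admissible o o' t) ∨ flag (optimal o o' t) (allowed o o' t) (conflict o o' t) trees ps

  everyBool : (Bool → Bool) → Bool
  everyBool f = f true ∧ f false

  -- `trees` and `ps` stay variables, so that all deductions from the check are independent of the
  -- concrete lists on which it is evaluated.
  flagCells : List Edges → List Position → Bool
  flagCells trees ps = everyBool λ o → everyBool λ o' → everyBool λ x → everyBool λ y → everyBool λ z →
    flagCell o o' (x ∷ y ∷ z ∷ []) trees ps

  T-∧⁻ : ∀ {x y} → T (x ∧ y) → T x × T y
  T-∧⁻ = Equivalence.to T-∧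

  every-sound : ∀ f → T (every f) → ∀ i → T (f i)
  every-sound f t 0F = proj₁ (T-∧⁻ t)
  every-sound f t 1F = proj₁ (T-∧⁻ (proj₂ (T-∧⁻ {f 0F} t)))
  every-sound f t 2F = proj₂ (T-∧⁻ {f 1F} (proj₂ (T-∧⁻ {f 0F} t)))

  everyBool-sound : ∀ f → T (everyBool f) → ∀ b → T (f b)
  everyBool-sound f t true  = proj₁ (T-∧⁻ t)
  everyBool-sound f t false = proj₂ (T-∧⁻ {f true} t)

  position∈ : ∀ p → p ∈ positions
  position∈ (i , j) = ∈P.∈-cartesianProduct⁺ (∈P.∈-allFin i) (∈P.∈-allFin j)

  module _ {optimal : Edges → Bool} {allowed : Position → Bool} {conflict : Position → Position → Bool}
           (g : Position → Bool) (compatible : ∀ p q → T (g p) → T (g q) → ¬ T (conflict p q)) where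

    -- The predicate `g` is the clique under consideration and singles out one branch of the search.
    -- Since `compatible` excludes the exit by a conflict, the branch ends at a tree that contains
    -- the clique.
    cliquesCovered-sound : ∀ es ps chosen →
      T (cliquesCovered optimal allowed conflict es ps chosen) → All (T ∘ g) chosen →
      ∃ λ e → e ∈ es × All (λ p → T (p isIn e)) chosen × (∀ p → p ∈ ps → T (g p) → T (p isIn e))
    cliquesCovered-sound es [] chosen c gs =
      let e , e∈ , h = find (AnyP.any⁻ (λ e → all (_isIn e) chosen) es c)
      in e , e∈ , AllP.all⁺ (_isIn e) chosen h , λ _ ()
    cliquesCovered-sound es (p ∷ ps) chosen c gs with T-∧⁻ c | g p in gp
    ... | c₁ , _ | false =
      let e , e∈ , h , h' = cliquesCovered-sound es ps chosen c₁ gs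
      in e , e∈ , h , λ { q (here refl) gq → ⊥-elim (subst T gp gq) ; q (there q∈) gq → h' q q∈ gq }
    ... | _ , c₂ | true with any (conflict p) chosen in eq
    ...   | true =
      let q , q∈ , bad = find (AnyP.any⁻ (conflict p) chosen (subst T (sym eq) tt))
      in ⊥-elim (compatible p q (subst T (sym gp) tt) (All.lookup gs q∈) bad)
    ...   | false with cliquesCovered-sound es ps (p ∷ chosen) c₂ (subst T (sym gp) tt ∷ gs)
    ...     | e , e∈ , (hp ∷ h) , h' =
      e , e∈ , h , λ { q (here refl) _ → hp ; q (there q∈) gq → h' q q∈ gq }

    flag-sound : ∀ trees ps → T (flag optimal allowed conflict trees ps) → (∀ p → T (g p) → T (allowed p)) →
      ∃ λ e → e ∈ trees × T (optimal e) × (∀ p → p ∈ ps → T (g p) → T (p isIn e))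
    flag-sound trees ps c g⊆allowed =
      let e , e∈ , _ , h = cliquesCovered-sound (filterᵇ optimal trees) (filterᵇ allowed ps) [] c []
          e∈trees , opt = ∈P.∈-filter⁻ (T? ∘ optimal) {xs = trees} e∈
      in e , e∈trees , opt , λ p p∈ gp → h p (∈P.∈-filter⁺ (T? ∘ allowed) p∈ (g⊆allowed p gp)) gp

  ∨-resolve : ∀ {x y} → T (not x ∨ y) → T x → T y
  ∨-resolve {true} y _ = y

  flagCells-sound : ∀ trees ps → T (flagCells trees ps) → ∀ o o' t → T (flagCell o o' t trees ps)
  flagCells-sound trees ps c o o' (x ∷ y ∷ z ∷ []) =
    everyBool-sound (λ z → flagCell o o' (x ∷ y ∷ z ∷ []) trees ps)
      (everyBool-sound (λ y → everyBool λ z → flagCell o o' (x ∷ y ∷ z ∷ []) trees ps)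
        (everyBool-sound (λ x → everyBool λ y → everyBool λ z → flagCell o o' (x ∷ y ∷ z ∷ []) trees ps)
          (everyBool-sound
            (λ o' → everyBool λ x → everyBool λ y → everyBool λ z → flagCell o o' (x ∷ y ∷ z ∷ []) trees ps)
            (everyBool-sound
              (λ o → everyBool λ o' → everyBool λ x → everyBool λ y → everyBool λ z →
                flagCell o o' (x ∷ y ∷ z ∷ []) trees ps)
              c o)
            o')
          x)
        y)
      z

open TriangleProducts

-- Matrices with given margins: circuits, integer decomposition, balancing

module Matrices where

  open import Data.Nat using (_+_; _*_; _∸_; _≤_; _<_)
  open import Data.Nat.Properties using (_<?_; _≤?_; ≮⇒≥; ≤-refl; ≤-trans; m≤m+n)
  open import Data.Nat.Tactic.RingSolver using (solve-∀)

  Mat : Set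
  Mat = Fin 3 → Fin 3 → ℕ

  Margins : (r c : Fin 3 → ℕ) → Mat → Set
  Margins r c x = (∀ i → sum3ℕ (x i) ≡ r i) × (∀ j → sum3ℕ (λ i → x i j) ≡ c j)

  ∀3 : ∀ {ℓ} {P : Fin 3 → Set ℓ} → P 0F → P 1F → P 2F → ∀ i → P i
  ∀3 a b c 0F = a
  ∀3 a b c 1F = b
  ∀3 a b c 2F = c

  sum3ℕ-cong : ∀ {f g} → (∀ i → f i ≡ g i) → sum3ℕ f ≡ sum3ℕ g
  sum3ℕ-cong h = cong₂ _+_ (h 0F) (cong₂ _+_ (h 1F) (h 2F))

  -- `fold-to` covers every commutative and associative operation because sums over both ℕ and ℤ get
  -- permuted. A self-inverse permutation serves for both directions of a relabelling.
  record Involution : Set₁ where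
    field
      to         : Fin 3 → Fin 3
      involutive : ∀ i → to (to i) ≡ i
      fold-to    : ∀ {A : Set} (_∙_ : A → A → A) →
                   (∀ x y z → (x ∙ y) ∙ z ≡ x ∙ (y ∙ z)) → (∀ x y → x ∙ y ≡ y ∙ x) →
                   ∀ (f : Fin 3 → A) → f (to 0F) ∙ (f (to 1F) ∙ f (to 2F)) ≡ f 0F ∙ (f 1F ∙ f 2F)

    sum-to : ∀ (f : Fin 3 → ℕ) → sum3ℕ (f ∘ to) ≡ sum3ℕ f
    sum-to = fold-to _+_ ℕP.+-assoc ℕP.+-comm

  transposition : Fin 3 → Fin 3 → Fin 3
  transposition 0F i  = i
  transposition 1F 0F = 1F
  transposition 1F 1F = 0F
  transposition 1F 2F = 2F
  transposition 2F 0F = 2F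
  transposition 2F 1F = 1F
  transposition 2F 2F = 0F

  module _ {A : Set} (_∙_ : A → A → A)
           (assoc : ∀ x y z → (x ∙ y) ∙ z ≡ x ∙ (y ∙ z)) (comm : ∀ x y → x ∙ y ≡ y ∙ x) where

    swap-first : ∀ x y z → y ∙ (x ∙ z) ≡ x ∙ (y ∙ z)
    swap-first x y z = trans (sym (assoc y x z)) (trans (cong (_∙ z) (comm y x)) (assoc x y z))

    fold-transposition : ∀ k (f : Fin 3 → A) → let g = f ∘ transposition k in
      g 0F ∙ (g 1F ∙ g 2F) ≡ f 0F ∙ (f 1F ∙ f 2F)
    fold-transposition 0F f = refl
    fold-transposition 1F f = swap-first (f 0F) (f 1F) (f 2F)
    fold-transposition 2F f = trans (cong (f 2F ∙_) (comm (f 1F) (f 0F)))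
      (trans (swap-first (f 0F) (f 2F) (f 1F)) (cong (f 0F ∙_) (comm (f 2F) (f 1F))))

  swapping : Fin 3 → Involution
  swapping k = record { to = transposition k ; involutive = involutive k
                      ; fold-to = λ _∙_ assoc comm → fold-transposition _∙_ assoc comm k }
    where
    involutive : ∀ k i → transposition k (transposition k i) ≡ i
    involutive 0F = λ _ → refl
    involutive 1F = ∀3 refl refl refl
    involutive 2F = ∀3 refl refl refl

  swap12 : Involution
  swap12 = record { to = ∀3 0F 2F 1F ; involutive = ∀3 refl refl refl
                  ; fold-to = λ _∙_ _ comm f → cong (f 0F ∙_) (comm (f 2F) (f 1F)) }

  -- The last two indices are the entries of `u` and `d`: a unit step from `p` is permitted only
  -- where it does not overshoot `q`, which is conformality.
  data Toward (p q : ℕ) : ℕ → ℕ → Set where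
    stay : Toward p q 0 0
    up   : p < q → Toward p q 1 0
    down : q < p → Toward p q 0 1

  -- A circuit u − d (a signed alternating cycle of K₃,₃) conformal to q − p.
  record Circuit (p q : Mat) (i j : Fin 3) : Set where
    field
      u d       : Mat
      rows      : ∀ k → sum3ℕ (u k) ≡ sum3ℕ (d k)
      columns   : ∀ l → sum3ℕ (λ k → u k l) ≡ sum3ℕ (λ k → d k l)
      toward    : ∀ k l → Toward (p k l) (q k l) (u k l) (d k l)
      decreases : d i j ≡ 1

  conjugate : (π ρ : Involution) → Mat → Mat
  conjugate π ρ x k l = x (Involution.to π k) (Involution.to ρ l)

  conjugate-circuit : ∀ π ρ {p q i j} → Circuit (conjugate π ρ p) (conjugate π ρ q) i j →
                      Circuit p q (Involution.to π i) (Involution.to ρ j)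
  conjugate-circuit π ρ {p} {q} {i} {j} C = record
    { u = conjugate π ρ u ; d = conjugate π ρ d
    ; rows = λ k → trans (R.sum-to (u (P.to k))) (trans (rows (P.to k)) (sym (R.sum-to (d (P.to k)))))
    ; columns = λ l → trans (P.sum-to (λ k → u k (R.to l)))
                       (trans (columns (R.to l)) (sym (P.sum-to (λ k → d k (R.to l)))))
    ; toward = λ k l → subst₂ (λ k' l' → Toward (p k' l') (q k' l') (u (P.to k) (R.to l)) (d (P.to k) (R.to l)))
                         (P.involutive k) (R.involutive l) (toward (P.to k) (R.to l))
    ; decreases = trans (cong₂ d (P.involutive i) (R.involutive j)) decreases }
    where
    module P = Involution π
    module R = Involution ρ
    open Circuit C

  matrix : Vec (Vec ℕ 3) 3 → Mat
  matrix = entry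

  SameMargins : Mat → Mat → Set
  SameMargins p q = (∀ i → sum3ℕ (p i) ≡ sum3ℕ (q i)) × (∀ j → sum3ℕ (λ i → p i j) ≡ sum3ℕ (λ i → q i j))

  thirdBelow : ∀ a b c a' b' c' → a + (b + c) ≡ a' + (b' + c') → a < a' → b ≤ b' → c' < c
  thirdBelow = linarith 6 λ a b c a' b' c' →
    a :+ (b :+ c) :≡ a' :+ (b' :+ c') ∷ a :< a' ∷ b :≤ b' ∷ [] ⊢ c' :< c

  thirdAbove : ∀ a b c a' b' c' → a + (b + c) ≡ a' + (b' + c') → a' < a → b' ≤ b → c < c'
  thirdAbove = linarith 6 λ a b c a' b' c' →
    a :+ (b :+ c) :≡ a' :+ (b' :+ c') ∷ a' :< a ∷ b' :≤ b ∷ [] ⊢ c :< c'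

  firstAbove : ∀ a b c a' b' c' → a + (b + c) ≡ a' + (b' + c') → b' < b → c' ≤ c → a < a'
  firstAbove = linarith 6 λ a b c a' b' c' →
    a :+ (b :+ c) :≡ a' :+ (b' :+ c') ∷ b' :< b ∷ c' :≤ c ∷ [] ⊢ a :< a'

  -- Starting from the corner of a path of signs −, +, +, the signs of the remaining entries force
  -- an alternating 4-cycle or 6-cycle.
  corner-circuit : ∀ p q → SameMargins p q → q 0F 0F < p 0F 0F → p 1F 0F < q 1F 0F → p 0F 1F < q 0F 1F →
                   Circuit p q 0F 0F
  corner-circuit p q (rows , columns) h₀₀ h₁₀ h₀₁ with q 1F 1F <? p 1F 1F
  ... | yes h₁₁ = record
    { u = matrix ((0 ∷ 1 ∷ 0 ∷ []) ∷ (1 ∷ 0 ∷ 0 ∷ []) ∷ (0 ∷ 0 ∷ 0 ∷ []) ∷ [])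
    ; d = matrix ((1 ∷ 0 ∷ 0 ∷ []) ∷ (0 ∷ 1 ∷ 0 ∷ []) ∷ (0 ∷ 0 ∷ 0 ∷ []) ∷ [])
    ; rows = ∀3 refl refl refl ; columns = ∀3 refl refl refl
    ; toward = ∀3 (∀3 (down h₀₀) (up h₀₁) stay) (∀3 (up h₁₀) (down h₁₁) stay) (∀3 stay stay stay)
    ; decreases = refl }
  -- Entry (1,1) does not decrease, so row 1 forces a decrease at (1,2) and column 1 one at (2,1).
  -- If (2,2) increases, a 6-cycle closes; otherwise row 2 forces an increase at (2,0), and rows 0
  -- and 2 carry a 4-cycle.
  ... | no ¬h₁₁ with p 2F 2F <? q 2F 2F
  ...   | yes h₂₂ = record
    { u = matrix ((0 ∷ 1 ∷ 0 ∷ []) ∷ (1 ∷ 0 ∷ 0 ∷ []) ∷ (0 ∷ 0 ∷ 1 ∷ []) ∷ [])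
    ; d = matrix ((1 ∷ 0 ∷ 0 ∷ []) ∷ (0 ∷ 0 ∷ 1 ∷ []) ∷ (0 ∷ 1 ∷ 0 ∷ []) ∷ [])
    ; rows = ∀3 refl refl refl ; columns = ∀3 refl refl refl
    ; toward = ∀3 (∀3 (down h₀₀) (up h₀₁) stay)
                  (∀3 (up h₁₀) stay (down (thirdBelow (p 1F 0F) (p 1F 1F) (p 1F 2F) _ _ _ (rows 1F) h₁₀ (≮⇒≥ ¬h₁₁))))
                  (∀3 stay (down (thirdBelow (p 0F 1F) (p 1F 1F) (p 2F 1F) _ _ _ (columns 1F) h₀₁ (≮⇒≥ ¬h₁₁))) (up h₂₂))
    ; decreases = refl }
  ...   | no ¬h₂₂ = record
    { u = matrix ((0 ∷ 1 ∷ 0 ∷ []) ∷ (0 ∷ 0 ∷ 0 ∷ []) ∷ (1 ∷ 0 ∷ 0 ∷ []) ∷ [])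
    ; d = matrix ((1 ∷ 0 ∷ 0 ∷ []) ∷ (0 ∷ 0 ∷ 0 ∷ []) ∷ (0 ∷ 1 ∷ 0 ∷ []) ∷ [])
    ; rows = ∀3 refl refl refl ; columns = ∀3 refl refl refl
    ; toward = ∀3 (∀3 (down h₀₀) (up h₀₁) stay) (∀3 stay stay stay)
                  (∀3 (up (firstAbove (p 2F 0F) (p 2F 1F) (p 2F 2F) _ _ _ (rows 2F) h₂₁ (≮⇒≥ ¬h₂₂))) (down h₂₁) stay)
    ; decreases = refl }
    where
    h₂₁ : q 2F 1F < p 2F 1F
    h₂₁ = thirdBelow (p 0F 1F) (p 1F 1F) (p 2F 1F) _ _ _ (columns 1F) h₀₁ (≮⇒≥ ¬h₁₁)

  sameMargins-conjugate : ∀ π ρ {p q} → SameMargins p q → SameMargins (conjugate π ρ p) (conjugate π ρ q)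
  sameMargins-conjugate π ρ {p} {q} (rows , columns) =
    (λ i → trans (R.sum-to (p (P.to i))) (trans (rows (P.to i)) (sym (R.sum-to (q (P.to i)))))) ,
    (λ j → trans (P.sum-to (λ k → p k (R.to j)))
            (trans (columns (R.to j)) (sym (P.sum-to (λ k → q k (R.to j))))))
    where
    module P = Involution π
    module R = Involution ρ

  unchanged : Involution
  unchanged = swapping 0F

  swapChoice : ∀ a b c a' b' c' → a + (b + c) ≡ a' + (b' + c') → a' < a → b < b' ⊎ c < c'
  swapChoice a b c a' b' c' eq h with b <? b'
  ... | yes h' = inj₁ h'
  ... | no ¬h' = inj₂ (thirdAbove a b c a' b' c' eq h (≮⇒≥ ¬h'))

  -- Equal margins force an increase somewhere in column 0 and in row 0; exchanging the indices 1
  -- and 2 where necessary moves these increases to (1,0) and (0,1).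
  origin-circuit : ∀ p q → SameMargins p q → q 0F 0F < p 0F 0F → Circuit p q 0F 0F
  origin-circuit p q m@(rows , columns) h
    with swapChoice (p 0F 0F) (p 1F 0F) (p 2F 0F) _ _ _ (columns 0F) h
       | swapChoice (p 0F 0F) (p 0F 1F) (p 0F 2F) _ _ _ (rows 0F) h
  ... | inj₁ h₁ | inj₁ h₂ = corner-circuit p q m h h₁ h₂
  ... | inj₂ h₁ | inj₁ h₂ = conjugate-circuit swap12 unchanged
    (corner-circuit _ _ (sameMargins-conjugate swap12 unchanged {p} {q} m) h h₁ h₂)
  ... | inj₁ h₁ | inj₂ h₂ = conjugate-circuit unchanged swap12
    (corner-circuit _ _ (sameMargins-conjugate unchanged swap12 {p} {q} m) h h₁ h₂)
  ... | inj₂ h₁ | inj₂ h₂ = conjugate-circuit swap12 swap12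
    (corner-circuit _ _ (sameMargins-conjugate swap12 swap12 {p} {q} m) h h₁ h₂)

  transposition-0 : ∀ k → transposition k 0F ≡ k
  transposition-0 = ∀3 refl refl refl

  abstract
    -- The common source of the exchange moves: with a multiple of a lattice point as `p` it drives
    -- the integer decomposition, with two lattice points the balancing of a pair.
    circuit : ∀ p q → SameMargins p q → ∀ i j → q i j < p i j → Circuit p q i j
    circuit p q m i j h = subst₂ (Circuit p q) (transposition-0 i) (transposition-0 j)
      (conjugate-circuit (swapping i) (swapping j)
        (origin-circuit _ _ (sameMargins-conjugate (swapping i) (swapping j) {p} {q} m)
          (subst₂ (λ k l → q k l < p k l) (sym (transposition-0 i)) (sym (transposition-0 j)) h)))

  shift : Mat → Mat → Mat → Mat
  shift x u d k l = (x k l + u k l) ∸ d k l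

  sum3ℕ-shift : ∀ x' d x u → (∀ k → x' k + d k ≡ x k + u k) → sum3ℕ u ≡ sum3ℕ d → sum3ℕ x' ≡ sum3ℕ x
  sum3ℕ-shift x' d x u h = linarith 12
    (λ x'₀ x'₁ x'₂ d₀ d₁ d₂ x₀ x₁ x₂ u₀ u₁ u₂ →
      x'₀ :+ d₀ :≡ x₀ :+ u₀ ∷ x'₁ :+ d₁ :≡ x₁ :+ u₁ ∷ x'₂ :+ d₂ :≡ x₂ :+ u₂ ∷
      u₀ :+ (u₁ :+ u₂) :≡ d₀ :+ (d₁ :+ d₂) ∷ []
      ⊢ x'₀ :+ (x'₁ :+ x'₂) :≡ x₀ :+ (x₁ :+ x₂))
    (x' 0F) (x' 1F) (x' 2F) (d 0F) (d 1F) (d 2F) (x 0F) (x 1F) (x 2F) (u 0F) (u 1F) (u 2F)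
    (h 0F) (h 1F) (h 2F)

  shift-margins : ∀ {r c x u d} → (∀ k l → shift x u d k l + d k l ≡ x k l + u k l) →
    (∀ k → sum3ℕ (u k) ≡ sum3ℕ (d k)) → (∀ l → sum3ℕ (λ k → u k l) ≡ sum3ℕ (λ k → d k l)) →
    Margins r c x → Margins r c (shift x u d)
  shift-margins {x = x} {u} {d} h rows columns (xr , xc) =
    (λ k → trans (sum3ℕ-shift (shift x u d k) (d k) (x k) (u k) (h k) (rows k)) (xr k)) ,
    (λ l → trans (sum3ℕ-shift (λ k → shift x u d k l) (λ k → d k l) (λ k → x k l) (λ k → u k l)
                    (λ k → h k l) (columns l)) (xc l))

  sum3ℕ-mono-≤ : ∀ {f g} → (∀ i → f i ≤ g i) → sum3ℕ f ≤ sum3ℕ g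
  sum3ℕ-mono-≤ h = ℕP.+-mono-≤ (h 0F) (ℕP.+-mono-≤ (h 1F) (h 2F))

  sum3ℕ-mono-< : ∀ {f g} → (∀ i → f i ≤ g i) → ∀ i → f i < g i → sum3ℕ f < sum3ℕ g
  sum3ℕ-mono-< h 0F k = ℕP.+-mono-<-≤ k (ℕP.+-mono-≤ (h 1F) (h 2F))
  sum3ℕ-mono-< h 1F k = ℕP.+-mono-≤-< (h 0F) (ℕP.+-mono-<-≤ k (h 2F))
  sum3ℕ-mono-< h 2F k = ℕP.+-mono-≤-< (h 0F) (ℕP.+-mono-≤-< (h 1F) k)

  sum3ℕ-* : ∀ D f → sum3ℕ (λ i → D * f i) ≡ D * sum3ℕ f
  sum3ℕ-* D f = distrib D (f 0F) (f 1F) (f 2F)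
    where
    distrib : ∀ D a b c → D * a + (D * b + D * c) ≡ D * (a + (b + c))
    distrib = solve-∀

  excess : Mat → Mat → ℕ
  excess n v = sum3ℕ λ i → sum3ℕ λ j → v i j ∸ n i j

  module _ (D' : ℕ) where
    private D = suc D'

    -- A step of `v` conformal to `n - D * v` never raises the excess over `n`: an upward step needs
    -- `D * v < n`, hence `v < n`, and a downward one needs `n < D * v`, hence `v` is positive.
    toward-multiple : ∀ v n {u d} → Toward (D * v) n u d →
      ((v + u) ∸ d) + d ≡ v + u × (v + u) ∸ d ∸ n ≤ v ∸ n × (d ≡ 1 → n < v → (v + u) ∸ d ∸ n < v ∸ n)
    toward-multiple v n stay rewrite ℕP.+-identityʳ v = ℕP.+-identityʳ v , ≤-refl , λ ()
    toward-multiple v n (up h) =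
      ℕP.+-identityʳ _ ,
      ≤-trans (ℕP.≤-reflexive (ℕP.m≤n⇒m∸n≡0 (subst (_≤ n) (sym (ℕP.+-comm v 1)) (ℕP.≤-<-trans (m≤m+n v _) h)))) z≤n ,
      λ ()
    toward-multiple zero n (down h) rewrite ℕP.*-zeroʳ D = ⊥-elim (ℕP.n≮0 h)
    toward-multiple (suc w) n (down h) rewrite ℕP.+-identityʳ w =
      ℕP.+-comm w 1 , ℕP.∸-monoˡ-≤ n (ℕP.n≤1+n w) ,
      λ { _ (s≤s n≤w) → ℕP.≤-reflexive (sym (ℕP.+-∸-assoc 1 n≤w)) }

    module _ {r c : Fin 3 → ℕ} (n : Mat) (nm : Margins (λ i → D * r i) (λ j → D * c j) n) where

      reduceExcess : ∀ v → Margins r c v → ∀ i j → n i j < v i j →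
                     ∃ λ v' → Margins r c v' × excess n v' < excess n v
      reduceExcess v vm i j h = shift v u d ,
        shift-margins {x = v} {u} {d} (λ k l → proj₁ (entries k l)) rows columns vm ,
        sum3ℕ-mono-< (λ k → sum3ℕ-mono-≤ λ l → proj₁ (proj₂ (entries k l))) i
          (sum3ℕ-mono-< (λ l → proj₁ (proj₂ (entries i l))) j (proj₂ (proj₂ (entries i j)) decreases h))
        where
        open Circuit (circuit (λ k l → D * v k l) n
          ((λ k → trans (sum3ℕ-* D (v k)) (trans (cong (D *_) (proj₁ vm k)) (sym (proj₁ nm k)))) ,
           (λ l → trans (sum3ℕ-* D (λ k → v k l)) (trans (cong (D *_) (proj₂ vm l)) (sym (proj₂ nm l)))))
          i j (ℕP.<-≤-trans h (m≤m+n (v i j) _)))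
        entries = λ k l → toward-multiple (v k l) (n k l) (toward k l)

      -- The step behind integer decomposition: a lattice point below `n` can be split off, which
      -- leaves a matrix in the next smaller dilate. The excess drops along circuits, so any lattice
      -- point may serve as the start.
      dominated : ∀ v → Margins r c v → ∃ λ v' → Margins r c v' × (∀ i j → v' i j ≤ n i j)
      dominated v vm = go v vm (<-wellFounded _)
        where
        go : ∀ v → Margins r c v → Acc _<_ (excess n v) → ∃ λ v' → Margins r c v' × (∀ i j → v' i j ≤ n i j)
        go v vm (acc rec) with any? (λ i → any? λ j → n i j <? v i j)
        ... | no none = v , vm , λ i j → ≮⇒≥ λ h → none (i , j , h)
        ... | yes (i , j , h) = let v' , vm' , lt = reduceExcess v vm i j h in go v' vm' (rec lt)

  sumAt : List Mat → Fin 3 → Fin 3 → ℕ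
  sumAt L i j = sum (List.map (λ x → x i j) L)

  sum3ℕ-zero : ∀ {f} → sum3ℕ f ≡ 0 → ∀ i → f i ≡ 0
  sum3ℕ-zero {f} h = ∀3
    (linarith 3 (λ a b c → a :+ (b :+ c) :≡ con 0 ∷ [] ⊢ a :≡ con 0) (f 0F) (f 1F) (f 2F) h)
    (linarith 3 (λ a b c → a :+ (b :+ c) :≡ con 0 ∷ [] ⊢ b :≡ con 0) (f 0F) (f 1F) (f 2F) h)
    (linarith 3 (λ a b c → a :+ (b :+ c) :≡ con 0 ∷ [] ⊢ c :≡ con 0) (f 0F) (f 1F) (f 2F) h)

  sum3ℕ-∸ : ∀ f g a b → (∀ i → g i ≤ f i) → sum3ℕ f ≡ b + a → sum3ℕ g ≡ b → sum3ℕ (λ i → f i ∸ g i) ≡ a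
  sum3ℕ-∸ f g a b h hf hg = linarith 11
    (λ x₀ x₁ x₂ f₀ f₁ f₂ g₀ g₁ g₂ a b →
      x₀ :+ g₀ :≡ f₀ ∷ x₁ :+ g₁ :≡ f₁ ∷ x₂ :+ g₂ :≡ f₂ ∷
      f₀ :+ (f₁ :+ f₂) :≡ b :+ a ∷ g₀ :+ (g₁ :+ g₂) :≡ b ∷ [] ⊢ x₀ :+ (x₁ :+ x₂) :≡ a)
    (f 0F ∸ g 0F) (f 1F ∸ g 1F) (f 2F ∸ g 2F) (f 0F) (f 1F) (f 2F) (g 0F) (g 1F) (g 2F) a b
    (ℕP.m∸n+n≡m (h 0F)) (ℕP.m∸n+n≡m (h 1F)) (ℕP.m∸n+n≡m (h 2F)) hf hg

  integerDecomposition : ∀ {r c v₀} → Margins r c v₀ → ∀ D n → Margins (λ i → D * r i) (λ j → D * c j) n →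
    ∃ λ L → length L ≡ D × All (Margins r c) L × (∀ i j → sumAt L i j ≡ n i j)
  integerDecomposition vm₀ zero n (rows , _) = [] , refl , [] , λ i j → sym (sum3ℕ-zero {n i} (rows i) j)
  integerDecomposition {v₀ = v₀} vm₀ (suc D) n nm =
    let v , vm , v≤n = dominated D n nm v₀ vm₀
        L , len , ms , sums = integerDecomposition {v₀ = v₀} vm₀ D (λ i j → n i j ∸ v i j)
          ((λ i → sum3ℕ-∸ (n i) (v i) _ _ (v≤n i) (proj₁ nm i) (proj₁ vm i)) ,
           (λ j → sum3ℕ-∸ (λ i → n i j) (λ i → v i j) _ _ (λ i → v≤n i j) (proj₂ nm j) (proj₂ vm j)))
    in v ∷ L , cong suc len , vm ∷ ms ,
       λ i j → trans (cong (v i j +_) (sums i j)) (ℕP.m+[n∸m]≡n (v≤n i j))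

  fill : ∀ s (c : Fin 3 → ℕ) → s ≤ sum3ℕ c → ∃ λ x → sum3ℕ x ≡ s × (∀ j → x j ≤ c j)
  fill s c h with s ≤? c 0F | s ≤? c 0F + c 1F
  ... | yes h₀ | _ = ∀3 s 0 0 , ℕP.+-identityʳ s , ∀3 h₀ z≤n z≤n
  ... | no h₀ | yes h₁ = ∀3 (c 0F) (s ∸ c 0F) 0 ,
    trans (cong (c 0F +_) (ℕP.+-identityʳ _)) (ℕP.m+[n∸m]≡n (ℕP.≰⇒≥ h₀)) ,
    ∀3 ≤-refl (ℕP.m≤n+o⇒m∸n≤o s (c 0F) h₁) z≤n
  ... | no h₀ | no h₁ = ∀3 (c 0F) (c 1F) (s ∸ (c 0F + c 1F)) ,
    trans (sym (ℕP.+-assoc (c 0F) (c 1F) _)) (ℕP.m+[n∸m]≡n (ℕP.≰⇒≥ h₁)) ,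
    ∀3 ≤-refl ≤-refl (ℕP.m≤n+o⇒m∸n≤o s (c 0F + c 1F) (subst (s ≤_) (sym (ℕP.+-assoc (c 0F) (c 1F) (c 2F))) h))

  -- The north-west corner rule: rows are filled greedily from what remains of the column sums, and
  -- the last row takes the rest.
  latticePoint : ∀ r c → sum3ℕ r ≡ sum3ℕ c → ∃ (Margins r c)
  latticePoint r c h =
    let x , xs , x≤c = fill (r 0F) c (subst (r 0F ≤_) h (m≤m+n _ _))
        c' = λ j → c j ∸ x j
        c'-sum : sum3ℕ c' ≡ r 1F + r 2F
        c'-sum = sum3ℕ-∸ c x _ _ x≤c (sym h) xs
        y , ys , y≤c' = fill (r 1F) c' (subst (r 1F ≤_) (sym c'-sum) (m≤m+n _ _))
        z = λ j → c' j ∸ y j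
    in ∀3 x y z , ∀3 xs ys (sum3ℕ-∸ c' y _ _ y≤c' c'-sum ys) ,
       λ j → trans (cong (x j +_) (ℕP.m+[n∸m]≡n (y≤c' j))) (ℕP.m+[n∸m]≡n (x≤c j))

  square-down : ∀ a b → b ≤ a → a * a + suc b * suc b ≤ suc a * suc a + b * b
  square-down a b h = subst₂ _≤_ (left (a * a) b) (right a (b * b))
    (linarith 4 (λ s t a b → b :≤ a ∷ [] ⊢ s :+ (t :+ 2 :* b :+ con 1) :≤ (s :+ 2 :* a :+ con 1) :+ t)
      (a * a) (b * b) a b h)
    where
    left : ∀ s b → s + (b * b + 2 * b + 1) ≡ s + suc b * suc b
    left = solve-∀
    right : ∀ a t → (a * a + 2 * a + 1) + t ≡ suc a * suc a + t
    right = solve-∀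

  square-down-< : ∀ a b → b < a → a * a + suc b * suc b < suc a * suc a + b * b
  square-down-< a b h = subst₂ _<_ (left (a * a) b) (right a (b * b))
    (linarith 4 (λ s t a b → b :< a ∷ [] ⊢ s :+ (t :+ 2 :* b :+ con 1) :< (s :+ 2 :* a :+ con 1) :+ t)
      (a * a) (b * b) a b h)
    where
    left : ∀ s b → s + (b * b + 2 * b + 1) ≡ s + suc b * suc b
    left = solve-∀
    right : ∀ a t → (a * a + 2 * a + 1) + t ≡ suc a * suc a + t
    right = solve-∀

  -- The circuit acts on `a` and its inverse on `b`, which preserves the sum. Across a difference of
  -- 1 the two entries are merely interchanged; the squares drop strictly from a difference of 2 on.
  toward-balance : ∀ a b {u d} → Toward a b u d → let a' = (a + u) ∸ d ; b' = (b + d) ∸ u in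
    a' + d ≡ a + u × b' + u ≡ b + d × a' + b' ≡ a + b × a' * a' + b' * b' ≤ a * a + b * b ×
    (d ≡ 1 → 2 + b ≤ a → a' * a' + b' * b' < a * a + b * b)
  toward-balance a b stay rewrite ℕP.+-identityʳ a | ℕP.+-identityʳ b =
    ℕP.+-identityʳ a , ℕP.+-identityʳ b , refl , ≤-refl , λ ()
  toward-balance a (suc b) (up (s≤s a≤b)) rewrite ℕP.+-comm a 1 | ℕP.+-identityʳ b =
    cong suc (ℕP.+-identityʳ a) , ℕP.+-comm b 1 , sym (ℕP.+-suc a b) ,
    subst₂ _≤_ (ℕP.+-comm (b * b) _) (ℕP.+-comm _ (a * a)) (square-down b a a≤b) , λ ()
  toward-balance (suc a) b (down (s≤s b≤a)) rewrite ℕP.+-comm b 1 | ℕP.+-identityʳ a =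
    ℕP.+-comm a 1 , cong suc (ℕP.+-identityʳ b) , ℕP.+-suc a b ,
    square-down a b b≤a , λ { _ (s≤s h) → square-down-< a b h }

  squares : (Fin 3 → ℕ) → ℕ
  squares x = sum3ℕ λ j → x j * x j

  -- The squares are compared row by row because row 0 does not enter the height.
  balance : ∀ {r c a b} → Margins r c a → Margins r c b → ∀ i j → 2 + b i j ≤ a i j →
    ∃₂ λ a' b' → Margins r c a' × Margins r c b' × (∀ k l → a' k l + b' k l ≡ a k l + b k l) ×
      (∀ k → squares (a' k) + squares (b' k) ≤ squares (a k) + squares (b k)) ×
      squares (a' i) + squares (b' i) < squares (a i) + squares (b i)
  balance {a = a} {b} am bm i j h =
    shift a u d , shift b d u ,
    shift-margins {x = a} {u} {d} (λ k l → proj₁ (entries k l)) rows columns am ,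
    shift-margins {x = b} {d} {u} (λ k l → proj₁ (proj₂ (entries k l))) (sym ∘ rows) (sym ∘ columns) bm ,
    (λ k l → proj₁ (proj₂ (proj₂ (entries k l)))) ,
    (λ k → subst₂ _≤_ (merge (shift a u d k) (shift b d u k)) (merge (a k) (b k)) (sum3ℕ-mono-≤ λ l → weak k l)) ,
    subst₂ _<_ (merge (shift a u d i) (shift b d u i)) (merge (a i) (b i))
      (sum3ℕ-mono-< (λ l → weak i l) j (proj₂ (proj₂ (proj₂ (proj₂ (entries i j)))) decreases h))
    where
    open Circuit (circuit a b
      ((λ k → trans (proj₁ am k) (sym (proj₁ bm k))) , (λ l → trans (proj₂ am l) (sym (proj₂ bm l))))
      i j (ℕP.≤-trans (ℕP.n≤1+n _) h))
    entries = λ k l → toward-balance (a k l) (b k l) (toward k l)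
    weak = λ k l → proj₁ (proj₂ (proj₂ (proj₂ (entries k l))))
    merge : ∀ x y → sum3ℕ (λ l → x l * x l + y l * y l) ≡ squares x + squares y
    merge x y = linarith 6
      (λ f₀ f₁ f₂ g₀ g₁ g₂ → []
        ⊢ (f₀ :+ g₀) :+ ((f₁ :+ g₁) :+ (f₂ :+ g₂)) :≡ (f₀ :+ (f₁ :+ f₂)) :+ (g₀ :+ (g₁ :+ g₂)))
      (x 0F * x 0F) (x 1F * x 1F) (x 2F * x 2F) (y 0F * y 0F) (y 1F * y 1F) (y 2F * y 2F)

open Matrices

-- Heights and reducible pairs of lattice points; the lattice points of a cell

module LatticePoints where

  open import Data.Nat using (_+_; _*_; _∸_; _≤_; _<_; _≡ᵇ_)
  open import Data.Nat.Properties using (_<?_; _≤?_; ≮⇒≥; ≤-refl; ≤-trans; m≤m+n)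
  open import Data.Nat.Tactic.RingSolver using (solve-∀)

  vectors : ∀ {A : Set} → List A → ∀ n → List (Vec A n)
  vectors xs zero    = [] ∷ []
  vectors xs (suc n) = List.cartesianProductWith _∷_ xs (vectors xs n)

  ∈-vectors : ∀ {A : Set} {xs : List A} {n} (v : Vec A n) → (∀ i → lookup v i ∈ xs) → v ∈ vectors xs n
  ∈-vectors []      h = here refl
  ∈-vectors (x ∷ v) h = ∈P.∈-cartesianProductWith⁺ _∷_ (h zero) (∈-vectors v (h ∘ suc))

  matricesUpTo : ℕ → List LMat
  matricesUpTo B = vectors (vectors (List.upTo (suc B)) 3) 3

  ∈-matricesUpTo : ∀ B M → (∀ i j → entry M i j ≤ B) → M ∈ matricesUpTo B
  ∈-matricesUpTo B M h = ∈-vectors M λ i → ∈-vectors (lookup M i) λ j → ∈P.∈-upTo⁺ (s≤s (h i j))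

  total : ∀ {A : Set} → (A → ℕ) → List A → ℕ
  total f L = sum (List.map f L)

  total-↭ : ∀ {A : Set} (f : A → ℕ) {L L'} → L ↭ L' → total f L ≡ total f L'
  total-↭ f p = sum-↭ (↭P.map⁺ f p)

  ∈⇒↭ : ∀ {A : Set} {x : A} {L} → x ∈ L → ∃ λ L' → L ↭ x ∷ L'
  ∈⇒↭ {x = x} x∈L with ∈P.∈-∃++ x∈L
  ... | ys , zs , refl = ys List.++ zs , ↭P.shift x ys zs

  module _ {A : Set} {R : A → A → Set} (R? : ∀ x y → Dec (R x y)) where

    splitPair : ∀ L → AllPairs (λ x y → ¬ R x y) L ⊎ (∃₂ λ x y → ∃ λ L' → L ↭ x ∷ y ∷ L' × R x y)
    splitPair [] = inj₁ []
    splitPair (x ∷ L) with Any.any? (R? x) L | splitPair L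
    ... | yes h | _ = let y , y∈L , xy = find h
                          L' , p = ∈⇒↭ y∈L
                      in inj₂ (x , y , L' , prep x p , xy)
    ... | no h | inj₁ ps = inj₁ (All.tabulate (λ y∈L xy → h (lose y∈L xy)) ∷ ps)
    ... | no h | inj₂ (y , z , L' , p , yz) =
      inj₂ (y , z , x ∷ L' , ↭-trans (prep x p) (↭-trans (swap x y ↭-refl) (prep y (swap x z ↭-refl))) , yz)

  -- All coefficients of the form are at most 2; the second group of terms in `expand` is what they
  -- lack.
  bilinear-≤ : ∀ p q → bilinear p q ≤ 2 * (sum3ℕ p * sum3ℕ q)
  bilinear-≤ p q = subst (bilinear p q ≤_)
    (expand (p 0F) (p 1F) (p 2F) (q 0F) (q 1F) (q 2F)) (m≤m+n (bilinear p q) _)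
    where
    expand : ∀ p₀ p₁ p₂ q₀ q₁ q₂ →
      (p₀ * q₀ + p₀ * q₂ + 2 * (p₁ * q₂) + 2 * (p₂ * q₀)) +
      (p₀ * q₀ + p₀ * q₂ + 2 * (p₀ * q₁) + 2 * (p₁ * q₀) + 2 * (p₁ * q₁) + 2 * (p₂ * q₁) + 2 * (p₂ * q₂))
      ≡ 2 * ((p₀ + (p₁ + p₂)) * (q₀ + (q₁ + q₂)))
    expand = solve-∀

  ≤-sum3ℕ : ∀ f i → f i ≤ sum3ℕ f
  ≤-sum3ℕ f = ∀3
    (linarith 3 (λ a b c → [] ⊢ a :≤ a :+ (b :+ c)) (f 0F) (f 1F) (f 2F))
    (linarith 3 (λ a b c → [] ⊢ b :≤ a :+ (b :+ c)) (f 0F) (f 1F) (f 2F))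
    (linarith 3 (λ a b c → [] ⊢ c :≤ a :+ (b :+ c)) (f 0F) (f 1F) (f 2F))

  -- ι moves the row that carries no hyperplanes into position 0.
  module Points (ι : Involution) (r c : Fin 3 → ℕ) where

    open Involution ι

    ent : LMat → Mat
    ent M i j = entry M (to i) j

    build : Mat → LMat
    build x = tabulate λ i → tabulate λ j → x (to i) j

    entry-build : ∀ x i j → entry (build x) i j ≡ x (to i) j
    entry-build x i j = trans (cong (λ v → lookup v j) (lookup∘tabulate (λ i → tabulate (x (to i))) i))
                              (lookup∘tabulate (x (to i)) j)

    ent-build : ∀ x i j → ent (build x) i j ≡ x i j
    ent-build x i j = trans (entry-build x (to i) j) (cong (λ k → x k j) (involutive i))

    build-unique : ∀ M x → (∀ i j → ent M i j ≡ x i j) → M ≡ build x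
    build-unique M x h = trans (sym (tabulate∘lookup M)) (tabulate-cong λ i →
      trans (sym (tabulate∘lookup (lookup M i))) (tabulate-cong λ j →
        trans (cong (λ k → entry M k j) (sym (involutive i))) (h (to i) j)))

    IsPoint : LMat → Set
    IsPoint M = Margins r c (ent M)

    margins-≗ : ∀ {x y} → (∀ i j → x i j ≡ y i j) → Margins r c y → Margins r c x
    margins-≗ h (rows , columns) =
      (λ i → trans (sum3ℕ-cong (h i)) (rows i)) , (λ j → trans (sum3ℕ-cong (λ i → h i j)) (columns j))

    build-point : ∀ {x} → Margins r c x → IsPoint (build x)
    build-point {x} = margins-≗ (ent-build x)

    isPoint? : ∀ M → Dec (IsPoint M)
    isPoint? M = all? (λ i → sum3ℕ (ent M i) ℕ.≟ r i) ×-dec all? (λ j → sum3ℕ (λ i → ent M i j) ℕ.≟ c j)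

    S : ℕ
    S = sum3ℕ r

    entry-bound : ∀ {x} → Margins r c x → ∀ i j → x i j ≤ S
    entry-bound {x} (rows , _) i j =
      ≤-trans (≤-sum3ℕ (x i) j) (≤-trans (ℕP.≤-reflexive (rows i)) (≤-sum3ℕ r i))

    row-bound : ∀ {x} → Margins r c x → ∀ i → sum3ℕ (x i) ≤ S
    row-bound (rows , _) i = ≤-trans (ℕP.≤-reflexive (rows i)) (≤-sum3ℕ r i)

    candidates : List LMat
    candidates = matricesUpTo S

    ∈-candidates : ∀ M → (∀ i j → ent M i j ≤ S) → M ∈ candidates
    ∈-candidates M h = ∈-matricesUpTo S M λ i j → subst (λ k → entry M k j ≤ S) (involutive i) (h (to i) j)

    -- Large enough for the squares to dominate the bilinear form and all potentials (at most 10) on T.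
    N : ℕ
    N = 4 * (S * S) + 40 * S + 61

    squaresPart : Mat → ℕ
    squaresPart x = squares (x 1F) + squares (x 2F)

    heightOf : Mat → ℕ
    heightOf x = N * squaresPart x + bilinear (x 1F) (x 2F)

    ω : LMat → ℕ
    ω M = heightOf (ent M)

    squares-cong : ∀ {x y : Fin 3 → ℕ} → (∀ j → x j ≡ y j) → squares x ≡ squares y
    squares-cong h = sum3ℕ-cong λ j → cong₂ _*_ (h j) (h j)

    bilinear-cong : ∀ {p p' q q'} → (∀ j → p j ≡ p' j) → (∀ j → q j ≡ q' j) → bilinear p q ≡ bilinear p' q'
    bilinear-cong hp hq = cong₂ _+_ (cong₂ _+_ (cong₂ _+_ (cong₂ _*_ (hp 0F) (hq 0F)) (cong₂ _*_ (hp 0F) (hq 2F)))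
      (cong (2 *_) (cong₂ _*_ (hp 1F) (hq 2F)))) (cong (2 *_) (cong₂ _*_ (hp 2F) (hq 0F)))

    heightOf-cong : ∀ {x y : Mat} → (∀ i j → x i j ≡ y i j) → heightOf x ≡ heightOf y
    heightOf-cong h = cong₂ _+_ (cong (N *_) (cong₂ _+_ (squares-cong (h 1F)) (squares-cong (h 2F))))
                                (bilinear-cong (h 1F) (h 2F))

    ω-build : ∀ x → ω (build x) ≡ heightOf x
    ω-build x = heightOf-cong (ent-build x)

    bilinear-bound : ∀ {x} → Margins r c x → bilinear (x 1F) (x 2F) ≤ 2 * (S * S)
    bilinear-bound {x} m = ≤-trans (bilinear-≤ (x 1F) (x 2F))
      (ℕP.*-monoʳ-≤ 2 (ℕP.*-mono-≤ (row-bound {x} m 1F) (row-bound {x} m 2F)))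

    Improves : LMat → LMat → LMat → LMat → Set
    Improves a b a' b' = IsPoint a' × IsPoint b' ×
      (∀ i j → ent a' i j + ent b' i j ≡ ent a i j + ent b i j) × ω a' + ω b' < ω a + ω b

    -- Quantifying over a finite list makes the relation decidable. Entries of points are at most
    -- `S`, so `candidates` misses none of them.
    Reducible : LMat → LMat → Set
    Reducible a b = Any (λ a' → Any (Improves a b a') candidates) candidates

    reducible? : ∀ a b → Dec (Reducible a b)
    reducible? a b = Any.any? (λ a' → Any.any? (λ b' →
      isPoint? a' ×-dec isPoint? b' ×-dec
      all? (λ i → all? λ j → ent a' i j + ent b' i j ℕ.≟ ent a i j + ent b i j) ×-dec
      (ω a' + ω b' <? ω a + ω b)) candidates) candidates

    reducible : ∀ {a b} x y → Margins r c x → Margins r c y →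
      (∀ i j → x i j + y i j ≡ ent a i j + ent b i j) → heightOf x + heightOf y < ω a + ω b → Reducible a b
    reducible {a} {b} x y xm ym sums lt =
      lose (∈-candidates (build x) (entry-bound {ent (build x)} (build-point {x} xm)))
        (lose (∈-candidates (build y) (entry-bound {ent (build y)} (build-point {y} ym)))
          (build-point {x} xm , build-point {y} ym ,
           (λ i j → trans (cong₂ _+_ (ent-build x i j) (ent-build y i j)) (sums i j)) ,
           subst (_< ω a + ω b) (sym (cong₂ _+_ (ω-build x) (ω-build y))) lt))

    reducible-elim : ∀ {a b} → Reducible a b → ∃₂ (Improves a b)
    reducible-elim h = let a' , _ , h' = find h
                           b' , _ , i = find h'
                       in a' , b' , i

    reducible-sym : ∀ {a b} → Reducible a b → Reducible b a
    reducible-sym {a} {b} = Any.map (λ {a'} → Any.map λ {b'} (pa , pb , sums , lt) →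
      pa , pb , (λ i j → trans (sums i j) (ℕP.+-comm (ent a i j) _)) ,
      subst (ω a' + ω b' <_) (ℕP.+-comm (ω a) (ω b)) lt)

    -- The gain in the squares outweighs any change of the bilinear form, by the choice of N.
    far-reducible : ∀ {a b} → IsPoint a → IsPoint b → ∀ i j → 2 + ent b (suc i) j ≤ ent a (suc i) j → Reducible a b
    far-reducible {a} {b} pa pb i j h =
      let x , y , xm , ym , sums , weak , strict = balance {a = ent a} {ent b} pa pb (suc i) j h
          less : squaresPart x + squaresPart y < squaresPart (ent a) + squaresPart (ent b)
          less = rearrange (squares (x 1F)) _ _ _ (squares (ent a 1F)) _ _ _ (both i x y (weak 1F) (weak 2F) strict)
      in reducible {a} {b} x y xm ym sums
          (dominate N (squaresPart x) (squaresPart y) (squaresPart (ent a)) (squaresPart (ent b)) _ _ _ _ less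
            (≤-trans (s≤s (ℕP.+-mono-≤ (bilinear-bound {x} xm) (bilinear-bound {y} ym))) (large (S * S) S)))
      where
      large : ∀ q s → suc (2 * q + 2 * q) ≤ 4 * q + 40 * s + 61
      large = linarith 2 λ q s → [] ⊢ con 1 :+ (2 :* q :+ 2 :* q) :≤ 4 :* q :+ 40 :* s :+ con 61
      both : ∀ i (x y : Mat) →
        squares (x 1F) + squares (y 1F) ≤ squares (ent a 1F) + squares (ent b 1F) →
        squares (x 2F) + squares (y 2F) ≤ squares (ent a 2F) + squares (ent b 2F) →
        squares (x (suc i)) + squares (y (suc i)) < squares (ent a (suc i)) + squares (ent b (suc i)) →
        (squares (x 1F) + squares (y 1F)) + (squares (x 2F) + squares (y 2F)) <
        (squares (ent a 1F) + squares (ent b 1F)) + (squares (ent a 2F) + squares (ent b 2F))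
      both zero       x y w₁ w₂ s = ℕP.+-mono-<-≤ s w₂
      both (suc zero) x y w₁ w₂ s = ℕP.+-mono-≤-< w₁ s
      rearrange : ∀ a b c d a' b' c' d' → (a + b) + (c + d) < (a' + b') + (c' + d') →
                  (a + c) + (b + d) < (a' + c') + (b' + d')
      rearrange = linarith 8 λ a b c d a' b' c' d' →
        (a :+ b) :+ (c :+ d) :< (a' :+ b') :+ (c' :+ d') ∷ [] ⊢ (a :+ c) :+ (b :+ d) :< (a' :+ c') :+ (b' :+ d')
      dominate : ∀ N A B A' B' e f e' f' → A + B < A' + B' → e + f < N →
                 (N * A + e) + (N * B + f) < (N * A' + e') + (N * B' + f')
      dominate N A B A' B' e f e' f' h k = combine (N * A) (N * B) (N * A') (N * B') e f e' f' N
        (subst₂ _≤_ (expand N A B) (ℕP.*-distribˡ-+ N A' B') (ℕP.*-monoʳ-≤ N h)) k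
        where
        expand : ∀ N A B → N * suc (A + B) ≡ N + (N * A + N * B)
        expand = solve-∀
        combine : ∀ NA NB NA' NB' e f e' f' N → N + (NA + NB) ≤ NA' + NB' → e + f < N →
                  (NA + e) + (NB + f) < (NA' + e') + (NB' + f')
        combine = linarith 9 λ NA NB NA' NB' e f e' f' N →
          N :+ (NA :+ NB) :≤ NA' :+ NB' ∷ e :+ f :< N ∷ []
          ⊢ (NA :+ e) :+ (NB :+ f) :< (NA' :+ e') :+ (NB' :+ f')

    Irreducible : List LMat → Set
    Irreducible = AllPairs λ a b → ¬ Reducible a b

    SameTotals : List LMat → List LMat → Set
    SameTotals L L' = length L ≡ length L' ×
      (∀ i j → total (λ M → ent M i j) L ≡ total (λ M → ent M i j) L')

    improvement : ∀ L → All IsPoint L → Irreducible L ⊎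
      (∃ λ L' → All IsPoint L' × SameTotals L' L × total ω L' < total ω L)
    improvement L ps = Sum.map₂ exchange (splitPair reducible? L)
      where
      addTail : ∀ a' b' a b t → a' + b' < a + b → a' + (b' + t) < a + (b + t)
      addTail = linarith 5 λ a' b' a b t → a' :+ b' :< a :+ b ∷ [] ⊢ a' :+ (b' :+ t) :< a :+ (b :+ t)
      addTail-≡ : ∀ a' b' a b t → a' + b' ≡ a + b → a' + (b' + t) ≡ a + (b + t)
      addTail-≡ = linarith 5 λ a' b' a b t → a' :+ b' :≡ a :+ b ∷ [] ⊢ a' :+ (b' :+ t) :≡ a :+ (b :+ t)
      exchange : (∃₂ λ a b → ∃ λ L₁ → L ↭ a ∷ b ∷ L₁ × Reducible a b) →
        ∃ λ L' → All IsPoint L' × SameTotals L' L × total ω L' < total ω L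
      exchange (a , b , L₁ , p , red) =
        let a' , b' , pa , pb , sums , lt = reducible-elim {a} {b} red
        in a' ∷ b' ∷ L₁ , pa ∷ pb ∷ All.tail (All.tail (↭P.All-resp-↭ p ps)) ,
           (sym (↭P.↭-length p) ,
            λ i j → trans
              (addTail-≡ (ent a' i j) (ent b' i j) (ent a i j) (ent b i j) (total (λ M → ent M i j) L₁) (sums i j))
              (sym (total-↭ (λ M → ent M i j) p))) ,
           subst (total ω (a' ∷ b' ∷ L₁) <_) (sym (total-↭ ω p))
             (addTail (ω a') (ω b') (ω a) (ω b) (total ω L₁) lt)

    -- Each exchange keeps the length and the entrywise totals and lowers the total height, a
    -- natural number.
    descend : ∀ L → All IsPoint L → ∃ λ L' → All IsPoint L' × SameTotals L' L × Irreducible L'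
    descend L ps = go L ps (<-wellFounded _)
      where
      go : ∀ L → All IsPoint L → Acc _<_ (total ω L) →
           ∃ λ L' → All IsPoint L' × SameTotals L' L × Irreducible L'
      go L ps (acc rec) = Sum.[ (λ irr → L , ps , (refl , λ _ _ → refl) , irr) ,
        (λ (L₁ , ps₁ , (len₁ , tot₁) , lt) → let L' , ps' , (len , tot) , irr = go L₁ ps₁ (rec lt) in
           L' , ps' , (trans len len₁ , λ i j → trans (tot i j) (tot₁ i j)) , irr) ] (improvement L ps)

  size : Bool → ℕ
  size true  = 1
  size false = 2

  sum-corner : ∀ o i → sum3ℕ (corner o i) ≡ size o
  sum-corner true  = ∀3 refl refl refl
  sum-corner false = ∀3 refl refl refl

  corner-≤1 : ∀ o i l → corner o i l ≤ 1
  corner-≤1 true  = ∀3 (∀3 (s≤s z≤n) z≤n z≤n) (∀3 z≤n (s≤s z≤n) z≤n) (∀3 z≤n z≤n (s≤s z≤n))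
  corner-≤1 false = ∀3 (∀3 z≤n (s≤s z≤n) (s≤s z≤n)) (∀3 (s≤s z≤n) z≤n (s≤s z≤n)) (∀3 (s≤s z≤n) (s≤s z≤n) z≤n)

  data Bit : ℕ → Set where
    bit0 : Bit 0
    bit1 : Bit 1

  step-bit : ∀ {x k} → k ≤ x → x ≤ suc k → ∃ λ b → x ≡ k + b × Bit b
  step-bit {x} {k} h h' with x ℕ.≟ k
  ... | yes refl = 0 , sym (ℕP.+-identityʳ k) , bit0
  ... | no x≢k = 1 , trans (ℕP.≤-antisym h' (ℕP.≤∧≢⇒< h (x≢k ∘ sym))) (ℕP.+-comm 1 k) , bit1

  bits-corner : ∀ o {a b c} → Bit a → Bit b → Bit c → a + (b + c) ≡ size o →
                ∃ λ i → a ≡ corner o i 0F × b ≡ corner o i 1F × c ≡ corner o i 2F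
  bits-corner true  bit1 bit0 bit0 _ = 0F , refl , refl , refl
  bits-corner true  bit0 bit1 bit0 _ = 1F , refl , refl , refl
  bits-corner true  bit0 bit0 bit1 _ = 2F , refl , refl , refl
  bits-corner false bit0 bit1 bit1 _ = 0F , refl , refl , refl
  bits-corner false bit1 bit0 bit1 _ = 1F , refl , refl , refl
  bits-corner false bit1 bit1 bit0 _ = 2F , refl , refl , refl
  bits-corner true  bit0 bit0 bit0 ()
  bits-corner true  bit1 bit1 bit0 ()
  bits-corner true  bit1 bit0 bit1 ()
  bits-corner true  bit0 bit1 bit1 ()
  bits-corner true  bit1 bit1 bit1 ()
  bits-corner false bit0 bit0 bit0 ()
  bits-corner false bit1 bit0 bit0 ()
  bits-corner false bit0 bit1 bit0 ()
  bits-corner false bit0 bit0 bit1 ()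
  bits-corner false bit1 bit1 bit1 ()

  -- The planes at height 1 and 2 above the lowest vertex `k` cut the unit cube in an upward and a
  -- downward triangle, and the lattice points of these are their corners.
  triangle-corner : ∀ o (x k : Fin 3 → ℕ) → sum3ℕ k + size o ≡ sum3ℕ x →
    (∀ l → k l ≤ x l × x l ≤ suc (k l)) → ∃ λ i → ∀ l → x l ≡ k l + corner o i l
  triangle-corner o x k sums h =
    let a , xa , ba = step-bit (proj₁ (h 0F)) (proj₂ (h 0F))
        b , xb , bb = step-bit (proj₁ (h 1F)) (proj₂ (h 1F))
        c , xc , bc = step-bit (proj₁ (h 2F)) (proj₂ (h 2F))
        i , ca , cb , cc = bits-corner o ba bb bc
          (linarith 10 (λ x₀ x₁ x₂ k₀ k₁ k₂ a b c s →
             k₀ :+ (k₁ :+ k₂) :+ s :≡ x₀ :+ (x₁ :+ x₂) ∷ x₀ :≡ k₀ :+ a ∷ x₁ :≡ k₁ :+ b ∷ x₂ :≡ k₂ :+ c ∷ []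
             ⊢ a :+ (b :+ c) :≡ s)
            (x 0F) (x 1F) (x 2F) (k 0F) (k 1F) (k 2F) a b c (size o) sums xa xb xc)
    in i , ∀3 (trans xa (cong (k 0F +_) ca)) (trans xb (cong (k 1F +_) cb)) (trans xc (cong (k 2F +_) cc))

  tightness : Mat → Vec Bool 3
  tightness K = tabulate λ l → K 0F l ≡ᵇ 0

  -- A cell is encoded by K: rows 1 and 2 of a point of the cell exceed rows 1 and 2 of K by 0 or 1 in
  -- each entry, and row 0 of K is one less than what these floors leave of the column sums.
  cellPoint : Bool → Bool → Mat → Position → Mat
  cellPoint o₁ o₂ K (i , j) = ∀3
    (λ l → suc (K 0F l) ∸ (corner o₁ i l + corner o₂ j l))
    (λ l → K 1F l + corner o₁ i l)
    (λ l → K 2F l + corner o₂ j l)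

  fits : ∀ s y → y ≤ 2 → T (not ((s ≡ᵇ 0) ∧ (2 ℕ.≤ᵇ y))) → y ≤ suc s
  fits zero    0 _ _ = z≤n
  fits zero    1 _ _ = s≤s z≤n
  fits zero    (suc (suc y)) _ ()
  fits (suc s) y h _ = ≤-trans h (s≤s (s≤s z≤n))

  fits⁻ : ∀ s y → y ≤ suc s → T (not ((s ≡ᵇ 0) ∧ (2 ℕ.≤ᵇ y)))
  fits⁻ zero    0 _ = tt
  fits⁻ zero    1 _ = tt
  fits⁻ zero    (suc (suc y)) (s≤s ())
  fits⁻ (suc s) y _ = tt

  every-complete : ∀ f → (∀ i → T (f i)) → T (every f)
  every-complete f h with f 0F | f 1F | f 2F | h 0F | h 1F | h 2F
  ... | true | true | true | _ | _ | _ = tt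

  allowed-fits : ∀ o₁ o₂ K i j → T (allowed o₁ o₂ (tightness K) (i , j)) →
                 ∀ l → corner o₁ i l + corner o₂ j l ≤ suc (K 0F l)
  allowed-fits o₁ o₂ K i j t = ∀3 (fit 0F (h 0F)) (fit 1F (h 1F)) (fit 2F (h 2F))
    where
    h = every-sound (λ l → not (lookup (tightness K) l ∧ (2 ℕ.≤ᵇ corner o₁ i l + corner o₂ j l))) t
    fit = λ l → fits (K 0F l) (corner o₁ i l + corner o₂ j l) (ℕP.+-mono-≤ (corner-≤1 o₁ i l) (corner-≤1 o₂ j l))

  fits-allowed : ∀ o₁ o₂ K i j → (∀ l → corner o₁ i l + corner o₂ j l ≤ suc (K 0F l)) →
                 T (allowed o₁ o₂ (tightness K) (i , j))
  fits-allowed o₁ o₂ K i j h = every-complete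
    (λ l → not (lookup (tightness K) l ∧ (2 ℕ.≤ᵇ corner o₁ i l + corner o₂ j l)))
    (∀3 (fits⁻ _ _ (h 0F)) (fits⁻ _ _ (h 1F)) (fits⁻ _ _ (h 2F)))

  module Cells (ι : Involution) (r c : Fin 3 → ℕ) (r≡c : sum3ℕ r ≡ sum3ℕ c) where

    open Points ι r c

    -- The successor demands that the floors leave at least 1 in each column; otherwise x₀ₗ would
    -- vanish on the whole cell, which would not be full-dimensional.
    IsCell : Bool → Bool → Mat → Set
    IsCell o₁ o₂ K =
      (∀ l → suc (K 0F l + (K 1F l + K 2F l)) ≡ c l) ×
      sum3ℕ (K 1F) + size o₁ ≡ r 1F × sum3ℕ (K 2F) + size o₂ ≡ r 2F ×
      T (admissible o₁ o₂ (tightness K))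

    isCell? : ∀ o₁ o₂ K → Dec (IsCell o₁ o₂ K)
    isCell? o₁ o₂ K = all? (λ l → suc (K 0F l + (K 1F l + K 2F l)) ℕ.≟ c l) ×-dec
      (sum3ℕ (K 1F) + size o₁ ℕ.≟ r 1F) ×-dec (sum3ℕ (K 2F) + size o₂ ℕ.≟ r 2F) ×-dec T? (admissible o₁ o₂ (tightness K))

    row₀ : ∀ (x : Mat) → (∀ l → x 0F l + (x 1F l + x 2F l) ≡ c l) → sum3ℕ (x 1F) ≡ r 1F → sum3ℕ (x 2F) ≡ r 2F →
           sum3ℕ (x 0F) ≡ r 0F
    row₀ x h h₁ h₂ = linarith 15
      (λ a₀ a₁ a₂ b₀ b₁ b₂ d₀ d₁ d₂ c₀ c₁ c₂ r₀ r₁ r₂ →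
        a₀ :+ (b₀ :+ d₀) :≡ c₀ ∷ a₁ :+ (b₁ :+ d₁) :≡ c₁ ∷ a₂ :+ (b₂ :+ d₂) :≡ c₂ ∷
        b₀ :+ (b₁ :+ b₂) :≡ r₁ ∷ d₀ :+ (d₁ :+ d₂) :≡ r₂ ∷
        r₀ :+ (r₁ :+ r₂) :≡ c₀ :+ (c₁ :+ c₂) ∷ [] ⊢ a₀ :+ (a₁ :+ a₂) :≡ r₀)
      (x 0F 0F) (x 0F 1F) (x 0F 2F) (x 1F 0F) (x 1F 1F) (x 1F 2F) (x 2F 0F) (x 2F 1F) (x 2F 2F)
      (c 0F) (c 1F) (c 2F) (r 0F) (r 1F) (r 2F) (h 0F) (h 1F) (h 2F) h₁ h₂ r≡c

    sum-shifted : ∀ o (k : Fin 3 → ℕ) i → sum3ℕ (λ l → k l + corner o i l) ≡ sum3ℕ k + size o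
    sum-shifted o k i = linarith 7
      (λ k₀ k₁ k₂ y₀ y₁ y₂ s → y₀ :+ (y₁ :+ y₂) :≡ s ∷ []
        ⊢ (k₀ :+ y₀) :+ ((k₁ :+ y₁) :+ (k₂ :+ y₂)) :≡ k₀ :+ (k₁ :+ k₂) :+ s)
      (k 0F) (k 1F) (k 2F) (corner o i 0F) (corner o i 1F) (corner o i 2F) (size o) (sum-corner o i)

    cellPoint-margins : ∀ o₁ o₂ K p → IsCell o₁ o₂ K → T (allowed o₁ o₂ (tightness K) p) →
                        Margins r c (cellPoint o₁ o₂ K p)
    cellPoint-margins o₁ o₂ K (i , j) (columns , h₁ , h₂ , _) t =
      ∀3 (row₀ x cols rows₁ rows₂) rows₁ rows₂ , cols
      where
      x = cellPoint o₁ o₂ K (i , j)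
      rows₁ : sum3ℕ (x 1F) ≡ r 1F
      rows₁ = trans (sum-shifted o₁ (K 1F) i) h₁
      rows₂ : sum3ℕ (x 2F) ≡ r 2F
      rows₂ = trans (sum-shifted o₂ (K 2F) j) h₂
      cols : ∀ l → x 0F l + (x 1F l + x 2F l) ≡ c l
      cols l = linarith 7
        (λ x₀ s k₁ y₁ k₂ y₂ c → x₀ :+ (y₁ :+ y₂) :≡ con 1 :+ s ∷ con 1 :+ (s :+ (k₁ :+ k₂)) :≡ c ∷ []
          ⊢ x₀ :+ ((k₁ :+ y₁) :+ (k₂ :+ y₂)) :≡ c)
        (x 0F l) (K 0F l) (K 1F l) (corner o₁ i l) (K 2F l) (corner o₂ j l) (c l)
        (ℕP.m∸n+n≡m (allowed-fits o₁ o₂ K i j t l)) (columns l)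

    InBox : Mat → LMat → Set
    InBox K M = ∀ i l → K (suc i) l ≤ ent M (suc i) l × ent M (suc i) l ≤ suc (K (suc i) l)

    inBox? : ∀ K M → Dec (InBox K M)
    inBox? K M = all? λ i → all? λ l → (K (suc i) l ≤? ent M (suc i) l) ×-dec (ent M (suc i) l ≤? suc (K (suc i) l))

    -- Converse to `cellPoint-margins`: rows 1 and 2 pick the corners, the column sums determine row
    -- 0, and its nonnegativity makes the position allowed.
    box-point : ∀ o₁ o₂ K M → IsCell o₁ o₂ K → IsPoint M → InBox K M →
      ∃ λ p → T (allowed o₁ o₂ (tightness K) p) × (∀ k l → ent M k l ≡ cellPoint o₁ o₂ K p k l)
    box-point o₁ o₂ K M (columns , h₁ , h₂ , _) (rows , cols) box =
      let i , e₁ = triangle-corner o₁ (ent M 1F) (K 1F) (trans h₁ (sym (rows 1F))) (box 0F)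
          j , e₂ = triangle-corner o₂ (ent M 2F) (K 2F) (trans h₂ (sym (rows 2F))) (box 1F)
          slack : ∀ l → ent M 0F l + (corner o₁ i l + corner o₂ j l) ≡ suc (K 0F l)
          slack l = linarith 9
            (λ x₀ x₁ x₂ s k₁ y₁ k₂ y₂ c → x₀ :+ (x₁ :+ x₂) :≡ c ∷ con 1 :+ (s :+ (k₁ :+ k₂)) :≡ c ∷
              x₁ :≡ k₁ :+ y₁ ∷ x₂ :≡ k₂ :+ y₂ ∷ [] ⊢ x₀ :+ (y₁ :+ y₂) :≡ con 1 :+ s)
            (ent M 0F l) (ent M 1F l) (ent M 2F l) (K 0F l) (K 1F l) (corner o₁ i l) (K 2F l) (corner o₂ j l) (c l)
            (cols l) (columns l) (e₁ l) (e₂ l)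
      in (i , j) ,
         fits-allowed o₁ o₂ K i j (λ l → subst (corner o₁ i l + corner o₂ j l ≤_) (slack l) (ℕP.m≤n+m _ (ent M 0F l))) ,
         ∀3 (λ l → trans (sym (ℕP.m+n∸n≡m (ent M 0F l) (corner o₁ i l + corner o₂ j l)))
                         (cong (_∸ (corner o₁ i l + corner o₂ j l)) (slack l)))
            e₁ e₂

open LatticePoints

-- Supporting affine functions, irreducibility inside simplices, unimodularity

module LowerFacets where

  open import Data.Integer using (+_; -[1+_]; _+_; _*_; _-_; -_; _≤_; _<_)
  open import Data.Integer.Tactic.RingSolver using (solve-∀)

  toℚᵘ-toℚ : ∀ z → ℚ.toℚᵘ (toℚ z) ≃ mkℚᵘ z 0
  toℚᵘ-toℚ z = ℚP.toℚᵘ-fromℚᵘ (mkℚᵘ z 0)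

  toℚ-+ : ∀ a b → toℚ (a ℤ.+ b) ≡ toℚ a ℚ.+ toℚ b
  toℚ-+ a b = ℚP.toℚᵘ-injective (ℚᵘP.≃-trans (toℚᵘ-toℚ (a ℤ.+ b)) (ℚᵘP.≃-sym (ℚᵘP.≃-trans
    (ℚP.toℚᵘ-homo-+ (toℚ a) (toℚ b))
    (ℚᵘP.≃-trans (ℚᵘP.+-cong (toℚᵘ-toℚ a) (toℚᵘ-toℚ b)) (*≡* (identity a b))))))
    where
    identity : ∀ a b → (a ℤ.* + 1 ℤ.+ b ℤ.* + 1) ℤ.* + 1 ≡ (a ℤ.+ b) ℤ.* + 1
    identity = solve-∀

  toℚ-* : ∀ a b → toℚ (a ℤ.* b) ≡ toℚ a ℚ.* toℚ b
  toℚ-* a b = ℚP.toℚᵘ-injective (ℚᵘP.≃-trans (toℚᵘ-toℚ (a ℤ.* b)) (ℚᵘP.≃-sym (ℚᵘP.≃-trans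
    (ℚP.toℚᵘ-homo-* (toℚ a) (toℚ b))
    (ℚᵘP.≃-trans (ℚᵘP.*-cong (toℚᵘ-toℚ a) (toℚᵘ-toℚ b)) (*≡* refl)))))

  toℚ-mono-< : ∀ {a b} → a ℤ.< b → toℚ a ℚ.< toℚ b
  toℚ-mono-< {a} {b} h = ℚP.toℚᵘ-cancel-<
    (ℚᵘP.<-respˡ-≃ (ℚᵘP.≃-sym (toℚᵘ-toℚ a)) (ℚᵘP.<-respʳ-≃ (ℚᵘP.≃-sym (toℚᵘ-toℚ b))
      (*<* (subst₂ ℤ._<_ (sym (ℤP.*-identityʳ a)) (sym (ℤP.*-identityʳ b)) h))))

  toℚ-injective : ∀ {a b} → toℚ a ≡ toℚ b → a ≡ b
  toℚ-injective {a} {b} h with ℚᵘP.≃-trans (ℚᵘP.≃-sym (toℚᵘ-toℚ a))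
                                 (ℚᵘP.≃-trans (ℚᵘP.≃-reflexive (cong ℚ.toℚᵘ h)) (toℚᵘ-toℚ b))
  ... | *≡* e = trans (sym (ℤP.*-identityʳ a)) (trans e (ℤP.*-identityʳ b))

  toℚ-sum3 : ∀ f → toℚ (sum3ℤ f) ≡ sum3ℚ (λ i → toℚ (f i))
  toℚ-sum3 f = trans (toℚ-+ (f zero) (f (suc zero) ℤ.+ f (suc (suc zero))))
    (cong (toℚ (f zero) ℚ.+_) (toℚ-+ (f (suc zero)) (f (suc (suc zero)))))

  sum3ℤ-cong : ∀ {f g} → (∀ i → f i ≡ g i) → sum3ℤ f ≡ sum3ℤ g
  sum3ℤ-cong h = cong₂ _+_ (h 0F) (cong₂ _+_ (h 1F) (h 2F))

  sum3ℤ-+ : ∀ f g → sum3ℤ (λ i → f i + g i) ≡ sum3ℤ f + sum3ℤ g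
  sum3ℤ-+ f g = identity (f 0F) (f 1F) (f 2F) (g 0F) (g 1F) (g 2F)
    where
    identity : ∀ a b c d e f → (a + d) + ((b + e) + (c + f)) ≡ (a + (b + c)) + (d + (e + f))
    identity = solve-∀

  sum3ℤ-* : ∀ k f → sum3ℤ (λ i → k * f i) ≡ k * sum3ℤ f
  sum3ℤ-* k f = identity k (f 0F) (f 1F) (f 2F)
    where
    identity : ∀ k a b c → k * a + (k * b + k * c) ≡ k * (a + (b + c))
    identity = solve-∀

  sum3ℤ-indicator : ∀ k (f : Fin 3 → ℤ) → sum3ℤ (λ i → indicator k i * f i) ≡ f k
  sum3ℤ-indicator 0F f = select (f 0F) (f 1F) (f 2F)
    where
    select : ∀ a b c → + 1 * a + (+ 0 * b + + 0 * c) ≡ a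
    select = solve-∀
  sum3ℤ-indicator 1F f = select (f 0F) (f 1F) (f 2F)
    where
    select : ∀ a b c → + 0 * a + (+ 1 * b + + 0 * c) ≡ b
    select = solve-∀
  sum3ℤ-indicator 2F f = select (f 0F) (f 1F) (f 2F)
    where
    select : ∀ a b c → + 0 * a + (+ 0 * b + + 1 * c) ≡ c
    select = solve-∀

  -- The supporting functions have integer coefficients, so all estimates stay in ℤ and only
  -- `toAffine` passes to ℚ.
  record IsAffine (f : ZMat → ℤ) : Set where
    field
      coefficients : ZMat
      constant     : ℤ
      equation     : ∀ X → f X ≡ constant + sum3ℤ λ i → sum3ℤ λ j → coefficients i j * X i j

  affine-const : ∀ k → IsAffine (λ _ → k)
  affine-const k = record { coefficients = λ _ _ → + 0 ; constant = k ; equation = λ X → sym (ℤP.+-identityʳ k) }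

  affine-entry : ∀ k l → IsAffine (λ X → X k l)
  affine-entry k l = record
    { coefficients = λ i j → indicator k i * indicator l j ; constant = + 0
    ; equation = λ X → sym (trans (ℤP.+-identityˡ _) (trans
        (sum3ℤ-cong λ i → trans (sum3ℤ-cong λ j → ℤP.*-assoc (indicator k i) (indicator l j) (X i j))
          (trans (sum3ℤ-* (indicator k i) (λ j → indicator l j * X i j))
                 (cong (indicator k i *_) (sum3ℤ-indicator l (X i)))))
        (sum3ℤ-indicator k (λ i → X i l)))) }

  affine-+ : ∀ {f g} → IsAffine f → IsAffine g → IsAffine (λ X → f X + g X)
  affine-+ {f} {g} F G = record
    { coefficients = λ i j → F.coefficients i j + G.coefficients i j
    ; constant = F.constant + G.constant
    ; equation = λ X → trans (cong₂ _+_ (F.equation X) (G.equation X)) (trans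
        (interchange F.constant _ G.constant _)
        (cong (λ z → F.constant + G.constant + z) (sym (trans
          (sum3ℤ-cong λ i → trans
            (sum3ℤ-cong λ j → ℤP.*-distribʳ-+ (X i j) (F.coefficients i j) (G.coefficients i j))
            (sum3ℤ-+ (λ j → F.coefficients i j * X i j) (λ j → G.coefficients i j * X i j)))
          (sum3ℤ-+ (λ i → sum3ℤ λ j → F.coefficients i j * X i j)
                   (λ i → sum3ℤ λ j → G.coefficients i j * X i j)))))) }
    where
    module F = IsAffine F
    module G = IsAffine G
    interchange : ∀ a b c d → (a + b) + (c + d) ≡ a + c + (b + d)
    interchange = solve-∀

  affine-* : ∀ {f} k → IsAffine f → IsAffine (λ X → k * f X)
  affine-* {f} k F = record
    { coefficients = λ i j → k * F.coefficients i j ; constant = k * F.constant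
    ; equation = λ X → trans (cong (k *_) (F.equation X)) (trans
        (ℤP.*-distribˡ-+ k F.constant _)
        (cong (λ z → k * F.constant + z) (sym (trans
          (sum3ℤ-cong λ i → trans (sum3ℤ-cong λ j → ℤP.*-assoc k (F.coefficients i j) (X i j))
            (sum3ℤ-* k (λ j → F.coefficients i j * X i j)))
          (sum3ℤ-* k (λ i → sum3ℤ λ j → F.coefficients i j * X i j)))))) }
    where module F = IsAffine F

  affine-cong : ∀ {f g} → (∀ X → g X ≡ f X) → IsAffine f → IsAffine g
  affine-cong h F = record { IsAffine F ; equation = λ X → trans (h X) (IsAffine.equation F X) }

  affine-sum3 : ∀ {f : Fin 3 → ZMat → ℤ} → (∀ i → IsAffine (f i)) → IsAffine (λ X → sum3ℤ λ i → f i X)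
  affine-sum3 F = affine-+ (F 0F) (affine-+ (F 1F) (F 2F))

  -- The chord of the square between the consecutive integers k and k + 1.
  chord : ℤ → ℤ → ℤ
  chord k x = (+ 2 * k + + 1) * x + - (k * k + k)

  -- A product of two consecutive integers: zero at `k` and `k + 1`, positive at all other integers.
  -- It is the amount by which the square exceeds its chord.
  gap : ℤ → ℤ → ℤ
  gap k x = (x - k) * ((x - k) - + 1)

  square-chord : ∀ k x → x * x ≡ chord k x + gap k x
  square-chord = identity
    where
    identity : ∀ k x → x * x ≡ ((+ 2 * k + + 1) * x + - (k * k + k)) + (x - k) * ((x - k) - + 1)
    identity = solve-∀

  gap-bit : ∀ k {b} → Bit b → gap k (k + + b) ≡ + 0
  gap-bit k bit0 = identity k
    where
    identity : ∀ k → (k + + 0 - k) * ((k + + 0 - k) - + 1) ≡ + 0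
    identity = solve-∀
  gap-bit k bit1 = identity k
    where
    identity : ∀ k → (k + + 1 - k) * ((k + + 1 - k) - + 1) ≡ + 0
    identity = solve-∀

  consecutive-nonNeg : ∀ y → + 0 ≤ y * (y - + 1)
  consecutive-nonNeg (+ 0)             = ℤ.+≤+ z≤n
  consecutive-nonNeg (+ 1)             = ℤ.+≤+ z≤n
  consecutive-nonNeg (+ suc (suc n))   = ℤ.+≤+ z≤n
  consecutive-nonNeg -[1+ n ]          = ℤ.+≤+ z≤n

  consecutive-pos : ∀ y → y ≢ + 0 → y ≢ + 1 → + 1 ≤ y * (y - + 1)
  consecutive-pos (+ 0)           h _ = ⊥-elim (h refl)
  consecutive-pos (+ 1)           _ h = ⊥-elim (h refl)
  consecutive-pos (+ suc (suc n)) _ _ = ℤ.+≤+ (s≤s z≤n)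
  consecutive-pos -[1+ n ]        _ _ = ℤ.+≤+ (s≤s z≤n)

  gap-pos : ∀ k x → ¬ (k ℕ.≤ x × x ℕ.≤ suc k) → + 1 ≤ gap (+ k) (+ x)
  gap-pos k x h = consecutive-pos (+ x - + k)
    (λ e → h (ℕP.≤-reflexive (sym (x≡k e)) , subst (ℕ._≤ suc k) (sym (x≡k e)) (ℕP.n≤1+n k)))
    (λ e → h (subst (k ℕ.≤_) (sym (x≡1+k e)) (ℕP.n≤1+n k) , ℕP.≤-reflexive (x≡1+k e)))
    where
    restore : ∀ a b → (a - b) + b ≡ a
    restore = solve-∀
    x≡k : + x - + k ≡ + 0 → x ≡ k
    x≡k e = ℤP.+-injective (trans (sym (restore (+ x) (+ k))) (trans (cong (λ z → z + + k) e) (ℤP.+-identityˡ (+ k))))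
    x≡1+k : + x - + k ≡ + 1 → x ≡ suc k
    x≡1+k e = ℤP.+-injective (trans (sym (restore (+ x) (+ k))) (cong (λ z → z + + k) e))

  bilinearℤ : (Fin 3 → ℤ) → (Fin 3 → ℤ) → ℤ
  bilinearℤ p q = p 0F * q 0F + p 0F * q 2F + + 2 * (p 1F * q 2F) + + 2 * (p 2F * q 0F)

  ⁺_ : (Fin 3 → ℕ) → Fin 3 → ℤ
  (⁺ x) l = + x l

  bilinear-ℤ : ∀ p q → + bilinear p q ≡ bilinearℤ (⁺ p) (⁺ q)
  bilinear-ℤ p q = cong₂ _+_ (cong₂ _+_ (cong₂ _+_ (ℤP.pos-* (p 0F) (q 0F)) (ℤP.pos-* (p 0F) (q 2F)))
      (trans (ℤP.pos-* 2 (p 1F ℕ.* q 2F)) (cong (+ 2 *_) (ℤP.pos-* (p 1F) (q 2F)))))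
    (trans (ℤP.pos-* 2 (p 2F ℕ.* q 0F)) (cong (+ 2 *_) (ℤP.pos-* (p 2F) (q 0F))))

  squares-ℤ : ∀ x → + squares x ≡ sum3ℤ (λ l → + x l * + x l)
  squares-ℤ x = cong₂ _+_ (ℤP.pos-* (x 0F) (x 0F)) (cong₂ _+_ (ℤP.pos-* (x 1F) (x 1F)) (ℤP.pos-* (x 2F) (x 2F)))

  -- The three terms in parentheses are affine in the point, so the corners alone determine the
  -- bilinear part up to an affine function.
  bilinear-expand : ∀ k y k' y' →
    bilinearℤ (λ l → k l + y l) (λ l → k' l + y' l) ≡
    (bilinearℤ k (λ l → k' l + y' l) + bilinearℤ (λ l → k l + y l) k' + - bilinearℤ k k') + bilinearℤ y y'
  bilinear-expand k y k' y' = identity (k 0F) (k 1F) (k 2F) (y 0F) (y 1F) (y 2F)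
                                       (k' 0F) (k' 1F) (k' 2F) (y' 0F) (y' 1F) (y' 2F)
    where
    identity : ∀ k₀ k₁ k₂ y₀ y₁ y₂ a₀ a₁ a₂ b₀ b₁ b₂ →
      (k₀ + y₀) * (a₀ + b₀) + (k₀ + y₀) * (a₂ + b₂) + + 2 * ((k₁ + y₁) * (a₂ + b₂)) + + 2 * ((k₂ + y₂) * (a₀ + b₀)) ≡
      ((k₀ * (a₀ + b₀) + k₀ * (a₂ + b₂) + + 2 * (k₁ * (a₂ + b₂)) + + 2 * (k₂ * (a₀ + b₀))) +
       ((k₀ + y₀) * a₀ + (k₀ + y₀) * a₂ + + 2 * ((k₁ + y₁) * a₂) + + 2 * ((k₂ + y₂) * a₀)) +
       - (k₀ * a₀ + k₀ * a₂ + + 2 * (k₁ * a₂) + + 2 * (k₂ * a₀))) +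
      (y₀ * b₀ + y₀ * b₂ + + 2 * (y₁ * b₂) + + 2 * (y₂ * b₀))
    identity = solve-∀

  -- Reflects a downward triangle onto the upward one, so that both orientations yield barycentric
  -- coordinates.
  relative : Bool → ℤ → ℤ
  relative true  y = y
  relative false y = + 1 - y

  relative-corner : ∀ o i l → relative o (+ corner o i l) ≡ indicator i l
  relative-corner true  = ∀3 (∀3 refl refl refl) (∀3 refl refl refl) (∀3 refl refl refl)
  relative-corner false = ∀3 (∀3 refl refl refl) (∀3 refl refl refl) (∀3 refl refl refl)

  corner-bit : ∀ o i l → Bit (corner o i l)
  corner-bit true  = ∀3 (∀3 bit1 bit0 bit0) (∀3 bit0 bit1 bit0) (∀3 bit0 bit0 bit1)
  corner-bit false = ∀3 (∀3 bit0 bit1 bit1) (∀3 bit1 bit0 bit1) (∀3 bit1 bit1 bit0)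

  -- The affine function whose value at corner `i` of the triangle is `lookup a i`.
  weighted : Bool → Vec ℤ 3 → (Fin 3 → ℤ) → (Fin 3 → ℤ) → ℤ
  weighted o a k x = sum3ℤ λ l → lookup a l * relative o (x l - k l)

  weighted-corner : ∀ o a k i → weighted o a (⁺ k) (λ l → + k l + + corner o i l) ≡ lookup a i
  weighted-corner o a k i = trans
    (sum3ℤ-cong λ l → trans
      (cong (lookup a l *_) (trans (cong (relative o) (subtractBack (+ k l) (+ corner o i l))) (relative-corner o i l)))
      (ℤP.*-comm (lookup a l) (indicator i l)))
    (sum3ℤ-indicator i (lookup a))
    where
    subtractBack : ∀ k y → (k + y) - k ≡ y
    subtractBack = solve-∀

  module Support (N : ℕ) (o₁ o₂ : Bool) (K : Mat) (π : Potential) where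

    k₁ k₂ : Fin 3 → ℤ
    k₁ = ⁺ K 1F
    k₂ = ⁺ K 2F

    chords : ZMat → ℤ
    chords X = sum3ℤ (λ l → chord (k₁ l) (X 1F l)) + sum3ℤ (λ l → chord (k₂ l) (X 2F l))

    correction : ZMat → ℤ
    correction X = (bilinearℤ k₁ (X 2F) + bilinearℤ (X 1F) k₂ + - bilinearℤ k₁ k₂) +
                   (weighted o₁ (proj₁ π) k₁ (X 1F) + weighted o₂ (proj₂ π) k₂ (X 2F))

    -- The affine function meant to carry a lower facet: chords replace the squares, the bilinear
    -- form is linearised at the floors, and the potential stands in for the remaining corner costs.
    support : ZMat → ℤ
    support X = + N * chords X + correction X

    affine-chord : ∀ k i l → IsAffine (λ X → chord k (X i l))
    affine-chord k i l = affine-+ (affine-* (+ 2 * k + + 1) (affine-entry i l)) (affine-const (- (k * k + k)))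

    affine-bilinearʳ : ∀ k i → IsAffine (λ X → bilinearℤ k (X i))
    affine-bilinearʳ k i = affine-+ (affine-+ (affine-+
      (affine-* (k 0F) (affine-entry i 0F)) (affine-* (k 0F) (affine-entry i 2F)))
      (affine-* (+ 2) (affine-* (k 1F) (affine-entry i 2F)))) (affine-* (+ 2) (affine-* (k 2F) (affine-entry i 0F)))

    affine-bilinearˡ : ∀ k i → IsAffine (λ X → bilinearℤ (X i) k)
    affine-bilinearˡ k i = affine-+ (affine-+ (affine-+
      (product 0F 0F) (product 0F 2F))
      (affine-* (+ 2) (product 1F 2F))) (affine-* (+ 2) (product 2F 0F))
      where
      product : ∀ l m → IsAffine (λ X → X i l * k m)
      product l m = affine-cong (λ X → ℤP.*-comm (X i l) (k m)) (affine-* (k m) (affine-entry i l))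

    affine-relative : ∀ o k i l → IsAffine (λ X → relative o (X i l - k))
    affine-relative true  k i l = affine-+ (affine-entry i l) (affine-const (- k))
    affine-relative false k i l = affine-cong (λ X → identity (X i l) k)
      (affine-+ (affine-* (- + 1) (affine-entry i l)) (affine-const (+ 1 + k)))
      where
      identity : ∀ x k → + 1 - (x - k) ≡ - + 1 * x + (+ 1 + k)
      identity = solve-∀

    affine-weighted : ∀ o a k i → IsAffine (λ X → weighted o a k (X i))
    affine-weighted o a k i = affine-sum3 λ l → affine-* (lookup a l) (affine-relative o (k l) i l)

    affine-support : IsAffine support
    affine-support = affine-+
      (affine-* (+ N) (affine-+ (affine-sum3 λ l → affine-chord (k₁ l) 1F l)
                                (affine-sum3 λ l → affine-chord (k₂ l) 2F l)))
      (affine-+ (affine-+ (affine-+ (affine-bilinearʳ k₁ 2F) (affine-bilinearˡ k₂ 1F)) (affine-const (- bilinearℤ k₁ k₂)))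
                (affine-+ (affine-weighted o₁ (proj₁ π) k₁ 1F) (affine-weighted o₂ (proj₂ π) k₂ 2F)))

  ⁺⁺_ : Mat → ZMat
  (⁺⁺ x) i j = + x i j

  sum3ℤ-mono-≤ : ∀ {f g} → (∀ i → f i ≤ g i) → sum3ℤ f ≤ sum3ℤ g
  sum3ℤ-mono-≤ h = ℤP.+-mono-≤ (h 0F) (ℤP.+-mono-≤ (h 1F) (h 2F))

  i≤+∣i∣ : ∀ i → i ≤ + ℤ.∣ i ∣
  i≤+∣i∣ (+ n)    = ℤP.≤-refl
  i≤+∣i∣ -[1+ n ] = ℤ.-≤+

  relative-bound : ∀ o x k → ℤ.∣ relative o (+ x - + k) ∣ ℕ.≤ suc (x ℕ.+ k)
  relative-bound true  x k = ℕP.m≤n⇒m≤1+n (ℤP.∣i-j∣≤∣i∣+∣j∣ (+ x) (+ k))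
  relative-bound false x k = ℕP.≤-trans (ℤP.∣i-j∣≤∣i∣+∣j∣ (+ 1) (+ x - + k)) (s≤s (ℤP.∣i-j∣≤∣i∣+∣j∣ (+ x) (+ k)))

  weighted-bound : ∀ o a k x → (∀ l → ℤ.∣ lookup a l ∣ ℕ.≤ 10) →
    weighted o a (⁺ k) (⁺ x) ≤ + (10 ℕ.* (3 ℕ.+ sum3ℕ x ℕ.+ sum3ℕ k))
  weighted-bound o a k x bounded = ℤP.≤-trans (sum3ℤ-mono-≤ term)
    (ℤ.+≤+ (ℕP.≤-reflexive (collect (x 0F) (x 1F) (x 2F) (k 0F) (k 1F) (k 2F))))
    where
    term : ∀ l → lookup a l * relative o (+ x l - + k l) ≤ + (10 ℕ.* suc (x l ℕ.+ k l))
    term l = ℤP.≤-trans (i≤+∣i∣ _) (ℤ.+≤+ (ℕP.≤-trans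
      (ℕP.≤-reflexive (ℤP.abs-* (lookup a l) (relative o (+ x l - + k l))))
      (ℕP.*-mono-≤ (bounded l) (relative-bound o (x l) (k l)))))
    collect : ∀ x₀ x₁ x₂ k₀ k₁ k₂ →
      10 ℕ.* suc (x₀ ℕ.+ k₀) ℕ.+ (10 ℕ.* suc (x₁ ℕ.+ k₁) ℕ.+ 10 ℕ.* suc (x₂ ℕ.+ k₂)) ≡
      10 ℕ.* (3 ℕ.+ (x₀ ℕ.+ (x₁ ℕ.+ x₂)) ℕ.+ (k₀ ℕ.+ (k₁ ℕ.+ k₂)))
    collect = linarith 6 λ x₀ x₁ x₂ k₀ k₁ k₂ → []
      ⊢ 10 :* (con 1 :+ (x₀ :+ k₀)) :+ (10 :* (con 1 :+ (x₁ :+ k₁)) :+ 10 :* (con 1 :+ (x₂ :+ k₂))) :≡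
        10 :* (con 3 :+ (x₀ :+ (x₁ :+ x₂)) :+ (k₀ :+ (k₁ :+ k₂)))

  squares-gap : ∀ (k : Fin 3 → ℤ) x → + squares x ≡ sum3ℤ (λ l → chord (k l) (+ x l)) + sum3ℤ (λ l → gap (k l) (+ x l))
  squares-gap k x = trans (squares-ℤ x) (trans (sum3ℤ-cong λ l → square-chord (k l) (+ x l))
    (sum3ℤ-+ (λ l → chord (k l) (+ x l)) (λ l → gap (k l) (+ x l))))

  squares-corner : ∀ o (k : Fin 3 → ℕ) i → + squares (λ l → k l ℕ.+ corner o i l) ≡
                             sum3ℤ (λ l → chord (+ k l) (+ (k l ℕ.+ corner o i l)))
  squares-corner o k i = trans (squares-gap (⁺ k) (λ l → k l ℕ.+ corner o i l)) (trans
    (cong (λ z → sum3ℤ (λ l → chord (+ k l) (+ (k l ℕ.+ corner o i l))) + z)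
      (sum3ℤ-cong {g = λ _ → + 0} λ l → gap-bit (+ k l) (corner-bit o i l)))
    (ℤP.+-identityʳ _))

  sum3ℤ-gap-nonNeg : ∀ (k x : Fin 3 → ℤ) → + 0 ≤ sum3ℤ (λ l → gap (k l) (x l))
  sum3ℤ-gap-nonNeg k x = sum3ℤ-mono-≤ {λ _ → + 0} λ l → consecutive-nonNeg (x l - k l)

  sum3ℤ-gap-pos : ∀ (k x : Fin 3 → ℤ) l → + 1 ≤ gap (k l) (x l) → + 1 ≤ sum3ℤ (λ l → gap (k l) (x l))
  sum3ℤ-gap-pos k x 0F h = ℤP.+-mono-≤ h (ℤP.+-mono-≤ (nn 1F) (nn 2F))
    where nn = λ l → consecutive-nonNeg (x l - k l)
  sum3ℤ-gap-pos k x 1F h = ℤP.+-mono-≤ (nn 0F) (ℤP.+-mono-≤ h (nn 2F))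
    where nn = λ l → consecutive-nonNeg (x l - k l)
  sum3ℤ-gap-pos k x 2F h = ℤP.+-mono-≤ (nn 0F) (ℤP.+-mono-≤ (nn 1F) h)
    where nn = λ l → consecutive-nonNeg (x l - k l)

  module Facets (ι : Involution) (r c : Fin 3 → ℕ) (r≡c : sum3ℕ r ≡ sum3ℕ c) where

    open Points ι r c
    open Cells ι r c r≡c

    height-ℤ : ∀ x → + heightOf x ≡ + N * (+ squares (x 1F) + + squares (x 2F)) + + bilinear (x 1F) (x 2F)
    height-ℤ x = cong (λ z → z + + bilinear (x 1F) (x 2F)) (ℤP.pos-* N (squaresPart x))

    module _ (o₁ o₂ : Bool) (K : Mat) (π : Potential) where

      open Support N o₁ o₂ K π

      -- Height minus support is the reduced cost of the position. Inside the cell, dual feasibility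
      -- with complementary slackness is therefore the lower facet condition.
      support-cellPoint : ∀ (p@(i , j) : Position) → let x = cellPoint o₁ o₂ K p in
        + heightOf x ≡ support (⁺⁺ x) + (+ cellCost o₁ o₂ i j - value π p)
      support-cellPoint (i , j) = trans (height-ℤ x) (trans
        (cong₂ _+_
          (cong (+ N *_) (cong₂ _+_ (squares-corner o₁ (K 1F) i) (squares-corner o₂ (K 2F) j)))
          (trans (bilinear-ℤ (x 1F) (x 2F)) (trans
            (bilinear-expand k₁ (⁺ corner o₁ i) k₂ (⁺ corner o₂ j))
            (cong (λ z → B + z) (sym (bilinear-ℤ (corner o₁ i) (corner o₂ j)))))))
        (trans (regroup (+ N * chords (⁺⁺ x)) B (+ cellCost o₁ o₂ i j) (lookup (proj₁ π) i) (lookup (proj₂ π) j))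
          (cong (λ z → (+ N * chords (⁺⁺ x) + (B + z)) + (+ cellCost o₁ o₂ i j - value π (i , j)))
            (cong₂ _+_ (sym (weighted-corner o₁ (proj₁ π) (K 1F) i)) (sym (weighted-corner o₂ (proj₂ π) (K 2F) j))))))
        where
        x = cellPoint o₁ o₂ K (i , j)
        B : ℤ
        B = bilinearℤ k₁ (⁺ x 2F) + bilinearℤ (⁺ x 1F) k₂ + - bilinearℤ k₁ k₂
        regroup : ∀ n b c u v → n + (b + c) ≡ (n + (b + (u + v))) + (c - (u + v))
        regroup = solve-∀

      -- The two mixed bilinear terms are at most `2 * (S * S)` each, the two weighted sums at most
      -- `10 * (3 + S + S)` each, and the subtracted term contributes at most 0: together at most
      -- `N - 1`.
      correction-bound : ∀ x → Margins r c x → sum3ℕ (K 1F) ℕ.≤ S → sum3ℕ (K 2F) ℕ.≤ S →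
        (∀ l → ℤ.∣ lookup (proj₁ π) l ∣ ℕ.≤ 10) → (∀ l → ℤ.∣ lookup (proj₂ π) l ∣ ℕ.≤ 10) →
        correction (⁺⁺ x) < + N
      correction-bound x xm K₁ K₂ ba bb = ℤP.≤-<-trans
        (ℤP.+-mono-≤
          (ℤP.+-mono-≤ (ℤP.+-mono-≤ (product (K 1F) (x 2F) K₁ (row-bound {x} xm 2F))
                                      (product (x 1F) (K 2F) (row-bound {x} xm 1F) K₂))
            (subst (- bilinearℤ k₁ k₂ ≤_) refl (ℤP.≤-trans
              (ℤP.≤-reflexive (cong -_ (sym (bilinear-ℤ (K 1F) (K 2F)))))
              (ℤP.neg-mono-≤ {+ 0} {+ bilinear (K 1F) (K 2F)} (ℤ.+≤+ z≤n)))))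
          (ℤP.+-mono-≤ (weighted-bound o₁ (proj₁ π) (K 1F) (x 1F) ba) (weighted-bound o₂ (proj₂ π) (K 2F) (x 2F) bb)))
        (ℤ.+<+ (estimate (S ℕ.* S) S _ _ _ _ (row-bound {x} xm 1F) (row-bound {x} xm 2F) K₁ K₂))
        where
        product : ∀ p q → sum3ℕ p ℕ.≤ S → sum3ℕ q ℕ.≤ S → bilinearℤ (⁺ p) (⁺ q) ≤ + (2 ℕ.* (S ℕ.* S))
        product p q hp hq = subst (_≤ + (2 ℕ.* (S ℕ.* S))) (bilinear-ℤ p q)
          (ℤ.+≤+ (ℕP.≤-trans (bilinear-≤ p q) (ℕP.*-monoʳ-≤ 2 (ℕP.*-mono-≤ hp hq))))
        estimate : ∀ q s a b k l → a ℕ.≤ s → b ℕ.≤ s → k ℕ.≤ s → l ℕ.≤ s →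
          2 ℕ.* q ℕ.+ 2 ℕ.* q ℕ.+ 0 ℕ.+ (10 ℕ.* (3 ℕ.+ a ℕ.+ k) ℕ.+ 10 ℕ.* (3 ℕ.+ b ℕ.+ l)) ℕ.< 4 ℕ.* q ℕ.+ 40 ℕ.* s ℕ.+ 61
        estimate = linarith 6 λ q s a b k l → a :≤ s ∷ b :≤ s ∷ k :≤ s ∷ l :≤ s ∷ []
          ⊢ 2 :* q :+ 2 :* q :+ con 0 :+ (10 :* (con 3 :+ a :+ k) :+ 10 :* (con 3 :+ b :+ l)) :<
            4 :* q :+ 40 :* s :+ con 61

      -- Outside the box some gap is at least 1, so `N` times the squares exceeds `N` times the
      -- chords by at least `N`, more than the whole correction. The bilinear part of the height is
      -- nonnegative.
      support-off-cell : ∀ x → correction (⁺⁺ x) < + N →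
        (i : Fin 2) (l : Fin 3) → ¬ (K (suc i) l ℕ.≤ x (suc i) l × x (suc i) l ℕ.≤ suc (K (suc i) l)) →
        support (⁺⁺ x) < + heightOf x
      support-off-cell x corr i l out = ℤP.<-≤-trans
        (ℤP.+-monoʳ-< (+ N * chords (⁺⁺ x)) corr)
        (ℤP.≤-trans
          (ℤP.≤-trans
            (ℤP.+-monoʳ-≤ (+ N * chords (⁺⁺ x)) (subst (_≤ + N * gaps) (ℤP.*-identityʳ (+ N))
              (ℤP.*-monoˡ-≤-nonNeg (+ N) (gaps-pos i l out))))
            (ℤP.≤-reflexive (trans (sym (ℤP.*-distribˡ-+ (+ N) (chords (⁺⁺ x)) gaps)) (cong (+ N *_) (sym split)))))
          (ℤP.≤-trans (ℤP.i≤i+j _ (+ bilinear (x 1F) (x 2F))) (ℤP.≤-reflexive (sym (height-ℤ x)))))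
        where
        gaps₁ gaps₂ gaps : ℤ
        gaps₁ = sum3ℤ λ l → gap (k₁ l) (+ x 1F l)
        gaps₂ = sum3ℤ λ l → gap (k₂ l) (+ x 2F l)
        gaps = gaps₁ + gaps₂
        interchange : ∀ a b c d → (a + b) + (c + d) ≡ (a + c) + (b + d)
        interchange = solve-∀
        split : + squares (x 1F) + + squares (x 2F) ≡ chords (⁺⁺ x) + gaps
        split = trans (cong₂ _+_ (squares-gap k₁ (x 1F)) (squares-gap k₂ (x 2F)))
          (interchange (sum3ℤ λ l → chord (k₁ l) (+ x 1F l)) gaps₁ (sum3ℤ λ l → chord (k₂ l) (+ x 2F l)) gaps₂)
        gaps-pos : ∀ i l → ¬ (K (suc i) l ℕ.≤ x (suc i) l × x (suc i) l ℕ.≤ suc (K (suc i) l)) → + 1 ≤ gaps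
        gaps-pos zero l h = ℤP.+-mono-≤ {+ 1} {gaps₁} {+ 0} {gaps₂}
          (sum3ℤ-gap-pos k₁ (⁺ x 1F) l (gap-pos (K 1F l) (x 1F l) h)) (sum3ℤ-gap-nonNeg k₂ (⁺ x 2F))
        gaps-pos (suc zero) l h = ℤP.+-mono-≤ {+ 0} {gaps₁} {+ 1} {gaps₂}
          (sum3ℤ-gap-nonNeg k₁ (⁺ x 1F)) (sum3ℤ-gap-pos k₂ (⁺ x 2F) l (gap-pos (K 2F l) (x 2F l) h))

      InBox⁻ : ∀ M → ¬ InBox K M → ∃₂ λ i l → ¬ (K (suc i) l ℕ.≤ ent M (suc i) l × ent M (suc i) l ℕ.≤ suc (K (suc i) l))
      InBox⁻ M h =
        let i , hi = ¬∀⟶∃¬ 2 (λ i → ∀ l → inStrip i l) (λ i → all? λ l → inStrip? i l) h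
            l , hl = ¬∀⟶∃¬ 3 (inStrip i) (inStrip? i) hi
        in i , l , hl
        where
        inStrip = λ (i : Fin 2) l → K (suc i) l ℕ.≤ ent M (suc i) l × ent M (suc i) l ℕ.≤ suc (K (suc i) l)
        inStrip? = λ i l → (K (suc i) l ℕ.≤? ent M (suc i) l) ×-dec (ent M (suc i) l ℕ.≤? suc (K (suc i) l))

    toAffine : ∀ {f} → IsAffine f → Affine
    toAffine F = affine (λ i j → toℚ (coefficients (Involution.to ι i) j)) (toℚ constant)
      where open IsAffine F

    evalAff-toAffine : ∀ {f} (F : IsAffine f) M → evalAff (toAffine F) M ≡ toℚ (f (⁺⁺ ent M))
    evalAff-toAffine {f} F M = sym (trans (cong toℚ (equation (⁺⁺ ent M))) (trans (toℚ-+ constant _)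
      (cong (toℚ constant ℚ.+_) (trans (cong toℚ (sym (fold-to _+_ ℤP.+-assoc ℤP.+-comm row)))
        (trans (toℚ-sum3 (row ∘ to)) (sum3ℚ-cong λ i → trans
          (toℚ-sum3 (λ j → coefficients (to i) j * + ent M (to i) j))
          (sum3ℚ-cong λ j → trans (toℚ-* (coefficients (to i) j) (+ ent M (to i) j))
            (cong (λ k → toℚ (coefficients (to i) j) ℚ.* ℕtoℚ (entry M k j)) (involutive i)))))))))
      where
      open IsAffine F
      open Involution ι
      row : Fin 3 → ℤ
      row i = sum3ℤ λ j → coefficients i j * + ent M i j
      sum3ℚ-cong : ∀ {f g} → (∀ i → f i ≡ g i) → sum3ℚ f ≡ sum3ℚ g
      sum3ℚ-cong h = cong₂ ℚ._+_ (h 0F) (cong₂ ℚ._+_ (h 1F) (h 2F))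

  sameIndex-sound : ∀ i j → T (sameIndex i j) → i ≡ j
  sameIndex-sound 0F 0F _ = refl
  sameIndex-sound 1F 1F _ = refl
  sameIndex-sound 2F 2F _ = refl

  sameIndex-refl : ∀ i → T (sameIndex i i)
  sameIndex-refl = ∀3 tt tt tt

  T-∧⁺ : ∀ {x y} → T x → T y → T (x ∧ y)
  T-∧⁺ {true} _ t = t

  samePosition-sound : ∀ p q → T (samePosition p q) → p ≡ q
  samePosition-sound (i , j) (k , l) t =
    cong₂ _,_ (sameIndex-sound i k (proj₁ (T-∧⁻ t))) (sameIndex-sound j l (proj₂ (T-∧⁻ {sameIndex i k} t)))

  isIn-sound : ∀ {n} p (es : Vec Position n) → T (any (samePosition p) (Vec.toList es)) → p VM.∈ es
  isIn-sound p (e ∷ es) t with Equivalence.to (T-∨ {samePosition p e}) t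
  ... | inj₁ t' = here (samePosition-sound p e t')
  ... | inj₂ t' = there (isIn-sound p es t')

  isIn-complete : ∀ {n} p (es : Vec Position n) → p VM.∈ es → T (any (samePosition p) (Vec.toList es))
  isIn-complete p (e ∷ es) (here refl) =
    Equivalence.from T-∨ (inj₁ (T-∧⁺ (sameIndex-refl (proj₁ p)) (sameIndex-refl (proj₂ p))))
  isIn-complete p (e ∷ es) (there h) = Equivalence.from (T-∨ {samePosition p e}) (inj₂ (isIn-complete p es h))

  module _ (o₁ o₂ : Bool) (t : Vec Bool 3) (es : Edges) (π : Potential) where

    optimalAt-in : ∀ i j → T (optimalAt o₁ o₂ t es π (i , j)) → T ((i , j) isIn es) →
                   T (allowed o₁ o₂ t (i , j)) × value π (i , j) ≡ + cellCost o₁ o₂ i j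
    optimalAt-in i j h h' with (i , j) isIn es
    ... | true = let a , b = T-∧⁻ h in a , toWitness {a? = value π (i , j) ℤ.≟ + cellCost o₁ o₂ i j} b

    optimalAt-out : ∀ i j → T (optimalAt o₁ o₂ t es π (i , j)) → ¬ T ((i , j) isIn es) →
                    T (allowed o₁ o₂ t (i , j)) → value π (i , j) < + cellCost o₁ o₂ i j
    optimalAt-out i j h h' al with (i , j) isIn es | allowed o₁ o₂ t (i , j)
    ... | true  | _    = ⊥-elim (h' tt)
    ... | false | true = toWitness {a? = value π (i , j) ℤ.<? + cellCost o₁ o₂ i j} h

    optimal-at : T (optimalFor o₁ o₂ t es π) → ∀ i j → T (optimalAt o₁ o₂ t es π (i , j))
    optimal-at h i j = every-sound (λ j → optimalAt o₁ o₂ t es π (i , j))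
      (every-sound (λ i → every λ j → optimalAt o₁ o₂ t es π (i , j)) (proj₁ (T-∧⁻ h)) i) j

    optimal-bounded : T (optimalFor o₁ o₂ t es π) → ∀ i →
                      ℤ.∣ lookup (proj₁ π) i ∣ ℕ.≤ 10 × ℤ.∣ lookup (proj₂ π) i ∣ ℕ.≤ 10
    optimal-bounded h i =
      let b = every-sound (λ i → bounded (lookup (proj₁ π) i) ∧ bounded (lookup (proj₂ π) i))
                (proj₂ (T-∧⁻ {every (λ i → every λ j → optimalAt o₁ o₂ t es π (i , j))} h)) i
          b₁ , b₂ = T-∧⁻ b
      in ℕP.≤ᵇ⇒≤ _ 10 b₁ , ℕP.≤ᵇ⇒≤ _ 10 b₂

  affine-≗ : ∀ {f} → IsAffine f → ∀ {X Y} → (∀ i j → X i j ≡ Y i j) → f X ≡ f Y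
  affine-≗ F {X} {Y} h = trans (equation X) (trans
    (cong (λ z → constant + z) (sum3ℤ-cong λ i → sum3ℤ-cong λ j → cong (coefficients i j *_) (h i j)))
    (sym (equation Y)))
    where open IsAffine F

  affine-sums : ∀ {f} → IsAffine f → ∀ {X Y X' Y'} → (∀ i j → X i j + Y i j ≡ X' i j + Y' i j) →
                f X + f Y ≡ f X' + f Y'
  affine-sums {f} F {X} {Y} {X'} {Y'} h = trans (together X Y) (trans
    (cong (λ z → constant + constant + z) (sum3ℤ-cong λ i → sum3ℤ-cong λ j → cong (coefficients i j *_) (h i j)))
    (sym (together X' Y')))
    where
    open IsAffine F
    interchange : ∀ a b c → (a + b) + (a + c) ≡ a + a + (b + c)
    interchange = solve-∀
    together : ∀ X Y → f X + f Y ≡ constant + constant + sum3ℤ λ i → sum3ℤ λ j → coefficients i j * (X i j + Y i j)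
    together X Y = trans (cong₂ _+_ (equation X) (equation Y)) (trans
      (interchange constant (sum3ℤ λ i → sum3ℤ λ j → coefficients i j * X i j) (sum3ℤ λ i → sum3ℤ λ j → coefficients i j * Y i j))
      (cong (λ z → constant + constant + z) (sym (trans
        (sum3ℤ-cong λ i → trans (sum3ℤ-cong λ j → ℤP.*-distribˡ-+ (coefficients i j) (X i j) (Y i j))
          (sum3ℤ-+ (λ j → coefficients i j * X i j) (λ j → coefficients i j * Y i j)))
        (sum3ℤ-+ (λ i → sum3ℤ λ j → coefficients i j * X i j) (λ i → sum3ℤ λ j → coefficients i j * Y i j))))))

  _≟ᴹ_ : (M M' : LMat) → Dec (M ≡ M')
  _≟ᴹ_ = ≡-dec (≡-dec ℕ._≟_)

  open VDec _≟ᴹ_ using () renaming (_∈?_ to _∈ᵛ?_)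

  module Simplices (ι : Involution) (r c : Fin 3 → ℕ) (r≡c : sum3ℕ r ≡ sum3ℕ c) (trees : List Edges) where

    open Points ι r c
    open Cells ι r c r≡c
    open Facets ι r c r≡c

    simplex : Bool → Bool → Mat → Edges → Simplex
    simplex o₁ o₂ K es = Vec.map (λ p → build (cellPoint o₁ o₂ K p)) es

    vert-simplex : ∀ o₁ o₂ K es k i j → ent (vert (simplex o₁ o₂ K es) k) i j ≡ cellPoint o₁ o₂ K (lookup es k) i j
    vert-simplex o₁ o₂ K es k i j = trans
      (cong (λ M → ent M i j) (lookup-map k (λ p → build (cellPoint o₁ o₂ K p)) es))
      (ent-build (cellPoint o₁ o₂ K (lookup es k)) i j)

    bools : List Bool
    bools = true ∷ false ∷ []

    frames : List (Bool × Bool × LMat)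
    frames = List.filter (λ (o₁ , o₂ , K) → isCell? o₁ o₂ (ent K))
      (List.cartesianProduct bools (List.cartesianProduct bools candidates))

    simplicesOf : Bool × Bool × LMat → List Simplex
    simplicesOf (o₁ , o₂ , K) =
      List.map (simplex o₁ o₂ (ent K)) (filterᵇ (optimal o₁ o₂ (tightness (ent K))) trees)

    allSimplices : List Simplex
    allSimplices = List.concatMap simplicesOf frames

    record Cell-of (σ : Simplex) : Set where
      field
        o₁ o₂   : Bool
        K       : Mat
        es      : Edges
        cell    : IsCell o₁ o₂ K
        tree    : es ∈ trees
        best    : T (optimal o₁ o₂ (tightness K) es)
        is      : σ ≡ simplex o₁ o₂ K es

    cell-of : ∀ σ → σ ∈ allSimplices → Cell-of σ
    cell-of σ σ∈ =
      let ss , σ∈ss , ss∈ = ∈P.∈-concat⁻′ (List.map simplicesOf frames) σ∈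
          (o₁ , o₂ , K) , f∈ , eq = ∈P.∈-map⁻ simplicesOf ss∈
          es , es∈ , is = ∈P.∈-map⁻ (simplex o₁ o₂ (ent K)) (subst (σ ∈_) eq σ∈ss)
          tree , best = ∈P.∈-filter⁻ (T? ∘ optimal o₁ o₂ (tightness (ent K))) {xs = trees} es∈
          _ , cell = ∈P.∈-filter⁻ (λ (o₁ , o₂ , K) → isCell? o₁ o₂ (ent K))
                       {xs = List.cartesianProduct bools (List.cartesianProduct bools candidates)} f∈
      in record { o₁ = o₁ ; o₂ = o₂ ; K = ent K ; es = es ; cell = cell ; tree = tree ; best = best ; is = is }

    bool∈ : ∀ b → b ∈ bools
    bool∈ true  = Any.here refl
    bool∈ false = Any.there (Any.here refl)

    cell-bound : ∀ {o₁ o₂ K} → IsCell o₁ o₂ K → ∀ i l → K i l ℕ.≤ S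
    cell-bound {K = K} (columns , _) i l = ℕP.≤-trans (ℕP.≤-trans
      (≤-sum3ℕ (λ i → K i l) i) (ℕP.≤-trans (ℕP.n≤1+n _) (ℕP.≤-reflexive (columns l))))
      (ℕP.≤-trans (≤-sum3ℕ c l) (ℕP.≤-reflexive (sym r≡c)))

    simplex∈ : ∀ o₁ o₂ K es → IsCell o₁ o₂ (ent K) → es ∈ trees → T (optimal o₁ o₂ (tightness (ent K)) es) →
               simplex o₁ o₂ (ent K) es ∈ allSimplices
    simplex∈ o₁ o₂ K es cell tree best =
      ∈P.∈-concat⁺′ (∈P.∈-map⁺ (simplex o₁ o₂ (ent K)) (∈P.∈-filter⁺ (T? ∘ optimal o₁ o₂ (tightness (ent K))) tree best))
        (∈P.∈-map⁺ simplicesOf (∈P.∈-filter⁺ (λ (o₁ , o₂ , K) → isCell? o₁ o₂ (ent K))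
          (∈P.∈-cartesianProduct⁺ (bool∈ o₁) (∈P.∈-cartesianProduct⁺ (bool∈ o₂)
            (∈-candidates K (cell-bound {o₁} {o₂} {ent K} cell)))) cell))

    height : LMat → ℚ
    height M = ℕtoℚ (ω M)

    module _ {σ} (C : Cell-of σ) where
      open Cell-of C

      private
        π : Potential
        π = costPotential o₁ o₂ es

      open Support N o₁ o₂ K π

      best-for : T (optimalFor o₁ o₂ (tightness K) es π)
      best-for = optimal-potential o₁ o₂ (tightness K) es best

      vertex-allowed : ∀ k → let p = lookup es k in
        T (allowed o₁ o₂ (tightness K) p) × value π p ≡ + cellCost o₁ o₂ (proj₁ p) (proj₂ p)
      vertex-allowed k = let i , j = lookup es k in
        optimalAt-in o₁ o₂ (tightness K) es π i j
          (optimal-at o₁ o₂ (tightness K) es π best-for i j) (isIn-complete (i , j) es (VMP.∈-lookup k es))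

      vertex-point : ∀ k → IsPoint (vert σ k)
      vertex-point k = subst (λ τ → IsPoint (vert τ k)) (sym is) (margins-≗
        (vert-simplex o₁ o₂ K es k)
        (cellPoint-margins o₁ o₂ K (lookup es k) cell (proj₁ (vertex-allowed k))))

      facet : Affine
      facet = toAffine affine-support

      height-at : ∀ M p → (∀ i j → ent M i j ≡ cellPoint o₁ o₂ K p i j) →
        + ω M ≡ support (⁺⁺ ent M) + (+ cellCost o₁ o₂ (proj₁ p) (proj₂ p) - value π p)
      height-at M p h = trans (cong +_ (heightOf-cong h)) (trans (support-cellPoint o₁ o₂ K π p)
        (cong (λ z → z + (+ cellCost o₁ o₂ (proj₁ p) (proj₂ p) - value π p))
          (affine-≗ affine-support (λ i j → cong +_ (sym (h i j))))))

      support-vertex : ∀ k → support (⁺⁺ ent (vert σ k)) ≡ + ω (vert σ k)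
      support-vertex k = sym (trans
        (height-at (vert σ k) p λ i j → trans (cong (λ τ → ent (vert τ k) i j) is) (vert-simplex o₁ o₂ K es k i j))
        (trans (cong (λ z → support (⁺⁺ ent (vert σ k)) + (+ cellCost o₁ o₂ (proj₁ p) (proj₂ p) - z))
                     (proj₂ (vertex-allowed k)))
          (vanish (support (⁺⁺ ent (vert σ k))) (+ cellCost o₁ o₂ (proj₁ p) (proj₂ p)))))
        where
        p = lookup es k
        vanish : ∀ a b → a + (b - b) ≡ a
        vanish = solve-∀

      support-member : ∀ M → M VM.∈ σ → support (⁺⁺ ent M) ≡ + ω M
      support-member M M∈ = subst (λ M → support (⁺⁺ ent M) ≡ + ω M) (sym (VAnyP.lookup-index M∈))
        (support-vertex (VAny.index M∈))

      facet-vertex : ∀ k → evalAff facet (vert σ k) ≡ height (vert σ k)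
      facet-vertex k = trans (evalAff-toAffine affine-support (vert σ k)) (cong toℚ (support-vertex k))

      -- Outside the box the gaps decide; inside it `M` is a cell point off the tree, and its
      -- reduced cost is positive.
      support-below : ∀ M → IsPoint M → ¬ (M VM.∈ σ) → support (⁺⁺ ent M) < + ω M
      support-below M pM M∉σ with inBox? K M
      ... | no out =
        let i , l , out' = InBox⁻ o₁ o₂ K π M out
            _ , row₁ , row₂ , _ = cell
            small : ∀ i s → sum3ℕ (K i) ℕ.+ s ≡ r i → sum3ℕ (K i) ℕ.≤ S
            small i s e = ℕP.≤-trans (ℕP.m≤m+n _ s) (ℕP.≤-trans (ℕP.≤-reflexive e) (≤-sum3ℕ r i))
            b = optimal-bounded o₁ o₂ (tightness K) es π best-for
        in support-off-cell o₁ o₂ K π (ent M)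
             (correction-bound o₁ o₂ K π (ent M) pM (small 1F _ row₁) (small 2F _ row₂)
               (proj₁ ∘ b) (proj₂ ∘ b))
             i l out'
      ... | yes box =
        let (i , j) , al , h = box-point o₁ o₂ K M cell pM box
            notIn : ¬ T ((i , j) isIn es)
            notIn t = M∉σ (subst₂ (λ M τ → M VM.∈ τ) (sym (build-unique M (cellPoint o₁ o₂ K (i , j)) h)) (sym is)
              (VMP.∈-map⁺ (λ p → build (cellPoint o₁ o₂ K p)) (isIn-sound (i , j) es t)))
            v<c = optimalAt-out o₁ o₂ (tightness K) es π i j
                    (optimal-at o₁ o₂ (tightness K) es π best-for i j) notIn al
        in subst (support (⁺⁺ ent M) <_) (sym (height-at M (i , j) h))
             (subst (_< support (⁺⁺ ent M) + (+ cellCost o₁ o₂ i j - value π (i , j)))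
               (ℤP.+-identityʳ (support (⁺⁺ ent M)))
               (ℤP.+-monoʳ-< (support (⁺⁺ ent M))
                 (subst (_< + cellCost o₁ o₂ i j - value π (i , j)) (ℤP.+-inverseʳ (value π (i , j)))
                   (ℤP.+-monoˡ-< (- value π (i , j)) v<c))))

      facet-below : ∀ M → IsPoint M → ¬ (M VM.∈ σ) → evalAff facet M ℚ.< height M
      facet-below M pM M∉σ = subst (ℚ._< height M) (sym (evalAff-toAffine affine-support M))
        (toℚ-mono-< (support-below M pM M∉σ))

      support-≤ : ∀ M → IsPoint M → support (⁺⁺ ent M) ≤ + ω M
      support-≤ M pM with M ∈ᵛ? σ
      ... | yes M∈σ = ℤP.≤-reflexive (support-member M M∈σ)
      ... | no  M∉σ = ℤP.<⇒≤ (support-below M pM M∉σ)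

      -- The support equals ω on `σ` and nowhere exceeds it, and its total over a pair depends only
      -- on the sum of the pair. A cheaper pair would fall below its own support.
      members-irreducible : ∀ a b → a VM.∈ σ → b VM.∈ σ → ¬ Reducible a b
      members-irreducible a b a∈ b∈ red =
        let a' , b' , pa , pb , sums , lt = reducible-elim {a} {b} red in
        ℤP.<-irrefl refl (ℤP.<-≤-trans (ℤ.+<+ lt) (subst₂ _≤_
          (trans (affine-sums affine-support {⁺⁺ ent a'} {⁺⁺ ent b'} {⁺⁺ ent a} {⁺⁺ ent b} (λ i j → cong +_ (sums i j)))
            (cong₂ _+_ (support-member a a∈) (support-member b b∈)))
          refl (ℤP.+-mono-≤ (support-≤ a' pa) (support-≤ b' pb))))

  sum5ℤ-cong : ∀ {f g : Fin 5 → ℤ} → (∀ k → f k ≡ g k) → sum5ℤ f ≡ sum5ℤ g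
  sum5ℤ-cong h = cong₂ _+_ (h zero) (cong₂ _+_ (h (suc zero)) (sum3ℤ-cong λ k → h (suc (suc k))))

  sum5ℤ-linear : ∀ x (f g : Fin 5 → ℤ) → sum5ℤ (λ k → x * f k + g k) ≡ x * sum5ℤ f + sum5ℤ g
  sum5ℤ-linear x f g = identity x (f 0F) (f 1F) (f 2F) (f (suc 2F)) (f (suc (suc 2F)))
                                  (g 0F) (g 1F) (g 2F) (g (suc 2F)) (g (suc (suc 2F)))
    where
    identity : ∀ x a b c d e a' b' c' d' e' →
      (x * a + a') + ((x * b + b') + ((x * c + c') + ((x * d + d') + (x * e + e')))) ≡
      x * (a + (b + (c + (d + e)))) + (a' + (b' + (c' + (d' + e'))))
    identity = solve-∀

  isFlow-sound : ∀ es δ η w → T (isFlow es δ η w) →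
                 (∀ i → outflow es w i ≡ δ i) × (∀ j → inflow es w j ≡ η j)
  isFlow-sound es δ η w t =
    (λ i → toWitness {a? = outflow es w i ℤ.≟ δ i}
      (every-sound (λ i → ⌊ outflow es w i ℤ.≟ δ i ⌋) (proj₁ (T-∧⁻ t)) i)) ,
    (λ j → toWitness {a? = inflow es w j ℤ.≟ η j}
      (every-sound (λ j → ⌊ inflow es w j ℤ.≟ η j ⌋)
        (proj₂ (T-∧⁻ {every (λ i → ⌊ outflow es w i ℤ.≟ δ i ⌋)} t)) j))
    where open import Relation.Nullary using (⌊_⌋)

  combination : (x₁ x₂ y₁ y₂ : ℤ) (A B C D : Fin 5 → ℤ) → Fin 5 → ℤ
  combination x₁ x₂ y₁ y₂ A B C D k = x₁ * A k + (x₂ * B k + (y₁ * C k + y₂ * D k))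

  sum5ℤ-combination : ∀ x₁ x₂ y₁ y₂ (A B C D I : Fin 5 → ℤ) → sum5ℤ (λ k → combination x₁ x₂ y₁ y₂ A B C D k * I k) ≡
    x₁ * sum5ℤ (λ k → A k * I k) + (x₂ * sum5ℤ (λ k → B k * I k) +
      (y₁ * sum5ℤ (λ k → C k * I k) + y₂ * sum5ℤ (λ k → D k * I k)))
  sum5ℤ-combination x₁ x₂ y₁ y₂ A B C D I = trans
    -- The trailing zero gives the innermost term, too, the shape `x * f k + g k` of `sum5ℤ-linear`.
    (sum5ℤ-cong {g = λ k → x₁ * (A k * I k) + (x₂ * (B k * I k) + (y₁ * (C k * I k) + (y₂ * (D k * I k) + + 0)))}
      (λ k → distribute x₁ x₂ y₁ y₂ (A k) (B k) (C k) (D k) (I k)))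
    (trans (sum5ℤ-linear x₁ (λ k → A k * I k) (λ k → x₂ * (B k * I k) + (y₁ * (C k * I k) + (y₂ * (D k * I k) + + 0))))
      (cong (λ z → x₁ * sum5ℤ (λ k → A k * I k) + z)
        (trans (sum5ℤ-linear x₂ (λ k → B k * I k) (λ k → y₁ * (C k * I k) + (y₂ * (D k * I k) + + 0)))
          (cong (λ z → x₂ * sum5ℤ (λ k → B k * I k) + z)
            (trans (sum5ℤ-linear y₁ (λ k → C k * I k) (λ k → y₂ * (D k * I k) + + 0))
              (cong (λ z → y₁ * sum5ℤ (λ k → C k * I k) + z)
                (trans (sum5ℤ-linear y₂ (λ k → D k * I k) (λ _ → + 0)) (ℤP.+-identityʳ _))))))))
    where
    distribute : ∀ x₁ x₂ y₁ y₂ a b c d i →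
      (x₁ * a + (x₂ * b + (y₁ * c + y₂ * d))) * i ≡ x₁ * (a * i) + (x₂ * (b * i) + (y₁ * (c * i) + (y₂ * (d * i) + + 0)))
    distribute = solve-∀

  difference-basis : ∀ (δ : Fin 3 → ℤ) → sum3ℤ δ ≡ + 0 → ∀ i → δ 1F * difference 1F i + δ 2F * difference 2F i ≡ δ i
  difference-basis δ h 0F = trans (rearrange (δ 0F) (δ 1F) (δ 2F))
    (trans (cong (λ z → δ 0F - z) h) (ℤP.+-identityʳ (δ 0F)))
    where
    rearrange : ∀ a b c → b * - + 1 + c * - + 1 ≡ a - (a + (b + c))
    rearrange = solve-∀
  difference-basis δ h 1F = simplify (δ 1F) (δ 2F)
    where
    simplify : ∀ b c → b * + 1 + c * + 0 ≡ b
    simplify = solve-∀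
  difference-basis δ h 2F = simplify (δ 1F) (δ 2F)
    where
    simplify : ∀ b c → b * + 0 + c * + 1 ≡ c
    simplify = solve-∀

  -- The four tested flows are combined with the entries 1 and 2 of `δ` and `η` as coefficients; the
  -- entries 0 then agree because all sums vanish.
  flow-exists : ∀ es πs → T (solvesFlows es πs) → ∀ (δ η : Fin 3 → ℤ) → sum3ℤ δ ≡ + 0 → sum3ℤ η ≡ + 0 →
    ∃ λ w → (∀ i → outflow es w i ≡ δ i) × (∀ j → inflow es w j ≡ η j)
  flow-exists es πs t δ η hδ hη =
    let t₁ , t' = T-∧⁻ {isFlow es (difference 1F) none A} t
        t₂ , t'' = T-∧⁻ {isFlow es (difference 2F) none B} t'
        t₃ , t₄ = T-∧⁻ {isFlow es none (difference 1F) C} t''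
        outA , inA = isFlow-sound es (difference 1F) none A t₁
        outB , inB = isFlow-sound es (difference 2F) none B t₂
        outC , inC = isFlow-sound es none (difference 1F) C t₃
        outD , inD = isFlow-sound es none (difference 2F) D t₄
    in combination (δ 1F) (δ 2F) (η 1F) (η 2F) A B C D ,
       (λ i → trans (sum5ℤ-combination (δ 1F) (δ 2F) (η 1F) (η 2F) A B C D (λ k → indicator (proj₁ (lookup es k)) i))
         (trans (cong₂ _+_ (cong (δ 1F *_) (outA i)) (cong₂ _+_ (cong (δ 2F *_) (outB i))
                   (cong₂ _+_ (cong (η 1F *_) (outC i)) (cong (η 2F *_) (outD i)))))
           (trans (dropLast (δ 1F * difference 1F i) (δ 2F * difference 2F i) (η 1F) (η 2F)) (difference-basis δ hδ i)))) ,
       (λ j → trans (sum5ℤ-combination (δ 1F) (δ 2F) (η 1F) (η 2F) A B C D (λ k → indicator (proj₂ (lookup es k)) j))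
         (trans (cong₂ _+_ (cong (δ 1F *_) (inA j)) (cong₂ _+_ (cong (δ 2F *_) (inB j))
                   (cong₂ _+_ (cong (η 1F *_) (inC j)) (cong (η 2F *_) (inD j)))))
           (trans (dropFirst (η 1F * difference 1F j) (η 2F * difference 2F j) (δ 1F) (δ 2F)) (difference-basis η hη j))))
    where
    A B C D : Fin 5 → ℤ
    A = lookup (flowWeights πs (difference 1F) none)
    B = lookup (flowWeights πs (difference 2F) none)
    C = lookup (flowWeights πs none (difference 1F))
    D = lookup (flowWeights πs none (difference 2F))
    dropLast : ∀ a b c d → a + (b + (c * + 0 + d * + 0)) ≡ a + b
    dropLast = solve-∀
    dropFirst : ∀ a b c d → c * + 0 + (d * + 0 + (a + b)) ≡ a + b
    dropFirst = solve-∀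

  sign base : Bool → ℤ
  sign true  = + 1
  sign false = - + 1
  base true  = + 0
  base false = + 1

  corner-ℤ : ∀ o i l → + corner o i l ≡ base o + sign o * indicator i l
  corner-ℤ true  = ∀3 (∀3 refl refl refl) (∀3 refl refl refl) (∀3 refl refl refl)
  corner-ℤ false = ∀3 (∀3 refl refl refl) (∀3 refl refl refl) (∀3 refl refl refl)

  sign-sign : ∀ o z → sign o * (sign o * z) ≡ z
  sign-sign true  = solve-∀
  sign-sign false = solve-∀

  -- The weights of a flow with zero total are the coordinates with respect to the edges at the first vertex.
  rooted : ∀ (w f : Fin 5 → ℤ) → sum5ℤ w ≡ + 0 → sum4ℤ (λ k → w (suc k) * (f (suc k) - f zero)) ≡ sum5ℤ (λ k → w k * f k)
  rooted w f h = trans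
    (identity (w 0F) (w 1F) (w 2F) (w (suc 2F)) (w (suc (suc 2F))) (f 0F) (f 1F) (f 2F) (f (suc 2F)) (f (suc (suc 2F))))
    (trans (cong (λ z → sum5ℤ (λ k → w k * f k) - z * f zero) h) (ℤP.+-identityʳ _))
    where
    identity : ∀ a b c d e a' b' c' d' e' →
      b * (b' - a') + (c * (c' - a') + (d * (d' - a') + e * (e' - a'))) ≡
      (a * a' + (b * b' + (c * c' + (d * d' + e * e')))) - (a + (b + (c + (d + e)))) * a'
    identity = solve-∀

  sum3ℤ-sum4ℤ : ∀ (f : Fin 4 → Fin 3 → ℤ) → sum3ℤ (λ l → sum4ℤ (λ k → f k l)) ≡ sum4ℤ (λ k → sum3ℤ (f k))
  sum3ℤ-sum4ℤ f = trans (sum3ℤ-+ (f 0F) (λ l → f 1F l + (f 2F l + f (suc 2F) l)))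
    (cong (λ z → sum3ℤ (f 0F) + z) (trans (sum3ℤ-+ (f 1F) (λ l → f 2F l + f (suc 2F) l))
      (cong (λ z → sum3ℤ (f 1F) + z) (sum3ℤ-+ (f 2F) (f (suc 2F))))))

  sum3ℤ-sum5ℤ : ∀ (f : Fin 5 → Fin 3 → ℤ) → sum3ℤ (λ l → sum5ℤ (λ k → f k l)) ≡ sum5ℤ (λ k → sum3ℤ (f k))
  sum3ℤ-sum5ℤ f = trans (sum3ℤ-+ (f zero) (λ l → sum4ℤ (λ k → f (suc k) l)))
    (cong (λ z → sum3ℤ (f zero) + z) (sum3ℤ-sum4ℤ (λ k → f (suc k))))

  sum5ℤ-indicators : ∀ (w : Fin 5 → ℤ) (i : Fin 5 → Fin 3) →
    sum3ℤ (λ l → sum5ℤ (λ k → w k * indicator (i k) l)) ≡ sum5ℤ w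
  sum5ℤ-indicators w i = trans (sum3ℤ-sum5ℤ λ k l → w k * indicator (i k) l) (sum5ℤ-cong λ k →
    trans (sum3ℤ-* (w k) (indicator (i k))) (trans (cong (w k *_) (total-indicator (i k))) (ℤP.*-identityʳ (w k))))
    where
    total-indicator : ∀ (i : Fin 3) → sum3ℤ (indicator i) ≡ + 1
    total-indicator = ∀3 refl refl refl

  module Unimodularity (ι : Involution) (r c : Fin 3 → ℕ) (r≡c : sum3ℕ r ≡ sum3ℕ c) (trees : List Edges)
                       (spans : ∀ es → es ∈ trees → T (spansFlows es)) where

    open Points ι r c
    open Cells ι r c r≡c
    open Simplices ι r c r≡c trees
    open Involution ι

    module _ {σ} (C : Cell-of σ) (M : ZMat) (zm : ZeroMargins M) where
      open Cell-of C

      Z : ZMat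
      Z i j = M (to i) j

      -- In rows 1 and 2 the vertices differ by differences of unit vectors, negated for a downward
      -- triangle. Writing `M` in terms of the edges thus means finding a flow on the tree with
      -- these divergences.
      δ η : Fin 3 → ℤ
      δ l = sign o₁ * Z 1F l
      η l = sign o₂ * Z 2F l

      scaled-zero : ∀ o i → sum3ℤ (λ l → sign o * Z i l) ≡ + 0
      scaled-zero o i = trans (sum3ℤ-* (sign o) (Z i)) (trans (cong (sign o *_) (proj₁ zm (to i))) (ℤP.*-zeroʳ (sign o)))

      solution : ∃ λ w → (∀ i → outflow es w i ≡ δ i) × (∀ j → inflow es w j ≡ η j)
      solution = flow-exists es (flowPotentials es) (spans es tree) δ η (scaled-zero o₁ 1F) (scaled-zero o₂ 2F)

      w : Fin 5 → ℤ
      w = proj₁ solution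

      total-weight : sum5ℤ w ≡ + 0
      total-weight = trans (sym (sum5ℤ-indicators w (λ k → proj₁ (lookup es k))))
        (trans (sum3ℤ-cong (proj₁ (proj₂ solution))) (scaled-zero o₁ 1F))

      E : Fin 4 → ZMat
      E k i j = + ent (vert σ (suc k)) i j - + ent (vert σ zero) i j

      combined : ZMat
      combined i j = sum4ℤ (λ k → w (suc k) * E k i j)

      coordinates : ∀ k i j → + ent (vert σ k) i j ≡ + cellPoint o₁ o₂ K (lookup es k) i j
      coordinates k i j = cong +_ (trans (cong (λ τ → ent (vert τ k) i j) is) (vert-simplex o₁ o₂ K es k i j))

      -- The weights have sum zero, so the floor `κ` and the summand `base o` drop out, and the two
      -- signs cancel.
      combined-row : ∀ i o (κ : Fin 3 → ℕ) (e : Fin 5 → Fin 3) → (∀ l → sum5ℤ (λ k → w k * indicator (e k) l) ≡ sign o * Z i l) →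
        (∀ k l → + ent (vert σ k) i l ≡ + (κ l ℕ.+ corner o (e k) l)) → ∀ l → combined i l ≡ Z i l
      combined-row i o κ e flow coords l = trans (rooted w (λ k → + ent (vert σ k) i l) total-weight) (trans
        (sum5ℤ-cong {g = λ k → (+ κ l + base o) * w k + (sign o * (w k * indicator (e k) l) + + 0)} λ k →
          trans (cong (w k *_) (trans (coords k l) (cong (λ z → + κ l + z) (corner-ℤ o (e k) l))))
            (expand (w k) (+ κ l) (base o) (sign o) (indicator (e k) l)))
        (trans (sum5ℤ-linear (+ κ l + base o) w (λ k → sign o * (w k * indicator (e k) l) + + 0))
          (trans (cong₂ _+_
              (trans (cong ((+ κ l + base o) *_) total-weight) (ℤP.*-zeroʳ (+ κ l + base o)))
              (trans (sum5ℤ-linear (sign o) (λ k → w k * indicator (e k) l) (λ _ → + 0))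
                (trans (ℤP.+-identityʳ _) (trans (cong (sign o *_) (flow l)) (sign-sign o (Z i l))))))
            (ℤP.+-identityˡ (Z i l)))))
        where
        expand : ∀ w k b s t → w * (k + (b + s * t)) ≡ (k + b) * w + (s * (w * t) + + 0)
        expand = solve-∀

      row₁ : ∀ l → combined 1F l ≡ Z 1F l
      row₁ = combined-row 1F o₁ (K 1F) (λ k → proj₁ (lookup es k)) (proj₁ (proj₂ solution)) (λ k → coordinates k 1F)

      row₂ : ∀ l → combined 2F l ≡ Z 2F l
      row₂ = combined-row 2F o₂ (K 2F) (λ k → proj₂ (lookup es k)) (proj₂ (proj₂ solution)) (λ k → coordinates k 2F)

      column-zero : ∀ (Y : ZMat) l → sum3ℤ (λ i → Y i l) ≡ + 0 → Y 0F l ≡ - (Y 1F l + Y 2F l)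
      column-zero Y l h = trans (isolate (Y 0F l) (Y 1F l + Y 2F l)) (trans (cong (_- (Y 1F l + Y 2F l)) h) (ℤP.+-identityˡ _))
        where
        isolate : ∀ a b → a ≡ (a + b) - b
        isolate = solve-∀

      edge-column : ∀ k l → sum3ℤ (λ i → E k i l) ≡ + 0
      edge-column k l = trans (regroup (+ ent (vert σ (suc k)) 0F l) (+ ent (vert σ (suc k)) 1F l) (+ ent (vert σ (suc k)) 2F l)
          (+ ent (vert σ zero) 0F l) (+ ent (vert σ zero) 1F l) (+ ent (vert σ zero) 2F l))
        (trans (cong₂ (λ a b → + a - + b) (proj₂ (vertex-point C (suc k)) l) (proj₂ (vertex-point C zero) l))
          (ℤP.+-inverseʳ (+ c l)))
        where
        regroup : ∀ a b c d e f → (a - d) + ((b - e) + (c - f)) ≡ (a + (b + c)) - (d + (e + f))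
        regroup = solve-∀

      combined-column : ∀ l → sum3ℤ (λ i → combined i l) ≡ + 0
      combined-column l = trans (sum3ℤ-sum4ℤ λ k i → w (suc k) * E k i l)
        (cong₂ _+_ (kill 0F) (cong₂ _+_ (kill 1F) (cong₂ _+_ (kill 2F) (kill (suc 2F)))))
        where
        kill : ∀ k → sum3ℤ (λ i → w (suc k) * E k i l) ≡ + 0
        kill k = trans (sum3ℤ-* (w (suc k)) (λ i → E k i l))
          (trans (cong (w (suc k) *_) (edge-column k l)) (ℤP.*-zeroʳ (w (suc k))))

      -- Rows 1 and 2 determine row 0, since both matrices have zero column sums.
      combined-Z : ∀ i l → Z i l ≡ combined i l
      combined-Z 1F l = sym (row₁ l)
      combined-Z 2F l = sym (row₂ l)
      combined-Z 0F l = trans (column-zero Z l (trans (fold-to _+_ ℤP.+-assoc ℤP.+-comm (λ i → M i l)) (proj₂ zm l)))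
        (trans (cong -_ (cong₂ _+_ (sym (row₁ l)) (sym (row₂ l)))) (sym (column-zero combined l (combined-column l))))

      edges-generate : ∀ i j → M i j ≡ sum4ℤ (λ k → w (suc k) * edge σ k i j)
      edges-generate i j = subst (λ i → M i j ≡ sum4ℤ (λ k → w (suc k) * edge σ k i j)) (involutive i) (combined-Z (to i) j)

    unimodular : ∀ {σ} → Cell-of σ → Unimodular σ
    unimodular C M zm = (λ k → w C M zm (suc k)) , edges-generate C M zm

open LowerFacets

-- The cell around a point, and irreducible families as faces

module Flagness where

  open import Data.Nat using (_+_; _*_; _∸_; _≤_; _<_; _≡ᵇ_)
  open import Data.Nat.Tactic.RingSolver using (solve-∀)
  import Data.Integer.Tactic.RingSolver as ℤSolver

  Between : ℕ → (Fin 3 → ℕ) → (Fin 3 → ℕ) → Set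
  Between D k x = ∀ l → D * k l ≤ x l × x l ≤ D * suc (k l)

  -- The unit triangle containing the point x / D of the plane with coordinate sum s.
  triangle : ∀ D .{{_ : NonZero D}} s x → sum3ℕ x ≡ D * s → 0 < s → ∃₂ λ o k → sum3ℕ k + size o ≡ s × Between D k x
  triangle D s x sums pos = byExcess (s ∸ sum3ℕ q) (ℕP.m∸n+n≡m q≤s) excess<3
    where
    q ρ : Fin 3 → ℕ
    q l = x l / D
    ρ l = x l % D
    x≡ : ∀ l → x l ≡ ρ l + D * q l
    x≡ l = trans (m≡m%n+[m/n]*n (x l) D) (cong (ρ l +_) (ℕP.*-comm (q l) D))
    remainders : sum3ℕ ρ + D * sum3ℕ q ≡ D * s
    remainders = trans (cong (sum3ℕ ρ +_) (sym (sum3ℕ-* D q))) (trans (linarith 9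
      (λ x₀ x₁ x₂ ρ₀ ρ₁ ρ₂ q₀ q₁ q₂ → x₀ :≡ ρ₀ :+ q₀ ∷ x₁ :≡ ρ₁ :+ q₁ ∷ x₂ :≡ ρ₂ :+ q₂ ∷ []
        ⊢ (ρ₀ :+ (ρ₁ :+ ρ₂)) :+ (q₀ :+ (q₁ :+ q₂)) :≡ x₀ :+ (x₁ :+ x₂))
      (x 0F) (x 1F) (x 2F) (ρ 0F) (ρ 1F) (ρ 2F) (D * q 0F) (D * q 1F) (D * q 2F) (x≡ 0F) (x≡ 1F) (x≡ 2F)) sums)
    q≤s : sum3ℕ q ≤ s
    q≤s = ℕP.*-cancelˡ-≤ D (subst (D * sum3ℕ q ≤_) remainders (ℕP.m≤n+m _ (sum3ℕ ρ)))
    excess<3 : s ∸ sum3ℕ q < 3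
    excess<3 = ℕP.+-cancelʳ-< (sum3ℕ q) (s ∸ sum3ℕ q) 3 (subst (_< 3 + sum3ℕ q) (sym (ℕP.m∸n+n≡m q≤s))
      (ℕP.*-cancelˡ-< D s (3 + sum3ℕ q) (subst₂ _<_ remainders (expand D (sum3ℕ q))
        (ℕP.+-monoˡ-< (D * sum3ℕ q) (linarith 4 (λ a b c D → a :< D ∷ b :< D ∷ c :< D ∷ [] ⊢ a :+ (b :+ c) :< 3 :* D)
          (ρ 0F) (ρ 1F) (ρ 2F) D (m%n<n (x 0F) D) (m%n<n (x 1F) D) (m%n<n (x 2F) D))))))
      where
      expand : ∀ D t → 3 * D + D * t ≡ D * (3 + t)
      expand = solve-∀
    between : Between D q x
    between l = subst (D * q l ≤_) (sym (x≡ l)) (ℕP.m≤n+m _ (ρ l)) ,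
      ℕP.≤-trans (ℕP.≤-reflexive (x≡ l)) (subst (ρ l + D * q l ≤_) (sym (ℕP.*-suc D (q l)))
        (ℕP.+-monoˡ-≤ (D * q l) (ℕP.<⇒≤ (m%n<n (x l) D))))
    exact : sum3ℕ q ≡ s → ∀ l → x l ≡ D * q l
    exact e l = trans (x≡ l) (cong (_+ D * q l) (sum3ℕ-zero {ρ} noRemainder l))
      where
      noRemainder : sum3ℕ ρ ≡ 0
      noRemainder = ℕP.+-cancelʳ-≡ (D * sum3ℕ q) (sum3ℕ ρ) 0 (trans remainders (cong (D *_) (sym e)))
    lowered : ∀ k l → (∀ m → x m ≡ D * q m) → q l ≡ suc (k l) → D * k l ≤ x l × x l ≤ D * suc (k l)
    lowered k l h e = subst (D * k l ≤_) (sym (h l)) (ℕP.*-monoʳ-≤ D (subst (k l ≤_) (sym e) (ℕP.n≤1+n (k l)))) ,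
                      ℕP.≤-reflexive (trans (h l) (cong (D *_) e))
    -- If x / D is a lattice point, then any triangle at it will do.
    atVertex : ∀ a b c → q 0F ≡ a → q 1F ≡ b → q 2F ≡ c → sum3ℕ q ≡ s →
               ∃₂ λ o k → sum3ℕ k + size o ≡ s × Between D k x
    atVertex (suc a) b c ea eb ec e = true , k , trans
        (linarith 3 (λ a b c → [] ⊢ a :+ (b :+ c) :+ con 1 :≡ con 1 :+ a :+ (b :+ c)) a (q 1F) (q 2F))
        (trans (cong (_+ (q 1F + q 2F)) (sym ea)) e) ,
      ∀3 (lowered k 0F (exact e) ea) (between 1F) (between 2F)
      where k = ∀3 a (q 1F) (q 2F)
    atVertex zero (suc b) c ea eb ec e = true , k , trans
        (linarith 3 (λ a b c → [] ⊢ a :+ (b :+ c) :+ con 1 :≡ a :+ (con 1 :+ b :+ c)) (q 0F) b (q 2F))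
        (trans (cong (λ z → q 0F + (z + q 2F)) (sym eb)) e) ,
      ∀3 (between 0F) (lowered k 1F (exact e) eb) (between 2F)
      where k = ∀3 (q 0F) b (q 2F)
    atVertex zero zero (suc c) ea eb ec e = true , k , trans
        (linarith 3 (λ a b c → [] ⊢ a :+ (b :+ c) :+ con 1 :≡ a :+ (b :+ (con 1 :+ c))) (q 0F) (q 1F) c)
        (trans (cong (λ z → q 0F + (q 1F + z)) (sym ec)) e) ,
      ∀3 (between 0F) (between 1F) (lowered k 2F (exact e) ec)
      where k = ∀3 (q 0F) (q 1F) c
    atVertex zero zero zero ea eb ec e = ⊥-elim (ℕP.<-irrefl
      (trans (sym (cong₂ _+_ ea (cong₂ _+_ eb ec))) e) pos)
    -- The excess of `s` over the sum of the floors is the height of x / D in its unit cube: 1 gives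
    -- an upward triangle, 2 a downward one, and 0 a lattice point.
    byExcess : ∀ d → d + sum3ℕ q ≡ s → d < 3 → ∃₂ λ o k → sum3ℕ k + size o ≡ s × Between D k x
    byExcess 0 e _ = atVertex (q 0F) (q 1F) (q 2F) refl refl refl e
    byExcess 1 e _ = true , q , trans (ℕP.+-comm (sum3ℕ q) 1) e , between
    byExcess 2 e _ = false , q , trans (ℕP.+-comm (sum3ℕ q) 2) e , between
    byExcess (suc (suc (suc d))) e (s≤s (s≤s (s≤s ())))

  count-≤1 : ∀ x y z → ¬ (T x × T y) → ¬ (T x × T z) → ¬ (T y × T z) → T (count (x ∷ y ∷ z ∷ []) ℕ.≤ᵇ 1)
  count-≤1 true  true  _     h _ _ = ⊥-elim (h (tt , tt))
  count-≤1 true  false true  _ h _ = ⊥-elim (h (tt , tt))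
  count-≤1 false true  true  _ _ h = ⊥-elim (h (tt , tt))
  count-≤1 true  false false _ _ _ = tt
  count-≤1 false true  false _ _ _ = tt
  count-≤1 false false true  _ _ _ = tt
  count-≤1 false false false _ _ _ = tt

  count-≤2 : ∀ x y z → ¬ (T x × T y × T z) → T (count (x ∷ y ∷ z ∷ []) ℕ.≤ᵇ 2)
  count-≤2 true  true  true  h = ⊥-elim (h (tt , tt , tt))
  count-≤2 true  true  false _ = tt
  count-≤2 true  false true  _ = tt
  count-≤2 true  false false _ = tt
  count-≤2 false true  true  _ = tt
  count-≤2 false true  false _ = tt
  count-≤2 false false true  _ = tt
  count-≤2 false false false _ = tt

  corner-injective : ∀ o i k → corner o i i ≡ corner o k i → i ≡ k
  corner-injective true  = ∀3 (∀3 (λ _ → refl) (λ ()) (λ ())) (∀3 (λ ()) (λ _ → refl) (λ ())) (∀3 (λ ()) (λ ()) (λ _ → refl))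
  corner-injective false = ∀3 (∀3 (λ _ → refl) (λ ()) (λ ())) (∀3 (λ ()) (λ _ → refl) (λ ())) (∀3 (λ ()) (λ ()) (λ _ → refl))

  module Location (ι : Involution) (r c : Fin 3 → ℕ) (r≡c : sum3ℕ r ≡ sum3ℕ c)
                  (r-pos : ∀ i → 0 < r i) (2≤r₀ : 2 ≤ r 0F) where

    open Points ι r c
    open Cells ι r c r≡c

    isCell-build : ∀ {o₁ o₂ K} → IsCell o₁ o₂ K → IsCell o₁ o₂ (ent (build K))
    isCell-build {o₁} {o₂} {K} (columns , row₁ , row₂ , adm) =
      (λ l → trans (cong suc (cong₂ _+_ (ent-build K 0F l) (cong₂ _+_ (ent-build K 1F l) (ent-build K 2F l)))) (columns l)) ,
      trans (cong (_+ size o₁) (sum3ℕ-cong (ent-build K 1F))) row₁ ,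
      trans (cong (_+ size o₂) (sum3ℕ-cong (ent-build K 2F))) row₂ ,
      subst (λ t → T (admissible o₁ o₂ t)) (tabulate-cong λ l → cong (_≡ᵇ 0) (sym (ent-build K 0F l))) adm

    -- Positive entries in row 0 keep the cell full-dimensional: the floors leave at least 1 in
    -- every column, and two downward triangles cannot have two tight columns.
    locate : ∀ D .{{_ : NonZero D}} n → Margins (λ i → D * r i) (λ j → D * c j) n → (∀ l → 0 < n 0F l) →
      ∃₂ λ o₁ o₂ → ∃ λ K → IsCell o₁ o₂ K × Between D (K 1F) (n 1F) × Between D (K 2F) (n 2F)
    locate D n (rows , columns) n₀-pos = fromTriangles
      (triangle D (r 1F) (n 1F) (rows 1F) (r-pos 1F)) (triangle D (r 2F) (n 2F) (rows 2F) (r-pos 2F))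
      where
      fromTriangles :
        (∃₂ λ o k → sum3ℕ k + size o ≡ r 1F × Between D k (n 1F)) →
        (∃₂ λ o k → sum3ℕ k + size o ≡ r 2F × Between D k (n 2F)) →
        ∃₂ λ o₁ o₂ → ∃ λ K → IsCell o₁ o₂ K × Between D (K 1F) (n 1F) × Between D (K 2F) (n 2F)
      fromTriangles (o₁ , k₁ , sum₁ , b₁) (o₂ , k₂ , sum₂ , b₂) =
        o₁ , o₂ , K , (cols , sum₁ , sum₂ , adm o₁ o₂ sum₁ sum₂) , b₁ , b₂
        where
        s : Fin 3 → ℕ
        s l = c l ∸ suc (k₁ l + k₂ l)
        K : Mat
        K = ∀3 s k₁ k₂
        below : ∀ l → k₁ l + k₂ l < c l
        below l = ℕP.*-cancelˡ-< D (k₁ l + k₂ l) (c l) (subst (_< D * c l) (sym (ℕP.*-distribˡ-+ D (k₁ l) (k₂ l)))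
          (linarith 6 (λ n₀ n₁ n₂ a b c → n₀ :+ (n₁ :+ n₂) :≡ c ∷ con 0 :< n₀ ∷ a :≤ n₁ ∷ b :≤ n₂ ∷ [] ⊢ a :+ b :< c)
            (n 0F l) (n 1F l) (n 2F l) (D * k₁ l) (D * k₂ l) (D * c l) (columns l) (n₀-pos l) (proj₁ (b₁ l)) (proj₁ (b₂ l))))
        cols : ∀ l → suc (s l + (k₁ l + k₂ l)) ≡ c l
        cols l = trans (sym (ℕP.+-suc (s l) (k₁ l + k₂ l))) (ℕP.m∸n+n≡m (below l))
        total-slack : sum3ℕ s + (r 1F + r 2F) + 3 ≡ sum3ℕ r + (size o₁ + size o₂)
        total-slack = linarith 17
          (λ s₀ s₁ s₂ a₀ a₁ a₂ b₀ b₁ b₂ c₀ c₁ c₂ r₀ r₁ r₂ h₁ h₂ →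
            con 1 :+ (s₀ :+ (a₀ :+ b₀)) :≡ c₀ ∷ con 1 :+ (s₁ :+ (a₁ :+ b₁)) :≡ c₁ ∷ con 1 :+ (s₂ :+ (a₂ :+ b₂)) :≡ c₂ ∷
            a₀ :+ (a₁ :+ a₂) :+ h₁ :≡ r₁ ∷ b₀ :+ (b₁ :+ b₂) :+ h₂ :≡ r₂ ∷
            r₀ :+ (r₁ :+ r₂) :≡ c₀ :+ (c₁ :+ c₂) ∷ []
            ⊢ s₀ :+ (s₁ :+ s₂) :+ (r₁ :+ r₂) :+ con 3 :≡ r₀ :+ (r₁ :+ r₂) :+ (h₁ :+ h₂))
          (s 0F) (s 1F) (s 2F) (k₁ 0F) (k₁ 1F) (k₁ 2F) (k₂ 0F) (k₂ 1F) (k₂ 2F) (c 0F) (c 1F) (c 2F)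
          (r 0F) (r 1F) (r 2F) (size o₁) (size o₂) (cols 0F) (cols 1F) (cols 2F) sum₁ sum₂ r≡c
        size-pos : ∀ o → 1 ≤ size o
        size-pos true  = s≤s z≤n
        size-pos false = s≤s z≤n
        -- By `total-slack`, row 0 of `K` sums to `r 0F + size o₁ + size o₂ - 3`, and `2 ≤ r 0F`
        -- makes this at least 1.
        notAllTight : ¬ (T (s 0F ≡ᵇ 0) × T (s 1F ≡ᵇ 0) × T (s 2F ≡ᵇ 0))
        notAllTight (t₀ , t₁ , t₂) = linarith 8
          (λ s₀ s₁ s₂ r₀ r₁ r₂ h₁ h₂ → s₀ :+ (s₁ :+ s₂) :+ (r₁ :+ r₂) :+ con 3 :≡ r₀ :+ (r₁ :+ r₂) :+ (h₁ :+ h₂) ∷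
            s₀ :≡ con 0 ∷ s₁ :≡ con 0 ∷ s₂ :≡ con 0 ∷ con 2 :≤ r₀ ∷ con 1 :≤ h₁ ∷ con 1 :≤ h₂ ∷ [] ⊢ false)
          (s 0F) (s 1F) (s 2F) (r 0F) (r 1F) (r 2F) (size o₁) (size o₂) total-slack
          (ℕP.≡ᵇ⇒≡ _ 0 t₀) (ℕP.≡ᵇ⇒≡ _ 0 t₁) (ℕP.≡ᵇ⇒≡ _ 0 t₂) 2≤r₀ (size-pos o₁) (size-pos o₂)
        -- In a product of two downward triangles the points with x₀ ≥ 0 have dimension 4 only if at most one entry is tight.
        notTwoTight : ∀ l m p → (∀ f → sum3ℕ f ≡ f l + (f m + f p)) → sum3ℕ k₁ + 2 ≡ r 1F → sum3ℕ k₂ + 2 ≡ r 2F →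
                      ¬ (T (s l ≡ᵇ 0) × T (s m ≡ᵇ 0))
        notTwoTight l m p reorder e₁ e₂ (tl , tm) = linarith 15
          (λ D nl nm al am ap bl bm bp Al Am Ap Bl Bm Bp →
            con 0 :< nl ∷ con 0 :< nm ∷
            nl :+ (al :+ bl) :≡ D :+ (Al :+ Bl) ∷ nm :+ (am :+ bm) :≡ D :+ (Am :+ Bm) ∷
            ap :≤ D :+ Ap ∷ bp :≤ D :+ Bp ∷
            al :+ (am :+ ap) :≡ Al :+ (Am :+ Ap) :+ 2 :* D ∷
            bl :+ (bm :+ bp) :≡ Bl :+ (Bm :+ Bp) :+ 2 :* D ∷ [] ⊢ false)
          D (n 0F l) (n 0F m) (n 1F l) (n 1F m) (n 1F p) (n 2F l) (n 2F m) (n 2F p)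
          (D * k₁ l) (D * k₁ m) (D * k₁ p) (D * k₂ l) (D * k₂ m) (D * k₂ p)
          (n₀-pos l) (n₀-pos m) (tightColumn l tl) (tightColumn m tm)
          (subst (n 1F p ≤_) (ℕP.*-suc D (k₁ p)) (proj₂ (b₁ p))) (subst (n 2F p ≤_) (ℕP.*-suc D (k₂ p)) (proj₂ (b₂ p)))
          (rowSum 1F k₁ e₁) (rowSum 2F k₂ e₂)
          where
          tightColumn : ∀ l → T (s l ≡ᵇ 0) → n 0F l + (n 1F l + n 2F l) ≡ D + (D * k₁ l + D * k₂ l)
          tightColumn l t = trans (columns l) (trans
            (cong (D *_) (trans (sym (cols l)) (cong (λ z → suc (z + (k₁ l + k₂ l))) (ℕP.≡ᵇ⇒≡ (s l) 0 t))))
            (trans (ℕP.*-suc D (k₁ l + k₂ l)) (cong (D +_) (ℕP.*-distribˡ-+ D (k₁ l) (k₂ l)))))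
          rowSum : ∀ i k → sum3ℕ k + 2 ≡ r i → n i l + (n i m + n i p) ≡ D * k l + (D * k m + D * k p) + 2 * D
          rowSum i k e = trans (sym (reorder (n i))) (trans (rows i) (trans (cong (D *_) (trans (sym e)
            (cong (_+ 2) (reorder k)))) (expand D (k l) (k m) (k p))))
            where
            expand : ∀ D a b c → D * (a + (b + c) + 2) ≡ D * a + (D * b + D * c) + 2 * D
            expand = solve-∀
        adm : ∀ o₁ o₂ → sum3ℕ k₁ + size o₁ ≡ r 1F → sum3ℕ k₂ + size o₂ ≡ r 2F → T (admissible o₁ o₂ (tightness K))
        adm true  true  _ _ = count-≤2 _ _ _ notAllTight
        adm true  false _ _ = count-≤2 _ _ _ notAllTight
        adm false true  _ _ = count-≤2 _ _ _ notAllTight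
        adm false false e₁ e₂ = count-≤1 _ _ _
          (notTwoTight 0F 1F 2F (λ f → refl) e₁ e₂)
          (notTwoTight 0F 2F 1F (λ f → linarith 3 (λ a b c → [] ⊢ a :+ (b :+ c) :≡ a :+ (c :+ b)) (f 0F) (f 1F) (f 2F)) e₁ e₂)
          (notTwoTight 1F 2F 0F (λ f → linarith 3 (λ a b c → [] ⊢ a :+ (b :+ c) :≡ b :+ (c :+ a)) (f 0F) (f 1F) (f 2F)) e₁ e₂)

  open DecMembership _≟ᴹ_ using (_∈?_)

  total-≤ : ∀ {A : Set} (f : A → ℕ) k L → (∀ u → u ∈ L → f u ≤ k) → total f L ≤ length L * k
  total-≤ f k []      h = z≤n
  total-≤ f k (u ∷ L) h = ℕP.+-mono-≤ (h u (here refl)) (total-≤ f k L (λ v → h v ∘ there))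

  total-< : ∀ {A : Set} (f : A → ℕ) k L → (∀ u → u ∈ L → f u ≤ k) → ∀ v → v ∈ L → f v < k → total f L < length L * k
  total-< f k (u ∷ L) h v (here refl) lt = ℕP.+-mono-<-≤ lt (total-≤ f k L (λ v → h v ∘ there))
  total-< f k (u ∷ L) h v (there v∈)  lt = ℕP.+-mono-≤-< (h u (here refl)) (total-< f k L (λ v → h v ∘ there) v v∈ lt)

  ≤-total : ∀ {A : Set} (f : A → ℕ) k L → (∀ u → u ∈ L → k ≤ f u) → length L * k ≤ total f L
  ≤-total f k []      h = z≤n
  ≤-total f k (u ∷ L) h = ℕP.+-mono-≤ (h u (here refl)) (≤-total f k L (λ v → h v ∘ there))

  <-total : ∀ {A : Set} (f : A → ℕ) k L → (∀ u → u ∈ L → k ≤ f u) → ∀ v → v ∈ L → k < f v → length L * k < total f L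
  <-total f k (u ∷ L) h v (here refl) lt = ℕP.+-mono-<-≤ lt (≤-total f k L (λ v → h v ∘ there))
  <-total f k (u ∷ L) h v (there v∈)  lt = ℕP.+-mono-≤-< (h u (here refl)) (<-total f k L (λ v → h v ∘ there) v v∈ lt)

  module Flag (ι : Involution) (r c : Fin 3 → ℕ) (r≡c : sum3ℕ r ≡ sum3ℕ c)
              (r-pos : ∀ i → 0 < r i) (c-pos : ∀ j → 0 < c j) (2≤r₀ : 2 ≤ r 0F)
              (trees : List Edges) (ps : List Position) (checked : T (flagCells trees ps)) (all∈ : ∀ p → p ∈ ps) where

    open Points ι r c
    open Cells ι r c r≡c
    open Facets ι r c r≡c
    open Simplices ι r c r≡c trees
    open Location ι r c r≡c r-pos 2≤r₀

    total-margins : ∀ L → All IsPoint L →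
      Margins (λ i → length L * r i) (λ j → length L * c j) (λ i j → total (λ M → ent M i j) L)
    total-margins [] [] = (λ _ → refl) , (λ _ → refl)
    total-margins (M ∷ L) (pM ∷ pL) =
      (λ i → trans (regroup (ent M i 0F) (ent M i 1F) (ent M i 2F) _ _ _)
                   (cong₂ _+_ (proj₁ pM i) (proj₁ (total-margins L pL) i))) ,
      (λ j → trans (regroup (ent M 0F j) (ent M 1F j) (ent M 2F j) _ _ _)
                   (cong₂ _+_ (proj₂ pM j) (proj₂ (total-margins L pL) j)))
      where
      regroup : ∀ a b c d e f → (a + d) + ((b + e) + (c + f)) ≡ (a + (b + c)) + (d + (e + f))
      regroup = solve-∀

    module _ (F : List LMat) (pF : All IsPoint F) (irr : ∀ a b → a ∈ F → b ∈ F → a ≢ b → ¬ Reducible a b) where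

      private
        ℓ W D : ℕ
        ℓ = length F
        -- The terms on which the perturbation can draw in `in-box` are at most `S * S`, so a single
        -- unit in the sum of `F`, multiplied by `W`, outweighs them. `D` is the dilate in which
        -- `perturbed` lies.
        W = suc (S * S)
        D = S + W * ℓ

        S-pos : 0 < S
        S-pos = ℕP.<-≤-trans (r-pos 0F) (≤-sum3ℕ r 0F)

      instance
        D-nonZero : NonZero D
        D-nonZero = ℕ.>-nonZero (ℕP.<-≤-trans S-pos (ℕP.m≤m+n S (W * ℓ)))

      sumOf : Mat
      sumOf i j = total (λ M → ent M i j) F

      -- A multiple of the sum of F, pushed slightly towards the interior point with entries rᵢ cⱼ / S.
      perturbed : Mat
      perturbed i j = r i * c j + W * sumOf i j

      perturbed-margins : Margins (λ i → D * r i) (λ j → D * c j) perturbed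
      perturbed-margins =
        (λ i → trans (rows (r i) W (c 0F) (c 1F) (c 2F) _ _ _)
          (trans (cong₂ (λ a b → r i * a + W * b) (sym r≡c) (proj₁ (total-margins F pF) i)) (collect (r i) S W ℓ))) ,
        (λ j → trans (columns (c j) W (r 0F) (r 1F) (r 2F) _ _ _)
          (trans (cong (λ b → c j * S + W * b) (proj₂ (total-margins F pF) j)) (collect (c j) S W ℓ)))
        where
        rows : ∀ r W a b c x y z → (r * a + W * x) + ((r * b + W * y) + (r * c + W * z)) ≡ r * (a + (b + c)) + W * (x + (y + z))
        rows = solve-∀
        columns : ∀ r W a b c x y z → (a * r + W * x) + ((b * r + W * y) + (c * r + W * z)) ≡ r * (a + (b + c)) + W * (x + (y + z))
        columns = solve-∀
        collect : ∀ r S W ℓ → r * S + W * (ℓ * r) ≡ (S + W * ℓ) * r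
        collect = solve-∀

      perturbed-pos : ∀ l → 0 < perturbed 0F l
      perturbed-pos l = ℕP.<-≤-trans (ℕP.*-mono-< (r-pos 0F) (c-pos l)) (ℕP.m≤m+n _ _)

      close : ∀ u v → u ∈ F → v ∈ F → ∀ i l → ent u (suc i) l ≤ suc (ent v (suc i) l)
      close u v u∈ v∈ i l = ℕP.≮⇒≥ λ h → irr u v u∈ v∈
        (λ e → ℕP.<-irrefl (cong (λ M → ent M (suc i) l) (sym e)) (ℕP.<-trans (ℕP.n<1+n _) h))
        (far-reducible {u} {v} (All.lookup pF u∈) (All.lookup pF v∈) i l h)

      cornerEntry≤ : ∀ i l → r i * c l ≤ S * S
      cornerEntry≤ i l = ℕP.*-mono-≤ (≤-sum3ℕ r i) (subst (c l ≤_) (sym r≡c) (≤-sum3ℕ c l))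

      -- If one member lay below the floor `k`, then `close` would keep all others at most at `k`,
      -- and the sum of `F` would fall short of `ℓ * k` by at least 1. Times `W`, this deficit
      -- exceeds the perturbation. The upper bound is symmetric.
      in-box : ∀ K → Between D (K 1F) (perturbed 1F) → Between D (K 2F) (perturbed 2F) → ∀ v → v ∈ F → InBox K v
      in-box K b₁ b₂ v v∈ i l = ℕP.≮⇒≥ low , ℕP.≮⇒≥ high
        where
        between : ∀ i → Between D (K (suc i)) (perturbed (suc i))
        between zero       = b₁
        between (suc zero) = b₂
        k : ℕ
        k = K (suc i) l
        e : LMat → ℕ
        e M = ent M (suc i) l
        low : ¬ (e v < k)
        low h = linarith 6 (λ SK WlK WT rc SS W → SK :+ WlK :≤ rc :+ WT ∷ WT :+ W :≤ WlK ∷ rc :≤ SS ∷ W :≡ con 1 :+ SS ∷ [] ⊢ false)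
          (S * k) (W * (ℓ * k)) (W * sumOf (suc i) l) (r (suc i) * c l) (S * S) W
          (subst (_≤ perturbed (suc i) l) (expand S W ℓ k) (proj₁ (between i l)))
          (subst (_≤ W * (ℓ * k)) (trans (ℕP.*-suc W _) (ℕP.+-comm W _))
            (ℕP.*-monoʳ-≤ W (total-< e k F (λ u u∈ → ℕP.≤-trans (close u v u∈ v∈ i l) h) v v∈ h)))
          (cornerEntry≤ (suc i) l) refl
          where
          expand : ∀ S W ℓ k → (S + W * ℓ) * k ≡ S * k + W * (ℓ * k)
          expand = solve-∀
        high : ¬ (suc k < e v)
        high h = linarith 6 (λ SK WlK WT rc SS W → rc :+ WT :≤ SK :+ WlK ∷ WlK :+ W :≤ WT ∷ SK :≤ SS ∷ W :≡ con 1 :+ SS ∷ [] ⊢ false)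
          (S * suc k) (W * (ℓ * suc k)) (W * sumOf (suc i) l) (r (suc i) * c l) (S * S) W
          (subst (perturbed (suc i) l ≤_) (expand S W ℓ (suc k)) (proj₂ (between i l)))
          (subst (_≤ W * sumOf (suc i) l) (trans (ℕP.*-suc W _) (ℕP.+-comm W _))
            (ℕP.*-monoʳ-≤ W (<-total e (suc k) F (λ u u∈ → ℕP.≤-pred (ℕP.≤-trans h (close v u v∈ u∈ i l))) v v∈ h)))
          (ℕP.*-monoʳ-≤ S (ℕP.≤-trans (ℕP.<⇒≤ h) (entry-bound {ent v} (All.lookup pF v∈) (suc i) l))) refl
          where
          expand : ∀ S W ℓ k → (S + W * ℓ) * k ≡ S * k + W * (ℓ * k)
          expand = solve-∀

      module InCell (o₁ o₂ : Bool) (K : Mat) (cell : IsCell o₁ o₂ K) (box : ∀ v → v ∈ F → InBox K v) where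

        point : Position → LMat
        point p = build (cellPoint o₁ o₂ K p)

        occupied : Position → Bool
        occupied p = ⌊ point p ∈? F ⌋

        -- At a position that is not allowed, truncated subtraction in row 0 spoils a column sum, so
        -- the resulting matrix cannot be a member of `F`.
        occupied-allowed : ∀ p → T (occupied p) → T (allowed o₁ o₂ (tightness K) p)
        occupied-allowed p@(i , j) t = fits-allowed o₁ o₂ K i j λ l → linarith 7
          (λ z y₁ y₂ s k₁ k₂ c → z :+ ((k₁ :+ y₁) :+ (k₂ :+ y₂)) :≡ c ∷ con 1 :+ (s :+ (k₁ :+ k₂)) :≡ c ∷ []
            ⊢ y₁ :+ y₂ :≤ con 1 :+ s)
          (cellPoint o₁ o₂ K p 0F l) (corner o₁ i l) (corner o₂ j l) (K 0F l) (K 1F l) (K 2F l) (c l)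
          (proj₂ margins l) (proj₁ cell l)
          where
          margins : Margins r c (cellPoint o₁ o₂ K p)
          margins = margins-≗ (λ i j → sym (ent-build (cellPoint o₁ o₂ K p) i j))
            (All.lookup pF (toWitness {a? = point p ∈? F} t))

        swapped-sum : ∀ i j k l →
          T (allowed o₁ o₂ (tightness K) (i , j)) → T (allowed o₁ o₂ (tightness K) (k , l)) →
          T (allowed o₁ o₂ (tightness K) (i , l)) → T (allowed o₁ o₂ (tightness K) (k , j)) → ∀ a b →
          cellPoint o₁ o₂ K (i , l) a b + cellPoint o₁ o₂ K (k , j) a b ≡
          cellPoint o₁ o₂ K (i , j) a b + cellPoint o₁ o₂ K (k , l) a b
        swapped-sum i j k l ij kl il kj 1F b = refl
        swapped-sum i j k l ij kl il kj 2F b = ℕP.+-comm (K 2F b + corner o₂ l b) _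
        swapped-sum i j k l ij kl il kj 0F b = linarith 9
          (λ z₁ z₂ z₃ z₄ s yi yk yj yl →
            z₁ :+ (yi :+ yl) :≡ s ∷ z₂ :+ (yk :+ yj) :≡ s ∷ z₃ :+ (yi :+ yj) :≡ s ∷ z₄ :+ (yk :+ yl) :≡ s ∷ []
            ⊢ z₁ :+ z₂ :≡ z₃ :+ z₄)
          (cellPoint o₁ o₂ K (i , l) 0F b) (cellPoint o₁ o₂ K (k , j) 0F b)
          (cellPoint o₁ o₂ K (i , j) 0F b) (cellPoint o₁ o₂ K (k , l) 0F b)
          (suc (K 0F b)) (corner o₁ i b) (corner o₁ k b) (corner o₂ j b) (corner o₂ l b)
          (slack i l il) (slack k j kj) (slack i j ij) (slack k l kl)
          where
          slack : ∀ i j → T (allowed o₁ o₂ (tightness K) (i , j)) →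
                  cellPoint o₁ o₂ K (i , j) 0F b + (corner o₁ i b + corner o₂ j b) ≡ suc (K 0F b)
          slack i j t = ℕP.m∸n+n≡m (allowed-fits o₁ o₂ K i j t b)

        -- Exchanging the second corners keeps the sum of the two points and hence the total of the
        -- affine part of the height. A cheaper exchange would lower the height, against
        -- irreducibility.
        no-conflict : ∀ p q → T (occupied p) → T (occupied q) → ¬ T (conflict o₁ o₂ (tightness K) p q)
        no-conflict p@(i , j) q@(k , l) tp tq t = irr (point p) (point q)
          (toWitness {a? = point p ∈? F} tp) (toWitness {a? = point q ∈? F} tq) distinct
          (reducible {point p} {point q} (cellPoint o₁ o₂ K (i , l)) (cellPoint o₁ o₂ K (k , j))
            (cellPoint-margins o₁ o₂ K (i , l) cell il) (cellPoint-margins o₁ o₂ K (k , j) cell kj)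
            (λ a b → trans (sums a b) (sym (cong₂ _+_ (ent-build (cellPoint o₁ o₂ K p) a b) (ent-build (cellPoint o₁ o₂ K q) a b))))
            (subst (heightOf (cellPoint o₁ o₂ K (i , l)) + heightOf (cellPoint o₁ o₂ K (k , j)) <_)
              (sym (cong₂ _+_ (ω-build (cellPoint o₁ o₂ K p)) (ω-build (cellPoint o₁ o₂ K q)))) lower))
          where
          il = proj₁ (T-∧⁻ {allowed o₁ o₂ (tightness K) (i , l)} t)
          rest = proj₂ (T-∧⁻ {allowed o₁ o₂ (tightness K) (i , l)} t)
          kj = proj₁ (T-∧⁻ {allowed o₁ o₂ (tightness K) (k , j)} rest)
          cheaper : cellCost o₁ o₂ i l + cellCost o₁ o₂ k j < cellCost o₁ o₂ i j + cellCost o₁ o₂ k l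
          cheaper = ℕP.≤ᵇ⇒≤ _ _ (proj₂ (T-∧⁻ {allowed o₁ o₂ (tightness K) (k , j)} rest))
          sums = swapped-sum i j k l (occupied-allowed p tp) (occupied-allowed q tq) il kj
          -- Equal points would have `i ≡ k`; the exchange would then only permute the two costs and
          -- could not be cheaper.
          distinct : point p ≢ point q
          distinct e = sameRow
            (corner-injective o₁ i k (ℕP.+-cancelˡ-≡ (K 1F i) (corner o₁ i i) (corner o₁ k i)
              (trans (sym (ent-build (cellPoint o₁ o₂ K p) 1F i))
                (trans (cong (λ M → ent M 1F i) e) (ent-build (cellPoint o₁ o₂ K q) 1F i))))) cheaper
            where
            sameRow : ∀ {k} → i ≡ k → ¬ (cellCost o₁ o₂ i l + cellCost o₁ o₂ k j < cellCost o₁ o₂ i j + cellCost o₁ o₂ k l)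
            sameRow refl = ℕP.<-irrefl (ℕP.+-comm (cellCost o₁ o₂ i l) (cellCost o₁ o₂ i j))
          lower : heightOf (cellPoint o₁ o₂ K (i , l)) + heightOf (cellPoint o₁ o₂ K (k , j)) <
                  heightOf (cellPoint o₁ o₂ K p) + heightOf (cellPoint o₁ o₂ K q)
          lower = ℤP.drop‿+<+ (subst₂ ℤ._<_
            (sym (trans (cong₂ ℤ._+_ (at (i , l)) (at (k , j)))
              (trans (regroup (support (⁺⁺ cellPoint o₁ o₂ K (i , l))) (support (⁺⁺ cellPoint o₁ o₂ K (k , j)))
                (ℤ.+ cellCost o₁ o₂ i l) (ℤ.+ cellCost o₁ o₂ k j) (v₁ i) (v₂ l) (v₁ k) (v₂ j))
              (cong₂ (λ a b → (a ℤ.+ (ℤ.+ (cellCost o₁ o₂ i l + cellCost o₁ o₂ k j))) ℤ.- b) same-support refl))))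
            (sym (trans (cong₂ ℤ._+_ (at p) (at q))
              (regroup' (support (⁺⁺ cellPoint o₁ o₂ K p)) (support (⁺⁺ cellPoint o₁ o₂ K q))
                (ℤ.+ cellCost o₁ o₂ i j) (ℤ.+ cellCost o₁ o₂ k l) (v₁ i) (v₂ j) (v₁ k) (v₂ l))))
            (ℤP.+-monoˡ-< (ℤ.- (v₁ i ℤ.+ v₁ k ℤ.+ (v₂ j ℤ.+ v₂ l)))
              (ℤP.+-monoʳ-< (support (⁺⁺ cellPoint o₁ o₂ K p) ℤ.+ support (⁺⁺ cellPoint o₁ o₂ K q)) (ℤ.+<+ cheaper))))
            where
            -- Any potential splits the height into an affine part and corner costs; with the zero
            -- potential these are the plain costs that `conflict` compares.
            π : Potential
            π = Vec.replicate 3 (ℤ.+ 0) , Vec.replicate 3 (ℤ.+ 0)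
            v₁ v₂ : Fin 3 → ℤ
            v₁ = lookup (proj₁ π)
            v₂ = lookup (proj₂ π)
            open Support N o₁ o₂ K π
            at = support-cellPoint o₁ o₂ K π
            regroup : ∀ s s' c c' a b a' b' → (s ℤ.+ (c ℤ.- (a ℤ.+ b))) ℤ.+ (s' ℤ.+ (c' ℤ.- (a' ℤ.+ b'))) ≡
                      ((s ℤ.+ s') ℤ.+ (c ℤ.+ c')) ℤ.- (a ℤ.+ a' ℤ.+ (b' ℤ.+ b))
            regroup = ℤSolver.solve-∀
            regroup' : ∀ s s' c c' a b a' b' → (s ℤ.+ (c ℤ.- (a ℤ.+ b))) ℤ.+ (s' ℤ.+ (c' ℤ.- (a' ℤ.+ b'))) ≡
                       ((s ℤ.+ s') ℤ.+ (c ℤ.+ c')) ℤ.- (a ℤ.+ a' ℤ.+ (b ℤ.+ b'))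
            regroup' = ℤSolver.solve-∀
            same-support : support (⁺⁺ cellPoint o₁ o₂ K (i , l)) ℤ.+ support (⁺⁺ cellPoint o₁ o₂ K (k , j)) ≡
                           support (⁺⁺ cellPoint o₁ o₂ K p) ℤ.+ support (⁺⁺ cellPoint o₁ o₂ K q)
            same-support = affine-sums affine-support
              {⁺⁺ cellPoint o₁ o₂ K (i , l)} {⁺⁺ cellPoint o₁ o₂ K (k , j)}
              {⁺⁺ cellPoint o₁ o₂ K p} {⁺⁺ cellPoint o₁ o₂ K q} λ a b → cong ℤ.+_ (sums a b)

        inSimplex : ∃ λ es → es ∈ trees × T (optimal o₁ o₂ (tightness K) es) × All (λ v → v VM.∈ simplex o₁ o₂ K es) F
        inSimplex =
          let es , es∈ , opt , covers = flag-sound {optimal o₁ o₂ (tightness K)} {allowed o₁ o₂ (tightness K)}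
                {conflict o₁ o₂ (tightness K)} occupied no-conflict trees ps
                (∨-resolve {admissible o₁ o₂ (tightness K)} (flagCells-sound trees ps checked o₁ o₂ (tightness K))
                  (proj₂ (proj₂ (proj₂ cell)))) occupied-allowed
          in es , es∈ , opt , All.tabulate λ {v} v∈ →
               let p , _ , h = box-point o₁ o₂ K v cell (All.lookup pF v∈) (box v v∈)
                   v≡ = build-unique v (cellPoint o₁ o₂ K p) h
               in subst (λ M → M VM.∈ simplex o₁ o₂ K es) (sym v≡)
                    (VMP.∈-map⁺ point (isIn-sound p es (covers p (all∈ p)
                      (fromWitness {a? = point p ∈? F} (subst (_∈ F) v≡ v∈)))))

      -- Covering and flagness both rest on this. The empty family is included: then `perturbed` is
      -- the interior matrix with entries rᵢ cⱼ, and a cell around it provides the simplex.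
      irreducible-face : ∃ λ σ → σ ∈ allSimplices × All (λ v → v VM.∈ σ) F
      irreducible-face =
        let o₁ , o₂ , K , cell , b₁ , b₂ = locate D perturbed perturbed-margins perturbed-pos
            cell' = isCell-build {o₁} {o₂} {K} cell
            box : ∀ v → v ∈ F → InBox (ent (build K)) v
            box v v∈ i l = let lo , hi = in-box K b₁ b₂ v v∈ i l in
              subst (_≤ ent v (suc i) l) (sym (ent-build K (suc i) l)) lo ,
              subst (λ k → ent v (suc i) l ≤ suc k) (sym (ent-build K (suc i) l)) hi
            es , es∈ , opt , inside = InCell.inSimplex o₁ o₂ (ent (build K)) cell' box
        in simplex o₁ o₂ (ent (build K)) es , simplex∈ o₁ o₂ (build K) es cell' es∈ opt , inside

open Flagness

-- Covering of the rational points and assembly of the quadratic triangulation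

module Triangulation where

  open import Data.Integer using (+_; -[1+_])
  open import Data.Nat using (_+_; _*_; _≤_; _<_)
  open import Data.Nat.Tactic.RingSolver using (solve-∀)
  open import Data.Rational.Solver using (module +-*-Solver)

  Clears : ℕ → ℚ → Set
  Clears D x = ∃ λ n → x ℚ.* ℕtoℚ D ≡ ℕtoℚ n

  ℕtoℚ-* : ∀ m n → ℕtoℚ (m * n) ≡ ℕtoℚ m ℚ.* ℕtoℚ n
  ℕtoℚ-* m n = trans (cong toℚ (ℤP.pos-* m n)) (toℚ-* (+ m) (+ n))

  clears-multiple : ∀ x D E → Clears D x → Clears (D * E) x
  clears-multiple x D E (n , e) = n * E , trans (cong (x ℚ.*_) (ℕtoℚ-* D E))
    (trans (sym (ℚP.*-assoc x (ℕtoℚ D) (ℕtoℚ E))) (trans (cong (ℚ._* ℕtoℚ E) e) (sym (ℕtoℚ-* n E))))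

  clearing : ∀ x → 0ℚ ℚ.≤ x → ∃ λ D → 0 < D × Clears D x
  clearing x@(mkℚ (+ n) d _) _ = suc d , s≤s z≤n , n , ℚP.toℚᵘ-injective (ℚᵘP.≃-trans
    (ℚP.toℚᵘ-homo-* x (ℕtoℚ (suc d)))
    (ℚᵘP.≃-trans (ℚᵘP.*-congˡ {ℚ.toℚᵘ x} (toℚᵘ-toℚ (+ suc d)))
      (ℚᵘP.≃-trans (*≡* (trans (ℤP.*-identityʳ _) (cong (λ k → + n ℤ.* + suc k) (sym (ℕP.*-identityʳ d)))))
                   (ℚᵘP.≃-sym (toℚᵘ-toℚ (+ n))))))
  clearing (mkℚ -[1+ n ] d _) (ℚ.*≤* ())

  common : ∀ (P : Fin 3 → ℕ → Set) → (∀ i D E → P i D → P i (D * E)) → (∀ i → ∃ λ D → 0 < D × P i D) →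
           ∃ λ D → 0 < D × (∀ i → P i D)
  common P multiple h =
    let a , a-pos , pa = h 0F
        b , b-pos , pb = h 1F
        c , c-pos , pc = h 2F
    in a * b * c , ℕP.*-mono-< (ℕP.*-mono-< a-pos b-pos) c-pos ,
       ∀3 (multiple 0F (a * b) c (multiple 0F a b pa))
          (multiple 1F (a * b) c (subst (P 1F) (ℕP.*-comm b a) (multiple 1F b a pb)))
          (subst (P 2F) (ℕP.*-comm c (a * b)) (multiple 2F c (a * b) pc))

  commonDenominator : ∀ (X : QMat) → (∀ i j → 0ℚ ℚ.≤ X i j) → ∃ λ D → 0 < D × (∀ i j → Clears D (X i j))
  commonDenominator X h = common (λ i D → ∀ j → Clears D (X i j)) (λ i D E p j → clears-multiple (X i j) D E (p j))
    λ i → common (λ j D → Clears D (X i j)) (λ j → clears-multiple (X i j)) (λ j → clearing (X i j) (h i j))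

  sum3-cleared : ∀ D (x : Fin 3 → ℚ) (n : Fin 3 → ℕ) s → (∀ i → x i ℚ.* ℕtoℚ D ≡ ℕtoℚ (n i)) →
                 sum3ℚ x ≡ ℕtoℚ s → sum3ℕ n ≡ D * s
  sum3-cleared D x n s h e = ℤP.+-injective (toℚ-injective (trans (toℚ-sum3 (λ i → + n i)) (trans
    (sym (cong₂ ℚ._+_ (h 0F) (cong₂ ℚ._+_ (h 1F) (h 2F)))) (trans
    (factor (x 0F) (x 1F) (x 2F) (ℕtoℚ D)) (trans (cong (ℕtoℚ D ℚ.*_) e) (sym (ℕtoℚ-* D s)))))))
    where
    open +-*-Solver using (solve; _:=_) renaming (_:+_ to _⊕_; _:*_ to _⊗_)
    factor : ∀ a b c d → a ℚ.* d ℚ.+ (b ℚ.* d ℚ.+ c ℚ.* d) ≡ d ℚ.* (a ℚ.+ (b ℚ.+ c))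
    factor = solve 4 (λ a b c d → a ⊗ d ⊕ (b ⊗ d ⊕ c ⊗ d) := d ⊗ (a ⊕ (b ⊕ c))) refl

  sum5ℕ : (Fin 5 → ℕ) → ℕ
  sum5ℕ f = f zero + (f (suc zero) + sum3ℕ (λ k → f (suc (suc k))))

  unitℕ : ∀ {n} → Fin n → Fin n → ℕ
  unitℕ zero    zero    = 1
  unitℕ (suc k) (suc m) = unitℕ k m
  unitℕ _       _       = 0

  sum5ℕ-cong : ∀ {f g : Fin 5 → ℕ} → (∀ k → f k ≡ g k) → sum5ℕ f ≡ sum5ℕ g
  sum5ℕ-cong h = cong₂ _+_ (h zero) (cong₂ _+_ (h (suc zero)) (sum3ℕ-cong λ k → h (suc (suc k))))

  sum5ℕ-+ : ∀ (f g : Fin 5 → ℕ) → sum5ℕ (λ k → f k + g k) ≡ sum5ℕ f + sum5ℕ g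
  sum5ℕ-+ f g = linarith 10
    (λ a b c d e a' b' c' d' e' → []
      ⊢ (a :+ a') :+ ((b :+ b') :+ ((c :+ c') :+ ((d :+ d') :+ (e :+ e')))) :≡
        (a :+ (b :+ (c :+ (d :+ e)))) :+ (a' :+ (b' :+ (c' :+ (d' :+ e')))))
    (f 0F) (f 1F) (f 2F) (f (suc 2F)) (f (suc (suc 2F))) (g 0F) (g 1F) (g 2F) (g (suc 2F)) (g (suc (suc 2F)))

  sum5ℕ-unit : ∀ k (f : Fin 5 → ℕ) → sum5ℕ (λ m → unitℕ k m * f m) ≡ f k
  sum5ℕ-unit 0F f = linarith 5 (λ a b c d e → [] ⊢ 1 :* a :+ (0 :* b :+ (0 :* c :+ (0 :* d :+ (0 :* e)))) :≡ a)
    (f 0F) (f 1F) (f 2F) (f (suc 2F)) (f (suc (suc 2F)))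
  sum5ℕ-unit 1F f = linarith 5 (λ a b c d e → [] ⊢ 0 :* a :+ (1 :* b :+ (0 :* c :+ (0 :* d :+ (0 :* e)))) :≡ b)
    (f 0F) (f 1F) (f 2F) (f (suc 2F)) (f (suc (suc 2F)))
  sum5ℕ-unit 2F f = linarith 5 (λ a b c d e → [] ⊢ 0 :* a :+ (0 :* b :+ (1 :* c :+ (0 :* d :+ (0 :* e)))) :≡ c)
    (f 0F) (f 1F) (f 2F) (f (suc 2F)) (f (suc (suc 2F)))
  sum5ℕ-unit (suc 2F) f = linarith 5 (λ a b c d e → [] ⊢ 0 :* a :+ (0 :* b :+ (0 :* c :+ (1 :* d :+ (0 :* e)))) :≡ d)
    (f 0F) (f 1F) (f 2F) (f (suc 2F)) (f (suc (suc 2F)))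
  sum5ℕ-unit (suc (suc 2F)) f = linarith 5 (λ a b c d e → [] ⊢ 0 :* a :+ (0 :* b :+ (0 :* c :+ (0 :* d :+ (1 :* e)))) :≡ e)
    (f 0F) (f 1F) (f 2F) (f (suc 2F)) (f (suc (suc 2F)))

  increment : Fin 5 → (Fin 5 → ℕ) → Fin 5 → ℕ
  increment k w m = unitℕ k m + w m

  sum5ℕ-increment : ∀ k w (f : Fin 5 → ℕ) → sum5ℕ (λ m → increment k w m * f m) ≡ f k + sum5ℕ (λ m → w m * f m)
  sum5ℕ-increment k w f = trans (sum5ℕ-cong λ m → ℕP.*-distribʳ-+ (f m) (unitℕ k m) (w m))
    (trans (sum5ℕ-+ (λ m → unitℕ k m * f m) (λ m → w m * f m)) (cong (_+ sum5ℕ (λ m → w m * f m)) (sum5ℕ-unit k f)))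

  -- One weight vector serves every `f`: at the entries it gives the convex combination, at the
  -- constant 1 the sum of the weights.
  multiplicities : ∀ (σ : Simplex) L → All (λ M → M VM.∈ σ) L →
    ∃ λ (w : Fin 5 → ℕ) → ∀ (f : LMat → ℕ) → total f L ≡ sum5ℕ (λ k → w k * f (vert σ k))
  multiplicities σ [] [] = (λ _ → 0) , λ f → refl
  multiplicities σ (M ∷ L) (M∈ ∷ L∈) =
    let w , h = multiplicities σ L L∈
        k = VAny.index M∈
    in increment k w , λ f → trans (cong₂ _+_ (cong f (VAnyP.lookup-index M∈)) (h f))
                               (sym (sum5ℕ-increment k w (λ m → f (vert σ m))))

  total-one : ∀ {A : Set} (L : List A) → total (λ _ → 1) L ≡ length L
  total-one []      = refl
  total-one (_ ∷ L) = cong suc (total-one L)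

  ℕtoℚ-sum5 : ∀ f → ℕtoℚ (sum5ℕ f) ≡ sum5ℚ (λ k → ℕtoℚ (f k))
  ℕtoℚ-sum5 f = trans (toℚ-+ (+ f 0F) (+ (f 1F + sum3ℕ (λ k → f (suc (suc k))))))
    (cong (ℕtoℚ (f 0F) ℚ.+_) (trans (toℚ-+ (+ f 1F) (+ sum3ℕ (λ k → f (suc (suc k)))))
      (cong (ℕtoℚ (f 1F) ℚ.+_) (toℚ-sum3 (λ k → + f (suc (suc k)))))))

  sum5ℚ-scale : ∀ (a b : Fin 5 → ℚ) q → sum5ℚ (λ k → a k ℚ.* b k) ℚ.* q ≡ sum5ℚ (λ k → (a k ℚ.* q) ℚ.* b k)
  sum5ℚ-scale a b q = identity (a 0F) (a 1F) (a 2F) (a (suc 2F)) (a (suc (suc 2F)))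
                               (b 0F) (b 1F) (b 2F) (b (suc 2F)) (b (suc (suc 2F))) q
    where
    open +-*-Solver using (solve; _:=_) renaming (_:+_ to _⊕_; _:*_ to _⊗_)
    identity : ∀ a₀ a₁ a₂ a₃ a₄ b₀ b₁ b₂ b₃ b₄ q → _
    identity = solve 11 (λ a₀ a₁ a₂ a₃ a₄ b₀ b₁ b₂ b₃ b₄ q →
      (a₀ ⊗ b₀ ⊕ (a₁ ⊗ b₁ ⊕ (a₂ ⊗ b₂ ⊕ (a₃ ⊗ b₃ ⊕ a₄ ⊗ b₄)))) ⊗ q :=
      (a₀ ⊗ q) ⊗ b₀ ⊕ ((a₁ ⊗ q) ⊗ b₁ ⊕ ((a₂ ⊗ q) ⊗ b₂ ⊕ ((a₃ ⊗ q) ⊗ b₃ ⊕ (a₄ ⊗ q) ⊗ b₄)))) refl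

  sum5ℚ-cong : ∀ {f g : Fin 5 → ℚ} → (∀ k → f k ≡ g k) → sum5ℚ f ≡ sum5ℚ g
  sum5ℚ-cong h = cong₂ ℚ._+_ (h zero) (cong₂ ℚ._+_ (h (suc zero))
    (cong₂ ℚ._+_ (h (suc (suc 0F))) (cong₂ ℚ._+_ (h (suc (suc 1F))) (h (suc (suc 2F))))))

  -- The barycentric coordinates are the multiplicities of the vertices in `L`, divided by `D`.
  average-InConv : ∀ D → 0 < D → ∀ σ L → All (λ M → M VM.∈ σ) L → length L ≡ D → ∀ X →
    (∀ i j → X i j ℚ.* ℕtoℚ D ≡ ℕtoℚ (total (λ M → entry M i j) L)) → InConv X σ
  average-InConv D D-pos σ L L∈ len X h =
    (λ k → ℕtoℚ (w k) ℚ.* q⁻¹) ,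
    (λ k → subst (ℚ._≤ ℕtoℚ (w k) ℚ.* q⁻¹) (ℚP.*-zeroˡ q⁻¹)
      (ℚP.*-monoʳ-≤-nonNeg q⁻¹ {{ℚP.pos⇒nonNeg q⁻¹ {{ℚP.1/pos⇒pos q}}}} (toℚ-mono-≤ {+ 0} {+ w k} (ℤ.+≤+ z≤n)))) ,
    trans (sum5ℚ-cong λ k → sym (ℚP.*-identityʳ (ℕtoℚ (w k) ℚ.* q⁻¹)))
      (trans (sym (sum5ℚ-scale (λ k → ℕtoℚ (w k)) (λ _ → 1ℚ) q⁻¹))
        (trans (cong (ℚ._* q⁻¹) (trans (sum5ℚ-cong λ k → sym (ℕtoℚ-* (w k) 1)) (trans (sym (ℕtoℚ-sum5 (λ k → w k * 1)))
            (cong ℕtoℚ (trans (sym (count-all (λ _ → 1))) (trans (total-one L) len))))))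
          (ℚP.*-inverseʳ q))) ,
    λ i j → trans (sym (ℚP.*-identityʳ (X i j))) (trans (cong (X i j ℚ.*_) (sym (ℚP.*-inverseʳ q)))
      (trans (sym (ℚP.*-assoc (X i j) q q⁻¹)) (trans (cong (ℚ._* q⁻¹) (trans (h i j) (trans (cong ℕtoℚ (count-all (λ M → entry M i j)))
          (trans (ℕtoℚ-sum5 (λ k → w k * entry (vert σ k) i j)) (sum5ℚ-cong λ k → ℕtoℚ-* (w k) (entry (vert σ k) i j))))))
        (sum5ℚ-scale (λ k → ℕtoℚ (w k)) (λ k → ℕtoℚ (entry (vert σ k) i j)) q⁻¹))))
    where
    w : Fin 5 → ℕ
    w = proj₁ (multiplicities σ L L∈)
    count-all : ∀ (f : LMat → ℕ) → total f L ≡ sum5ℕ (λ k → w k * f (vert σ k))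
    count-all = proj₂ (multiplicities σ L L∈)
    q : ℚ
    q = ℕtoℚ D
    instance
      q-pos : ℚ.Positive q
      q-pos = ℚ.positive (toℚ-mono-< {+ 0} {+ D} (ℤ.+<+ D-pos))
      q-nonZero : ℚ.NonZero q
      q-nonZero = ℚP.pos⇒nonZero q
    q⁻¹ : ℚ
    q⁻¹ = ℚ.1/ q
    toℚ-mono-≤ : ∀ {a b} → a ℤ.≤ b → toℚ a ℚ.≤ toℚ b
    toℚ-mono-≤ {a} {b} h with a ℤ.≟ b
    ... | yes refl = ℚP.≤-refl
    ... | no a≢b   = ℚP.<⇒≤ (toℚ-mono-< (ℤP.≤∧≢⇒< h a≢b))

  allPairs-lookup : ∀ {A : Set} {R : A → A → Set} → (∀ {x y} → R x y → R y x) → ∀ {L} → AllPairs R L →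
                    ∀ x y → x ∈ L → y ∈ L → x ≢ y → R x y
  allPairs-lookup symm (_ ∷ _)  x y (here refl) (here refl) x≢y = ⊥-elim (x≢y refl)
  allPairs-lookup symm (h ∷ _)  x y (here refl) (there y∈)  _   = All.lookup h y∈
  allPairs-lookup symm (h ∷ _)  x y (there x∈)  (here refl) _   = symm (All.lookup h x∈)
  allPairs-lookup symm (_ ∷ hs) x y (there x∈)  (there y∈)  x≢y = allPairs-lookup symm hs x y x∈ y∈ x≢y

  pigeonhole : ∀ {A : Set} {x y z a b : A} → x ≢ y → x ≢ z → y ≢ z →
               x ∈ a ∷ b ∷ [] → y ∈ a ∷ b ∷ [] → z ∈ a ∷ b ∷ [] → ⊥
  pigeonhole x≢y _ _ (here refl) (here refl) _ = x≢y refl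
  pigeonhole x≢y _ _ (there (here refl)) (there (here refl)) _ = x≢y refl
  pigeonhole _ x≢z _ (here refl) (there (here refl)) (here refl) = x≢z refl
  pigeonhole _ _ y≢z (here refl) (there (here refl)) (there (here refl)) = y≢z refl
  pigeonhole _ x≢z _ (there (here refl)) (here refl) (there (here refl)) = x≢z refl
  pigeonhole _ _ y≢z (there (here refl)) (here refl) (here refl) = y≢z refl

  module Main (i₀ : Fin 3) (r₀ c : Fin 3 → ℕ) (r₀-pos : ∀ i → 0 < r₀ i) (c-pos : ∀ j → 0 < c j)
              (r₀≡c : sum3ℕ r₀ ≡ sum3ℕ c) (2≤r : 2 ≤ r₀ i₀)
              (trees : List Edges) (spans : ∀ es → es ∈ trees → T (spansFlows es))
              (ps : List Position) (checked : T (flagCells trees ps)) (all∈ : ∀ p → p ∈ ps) where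

    ι : Involution
    ι = swapping i₀

    open Involution ι

    r : Fin 3 → ℕ
    r = r₀ ∘ to

    r≡c : sum3ℕ r ≡ sum3ℕ c
    r≡c = trans (sum-to r₀) r₀≡c

    2≤r₀ : 2 ≤ r 0F
    2≤r₀ = subst (λ i → 2 ≤ r₀ i) (sym (transposition-0 i₀)) 2≤r

    open Points ι r c
    open Simplices ι r c r≡c trees
    open Unimodularity ι r c r≡c trees spans
    open Flag ι r c r≡c (r₀-pos ∘ to) c-pos 2≤r₀ trees ps checked all∈

    point⇒InT : ∀ {M} → IsPoint M → InT r₀ c M
    point⇒InT {M} (rows , columns) =
      (λ i → subst (λ k → sum3ℕ (entry M k) ≡ r₀ k) (involutive i) (rows (to i))) ,
      (λ j → trans (sym (sum-to (λ i → entry M i j))) (columns j))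

    InT⇒point : ∀ {M} → InT r₀ c M → IsPoint M
    InT⇒point {M} (rows , columns) = (λ i → rows (to i)) , (λ j → trans (sum-to (λ i → entry M i j)) (columns j))

    decompose : ∀ D n → Margins (λ i → D * r i) (λ j → D * c j) n →
      ∃ λ L → All IsPoint L × length L ≡ D × (∀ i j → total (λ M → ent M i j) L ≡ n i j) × Irreducible L
    decompose D n nm =
      let v₀ , vm₀ = latticePoint r c r≡c
          L₀ , len₀ , ms , sums = integerDecomposition {v₀ = v₀} vm₀ D n nm
          L , pL , (len , tot) , irr = descend (List.map build L₀) (AllP.map⁺ (All.map (λ {x} → build-point {x}) ms))
      in L , pL , trans len (trans (ListP.length-map build L₀) len₀) ,
         (λ i j → trans (tot i j) (trans (total-build L₀ i j) (sums i j))) , irr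
      where
      total-build : ∀ L i j → total (λ M → ent M i j) (List.map build L) ≡ sumAt L i j
      total-build []      i j = refl
      total-build (x ∷ L) i j = cong₂ _+_ (ent-build x i j) (total-build L i j)

    covering : ∀ X → InTℚ r₀ c X → ∃ λ σ → σ ∈ allSimplices × InConv X σ
    covering X (X≥0 , rows , columns) =
      let D , D-pos , clears = commonDenominator X X≥0
          n : Mat
          n i j = proj₁ (clears i j)
          L , pL , len , tot , irr = decompose D (n ∘ to)
            ((λ i → sum3-cleared D (X (to i)) (n (to i)) (r i) (λ j → proj₂ (clears (to i) j)) (rows (to i))) ,
             (λ j → trans (sum-to (λ i → n i j))
               (sum3-cleared D (λ i → X i j) (λ i → n i j) (c j) (λ i → proj₂ (clears i j)) (columns j))))
          σ , σ∈ , inside = irreducible-face L pL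
            (allPairs-lookup (λ {a} {b} h → h ∘ reducible-sym {b} {a}) irr)
      in σ , σ∈ , average-InConv D D-pos σ L inside len X λ i j → trans (proj₂ (clears i j)) (cong ℕtoℚ (sym
           (trans (cong (λ k → total (λ M → entry M k j) L) (sym (involutive i)))
             (trans (tot (to i) j) (cong (λ k → n k j) (involutive i))))))

    triangulation : RegUnimodTriang r₀ c
    triangulation = record
      { simplices  = allSimplices
      ; vertsInT   = λ σ σ∈ k → point⇒InT {vert σ k} (vertex-point (cell-of σ σ∈) k)
      ; unimodular = λ σ σ∈ → unimodular (cell-of σ σ∈)
      ; covers     = covering
      ; height     = height
      ; lowerFacet = λ σ σ∈ → let C = cell-of σ σ∈ in
          facet C , facet-vertex C , λ M inT M∉σ → facet-below C M (InT⇒point {M} inT) M∉σ }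

    -- Among three or more elements every pair is a proper subset by `pigeonhole`, hence a face and
    -- irreducible, so the whole family is a face. At most one element leaves no distinct pair to be
    -- reducible.
    quadratic : IsQuadratic triangulation
    quadratic [] (_ , inT , ¬face , _) = ⊥-elim (¬face (irreducible-face [] [] λ _ _ ()))
    quadratic (x ∷ []) (_ , inT , ¬face , _) = ⊥-elim (¬face (irreducible-face (x ∷ []) (All.map (λ {M} → InT⇒point {M}) inT)
      λ { a b (here refl) (here refl) a≢b _ → a≢b refl }))
    quadratic (_ ∷ _ ∷ []) _ = refl
    quadratic F@(x ∷ y ∷ z ∷ L) (((x≢y ∷ x≢z ∷ _) ∷ (y≢z ∷ _) ∷ _) , inT , ¬face , minimal) =
      ⊥-elim (¬face (irreducible-face F (All.map (λ {M} → InT⇒point {M}) inT) λ a b a∈ b∈ _ →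
        let σ , σ∈ , h = minimal (a ∷ b ∷ []) (a∈ ∷ b∈ ∷ [])
              λ { (hx ∷ hy ∷ hz ∷ _) → pigeonhole x≢y x≢z y≢z hx hy hz }
        in members-irreducible (cell-of σ σ∈) a b (All.head h) (All.head (All.tail h))))

    quadraticTriangulation : HasQuadraticTriangulation r₀ c
    quadraticTriangulation = triangulation , quadratic

  opaque
    unfolding flowPotentials costPotential optimal
    -- The finite computation, over two orientations and three tightness bits; inadmissible
    -- combinations pass vacuously. Only here are the potentials unfolded.
    allCellsFlag : flagCells spanningTrees positions ≡ true
    allCellsFlag = refl

  spanningTrees-span : ∀ es → es ∈ spanningTrees → T (spansFlows es)
  spanningTrees-span es es∈ = proj₂ (∈P.∈-filter⁻ (T? ∘ spansFlows) {xs = choose 5 positions} es∈)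

  unit-columns : ∀ r c → (∀ i → r i ≡ 1) → (∀ j → 0 < c j) → sum3ℕ r ≡ sum3ℕ c → ∀ j → c j ≡ 1
  unit-columns r c r≡1 c-pos r≡c = ∀3
    (linarith 3 (λ a b c → a :+ (b :+ c) :≡ con 3 ∷ con 0 :< a ∷ con 0 :< b ∷ con 0 :< c ∷ [] ⊢ a :≡ con 1)
      (c 0F) (c 1F) (c 2F) c-sum (c-pos 0F) (c-pos 1F) (c-pos 2F))
    (linarith 3 (λ a b c → a :+ (b :+ c) :≡ con 3 ∷ con 0 :< a ∷ con 0 :< b ∷ con 0 :< c ∷ [] ⊢ b :≡ con 1)
      (c 0F) (c 1F) (c 2F) c-sum (c-pos 0F) (c-pos 1F) (c-pos 2F))
    (linarith 3 (λ a b c → a :+ (b :+ c) :≡ con 3 ∷ con 0 :< a ∷ con 0 :< b ∷ con 0 :< c ∷ [] ⊢ c :≡ con 1)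
      (c 0F) (c 1F) (c 2F) c-sum (c-pos 0F) (c-pos 1F) (c-pos 2F))
    where
    c-sum : sum3ℕ c ≡ 3
    c-sum = trans (sym r≡c) (cong₂ _+_ (r≡1 0F) (cong₂ _+_ (r≡1 1F) (r≡1 2F)))

open Triangulation

open import Data.Nat using (_<_)

theorem1p9 : (r c : Fin 3 → ℕ) → (∀ i → 0 < r i) → (∀ j → 0 < c j)
    → sum3ℕ r ≡ sum3ℕ c
    → ¬ (Σ ℕ λ k → (0 < k) × (∀ i → r i ≡ k) × (∀ j → c j ≡ k))
    → HasQuadraticTriangulation r c
theorem1p9 r c r-pos c-pos r≡c notMultiple with any? (λ i → 2 ℕ.≤? r i)
... | yes (i₀ , h) = Main.quadraticTriangulation i₀ r c r-pos c-pos r≡c h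
                       spanningTrees spanningTrees-span positions (Equivalence.from T-≡ allCellsFlag) position∈
... | no small = ⊥-elim (notMultiple (1 , s≤s z≤n , r≡1 , c≡1))
  where
  r≡1 : ∀ i → r i ≡ 1
  r≡1 i = ℕP.≤-antisym (ℕP.≤-pred (ℕP.≰⇒> λ h → small (i , h))) (r-pos i)
  c≡1 : ∀ j → c j ≡ 1
  c≡1 = unit-columns r c r≡1 c-pos r≡c
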